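{- For every tree $T$, $$\mathrm{ex}(n,K_3,T^{\triangle})=\left|\mathcal{S}_{\mathrm{bi}}(n,\sigma(T)-1)\right|+o(n^2).$$
   Context: For a graph $F$, $|F|$ is its number of edges and $F-I$ the subgraph induced on $V(F)\setminus I$. The crosscut number is $\sigma(F)=\min\{|I|+|F-I| : I \text{ independent in } F\}$. The $\triangle$-blowup $F^{\triangle}$ of a graph $F$ is obtained by replacing each edge $uv$ by a triangle $uvw_{uv}$ with a new vertex $w_{uv}$, distinct edges receiving distinct new vertices. $\mathrm{ex}(n,K_3,F^{\triangle})$ is the maximum number of triangles in an $n$-vertex graph with no copy of $F^{\triangle}$. $T(m)$ is the balanced complete bipartite graph on $m$ vertices, $S(n,t)=K_t\vee T(n-t)$ is the join of $K_t$ and $T(n-t)$, and $\mathcal{S}_{\mathrm{bi}}(n,t)$ is the set of triangles (vertex triples inducing $K_3$) of $S(n,t)$. -}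

module Defs where

open import Data.Empty using (⊥)
open import Data.Fin.Base using (Fin; zero; suc; inject₁; fromℕ; splitAt; _<_)
open import Data.Fin.Properties using (_≟_; _<?_; all?)
open import Data.Fin.Subset using (Subset; inside; outside; _∈_; ∣_∣) renaming (⊥ to ∅)
open import Data.Fin.Subset.Properties using (_∈?_; ∉⊥)
open import Data.List.Base
  using (List; []; _∷_; length; map; filter; allFin; cartesianProduct; cartesianProductWith)
  renaming (lookup to lookupList)
open import Data.List.Extrema.Nat using (min; max; min≤xs; argmin-sel; argmax-sel; xs≤max)
open import Data.List.Membership.Propositional using (lose) renaming (_∈_ to _∈ᴸ_)
open import Data.List.Membership.Propositional.Properties
  using (∈-cartesianProductWith⁺; ∈-allFin; ∈-filter⁺; ∈-filter⁻; ∈-map⁺; ∈-map⁻)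
open import Data.List.Properties using (filter-≐)
open import Data.List.Relation.Unary.All using () renaming (lookup to All-lookup)
open import Data.List.Relation.Unary.Any using (here; there; any?; satisfied)
open import Data.Nat.Base using (ℕ; zero; suc; _+_; _*_; _∸_; _≤_; ⌊_/2⌋; ⌈_/2⌉)
open import Data.Nat.Properties using (n≤0⇒n≡0; ≤-reflexive; ≤-trans)
open import Data.Product.Base using (∃-syntax; _×_; _,_; proj₁; proj₂)
open import Data.Sum.Base using (_⊎_; inj₁; inj₂; swap)
open import Data.Unit.Base using (⊤; tt)
open import Data.Vec.Base using (Vec; []; _∷_; lookup; tabulate)
open import Data.Vec.Properties using (lookup∘tabulate; lookup⇒[]=; []=⇒lookup)
open import Function.Base using (_∘_)
open import Function.Definitions using (Injective)
open import Level using (0ℓ)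
open import Relation.Binary.Construct.Closure.ReflexiveTransitive using (Star)
open import Relation.Binary.Core using (Rel)
open import Relation.Binary.Definitions using (Decidable; Symmetric)
open import Relation.Binary.PropositionalEquality
  using (_≡_; _≢_; refl; sym; trans; cong; subst₂)
open import Relation.Nullary using (¬_; Dec; yes; no; does)
open import Relation.Nullary.Decidable using (_×-dec_; _⊎-dec_; _→-dec_; ¬?; map′; dec-true)

infix 4 _=o_

record Graph (n : ℕ) : Set₁ where
  infix 4 _~_ _~?_
  field
    _~_    : Rel (Fin n) 0ℓ
    _~?_   : Decidable _~_
    ~-sym  : Symmetric _~_
    ~-irr  : ∀ {v} → ¬ (v ~ v)

edges : ∀ {n} → Graph n → List (Fin n × Fin n)
edges {n} G = filter (λ (u , v) → (u <? v) ×-dec (u ~? v))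
                     (cartesianProduct (allFin n) (allFin n))
  where open Graph G

IsTriangle : ∀ {n} → Graph n → Fin n × Fin n × Fin n → Set
IsTriangle G (u , v , w) = (u < v × v < w) × (u ~ v × v ~ w × u ~ w)
  where open Graph G

isTriangle? : ∀ {n} (G : Graph n) t → Dec (IsTriangle G t)
isTriangle? G (u , v , w) =
  ((u <? v) ×-dec (v <? w)) ×-dec ((u ~? v) ×-dec ((v ~? w) ×-dec (u ~? w)))
  where open Graph G

-- Each vertex triple inducing K₃ is listed once, in increasing order.
triangles : ∀ {n} → Graph n → List (Fin n × Fin n × Fin n)
triangles {n} G =
  filter (isTriangle? G) (cartesianProduct (allFin n) (cartesianProduct (allFin n) (allFin n)))

Connected : ∀ {n} → Graph n → Set
Connected G = ∀ u v → Star (Graph._~_ G) u v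

record Cycle {n} (G : Graph n) : Set where
  open Graph G
  field
    {ℓ}       : ℕ
    vertex    : Fin (3 + ℓ) → Fin n
    distinct  : Injective _≡_ _≡_ vertex
    step      : ∀ i → vertex (inject₁ i) ~ vertex (suc i)
    close     : vertex (fromℕ (2 + ℓ)) ~ vertex zero

record IsTree {n} (G : Graph n) : Set where
  field
    nonempty   : Fin n
    connected  : Connected G
    acyclic    : ¬ Cycle G

allVecs : ∀ {A : Set} → List A → ∀ n → List (Vec A n)
allVecs xs zero    = [] ∷ []
allVecs xs (suc n) = cartesianProductWith _∷_ xs (allVecs xs n)

∈-allVecs : ∀ {A : Set} {xs : List A} → (∀ x → x ∈ᴸ xs) → ∀ {n} (v : Vec A n) → v ∈ᴸ allVecs xs n
∈-allVecs all [] = here refl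
∈-allVecs all (x ∷ v) = ∈-cartesianProductWith⁺ _∷_ (all x) (∈-allVecs all v)

allSubsets : ∀ n → List (Subset n)
allSubsets = allVecs (inside ∷ outside ∷ [])

∈-allSubsets : ∀ {n} (p : Subset n) → p ∈ᴸ allSubsets n
∈-allSubsets = ∈-allVecs λ { inside → here refl ; outside → there (here refl) }

Independent : ∀ {n} → Graph n → Subset n → Set
Independent G I = ∀ u v → u ∈ I → v ∈ I → ¬ (u ~ v)
  where open Graph G

independent? : ∀ {n} (G : Graph n) I → Dec (Independent G I)
independent? G I =
  all? λ u → all? λ v → (u ∈? I) →-dec ((v ∈? I) →-dec ¬? (u ~? v))
  where open Graph G

-- The edges of the subgraph induced on the complement of I.
edgesOff : ∀ {n} → Graph n → Subset n → List (Fin n × Fin n)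
edgesOff G I = filter (λ (u , v) → ¬? (u ∈? I) ×-dec ¬? (v ∈? I)) (edges G)

crosscutSize : ∀ {n} → Graph n → Subset n → ℕ
crosscutSize G I = ∣ I ∣ + length (edgesOff G I)

-- ∅ is independent, so using its value as the seed of `min` does not change the minimum.
-- σ G ≥ 1 as soon as G has an edge; for edgeless G it is 0, and σ G ∸ 1 truncates.
σ : ∀ {n} → Graph n → ℕ
σ {n} G = min (crosscutSize G ∅) (map (crosscutSize G) (filter (independent? G) (allSubsets n)))

σ-lower : ∀ {n} (G : Graph n) I → Independent G I → σ G ≤ crosscutSize G I
σ-lower G I ind = All-lookup (min≤xs _ _)
  (∈-map⁺ (crosscutSize G) (∈-filter⁺ (independent? G) (∈-allSubsets I) ind))

σ-attained : ∀ {n} (G : Graph n) → ∃[ I ] Independent G I × σ G ≡ crosscutSize G I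
σ-attained {n} G
  with argmin-sel (λ m → m) (crosscutSize G ∅)
         (map (crosscutSize G) (filter (independent? G) (allSubsets n)))
... | inj₁ eq = ∅ , (λ u v u∈ _ _ → ∉⊥ u∈) , eq
... | inj₂ mem with ∈-map⁻ (crosscutSize G) mem
...   | I , I∈ , eq = I , proj₂ (∈-filter⁻ (independent? G) {xs = allSubsets n} I∈) , eq

sumGraph : ∀ m {n} (R : Rel (Fin m ⊎ Fin n) 0ℓ) →
           Decidable R → Symmetric R → (∀ {x} → ¬ R x x) → Graph (m + n)
sumGraph m R R? R-sym R-irr = record
  { _~_   = λ u v → R (splitAt m u) (splitAt m v)
  ; _~?_  = λ u v → R? (splitAt m u) (splitAt m v)
  ; ~-sym = λ {u} {v} → R-sym {splitAt m u} {splitAt m v}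
  ; ~-irr = λ {v} → R-irr {splitAt m v}
  }

-- The triangle blowup: inj₁ v is an original vertex, inj₂ e the vertex added for edge e.

Edge : ∀ {n} → Graph n → Set
Edge G = Fin (length (edges G))

Incident : ∀ {n} (G : Graph n) → Fin n → Edge G → Set
Incident G v e = v ≡ proj₁ (lookupList (edges G) e) ⊎ v ≡ proj₂ (lookupList (edges G) e)

incident? : ∀ {n} (G : Graph n) v e → Dec (Incident G v e)
incident? G v e = (v ≟ _) ⊎-dec (v ≟ _)

BlowupAdj : ∀ {n} (G : Graph n) → Rel (Fin n ⊎ Edge G) 0ℓ
BlowupAdj G (inj₁ u) (inj₁ v) = Graph._~_ G u v
BlowupAdj G (inj₁ u) (inj₂ e) = Incident G u e
BlowupAdj G (inj₂ e) (inj₁ u) = Incident G u e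
BlowupAdj G (inj₂ _) (inj₂ _) = ⊥

infix 9 _▵

_▵ : ∀ {n} (G : Graph n) → Graph (n + length (edges G))
_▵ {n} G = sumGraph n (BlowupAdj G) dec (λ {x} {y} → symm x y) (λ {x} → irr x)
  where
  open Graph G
  dec : Decidable (BlowupAdj G)
  dec (inj₁ u) (inj₁ v) = u ~? v
  dec (inj₁ u) (inj₂ e) = incident? G u e
  dec (inj₂ e) (inj₁ u) = incident? G u e
  dec (inj₂ _) (inj₂ _) = no λ ()
  symm : ∀ x y → BlowupAdj G x y → BlowupAdj G y x
  symm (inj₁ u) (inj₁ v) p = ~-sym p
  symm (inj₁ u) (inj₂ e) p = p
  symm (inj₂ e) (inj₁ u) p = p
  irr : ∀ x → ¬ BlowupAdj G x x
  irr (inj₁ u) p = ~-irr p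

complete : ∀ n → Graph n
complete n = record
  { _~_ = _≢_ ; _~?_ = λ u v → ¬? (u ≟ v) ; ~-sym = λ p q → p (sym q) ; ~-irr = λ p → p refl }

edgeless : ∀ n → Graph n
edgeless n = record
  { _~_ = λ _ _ → ⊥ ; _~?_ = λ _ _ → no λ () ; ~-sym = λ () ; ~-irr = λ () }

JoinAdj : ∀ {m n} → Graph m → Graph n → Rel (Fin m ⊎ Fin n) 0ℓ
JoinAdj G H (inj₁ u) (inj₁ v) = Graph._~_ G u v
JoinAdj G H (inj₁ _) (inj₂ _) = ⊤
JoinAdj G H (inj₂ _) (inj₁ _) = ⊤
JoinAdj G H (inj₂ u) (inj₂ v) = Graph._~_ H u v

infixr 6 _∨_

_∨_ : ∀ {m n} → Graph m → Graph n → Graph (m + n)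
_∨_ {m} G H = sumGraph m (JoinAdj G H) dec (λ {x} {y} → symm x y) (λ {x} → irr x)
  where
  dec : Decidable (JoinAdj G H)
  dec (inj₁ u) (inj₁ v) = Graph._~?_ G u v
  dec (inj₁ _) (inj₂ _) = yes tt
  dec (inj₂ _) (inj₁ _) = yes tt
  dec (inj₂ u) (inj₂ v) = Graph._~?_ H u v
  symm : ∀ x y → JoinAdj G H x y → JoinAdj G H y x
  symm (inj₁ u) (inj₁ v) p = Graph.~-sym G p
  symm (inj₁ _) (inj₂ _) p = tt
  symm (inj₂ _) (inj₁ _) p = tt
  symm (inj₂ u) (inj₂ v) p = Graph.~-sym H p
  irr : ∀ x → ¬ JoinAdj G H x x
  irr (inj₁ u) p = Graph.~-irr G p
  irr (inj₂ u) p = Graph.~-irr H p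

balancedBipartite : ∀ m → Graph (⌊ m /2⌋ + ⌈ m /2⌉)
balancedBipartite m = edgeless ⌊ m /2⌋ ∨ edgeless ⌈ m /2⌉

-- The vertex count equals n, propositionally, exactly when t ≤ n; S(n,t) is only meaningful then.
S : ∀ n t → Graph (t + (⌊ n ∸ t /2⌋ + ⌈ n ∸ t /2⌉))
S n t = complete t ∨ balancedBipartite (n ∸ t)

Sbi : ∀ n t → let m = t + (⌊ n ∸ t /2⌋ + ⌈ n ∸ t /2⌉) in List (Fin m × Fin m × Fin m)
Sbi n t = triangles (S n t)

IsCopy : ∀ {h n} → Graph h → Graph n → (Fin h → Fin n) → Set
IsCopy H G f = Injective _≡_ _≡_ f × (∀ u v → Graph._~_ H u v → Graph._~_ G (f u) (f v))

isCopy? : ∀ {h n} (H : Graph h) (G : Graph n) f → Dec (IsCopy H G f)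
isCopy? H G f =
  map′ (λ p → p _ _) (λ p u v → p) (all? λ u → all? λ v → (f u ≟ f v) →-dec (u ≟ v)) ×-dec
  (all? λ u → all? λ v → Graph._~?_ H u v →-dec Graph._~?_ G (f u) (f v))

Free : ∀ {h n} → Graph h → Graph n → Set
Free H G = ¬ (∃[ f ] IsCopy H G f)

free? : ∀ {h n} (H : Graph h) (G : Graph n) → Dec (Free H G)
free? {h} {n} H G = ¬? (map′ sound complete′ (any? (isCopy? H G ∘ lookup) (allVecs (allFin n) h)))
  where
  sound : _ → ∃[ f ] IsCopy H G f
  sound p with satisfied p
  ... | v , c = lookup v , c
  complete′ : ∃[ f ] IsCopy H G f → _
  complete′ (f , inj , hom) = lose (∈-allVecs ∈-allFin (tabulate f))
    ( (λ {u} {v} eq →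
        inj (trans (sym (lookup∘tabulate f u)) (trans eq (lookup∘tabulate f v))))
    , (λ u v e → subst₂ (Graph._~_ G) (sym (lookup∘tabulate f u)) (sym (lookup∘tabulate f v))
                        (hom u v e)))

fromNeighbourhoods : ∀ {n} → Vec (Subset n) n → Graph n
fromNeighbourhoods N = record
  { _~_   = λ u v → u ≢ v × (v ∈ lookup N u ⊎ u ∈ lookup N v)
  ; _~?_  = λ u v → ¬? (u ≟ v) ×-dec ((v ∈? lookup N u) ⊎-dec (u ∈? lookup N v))
  ; ~-sym = λ (p , q) → (λ e → p (sym e)) , swap q
  ; ~-irr = λ (p , _) → p refl
  }

-- Every graph on Fin n, up to equivalence of adjacency relations (see `neighbourhoods-≐`).
allGraphs : ∀ n → List (Graph n)
allGraphs n = map fromNeighbourhoods (allVecs (allSubsets n) n)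

-- If no graph on n vertices is H-free, this maximum over the empty set is 0.
ex : ∀ {h} → ℕ → Graph h → ℕ
ex n H = max 0 (map (length ∘ triangles) (filter (free? H) (allGraphs n)))

neighbourhoods : ∀ {n} → Graph n → Vec (Subset n) n
neighbourhoods G = tabulate λ u → tabulate λ v → does (Graph._~?_ G u v)

module _ {n} (G : Graph n) where
  open Graph G
  open Graph (fromNeighbourhoods (neighbourhoods G)) using () renaming (_~_ to _≈_)

  private
    entry : ∀ u v → lookup (lookup (neighbourhoods G) u) v ≡ does (u ~? v)
    entry u v = trans (cong (λ p → lookup p v) (lookup∘tabulate _ u)) (lookup∘tabulate _ v)

    fwd : ∀ {u v} → u ~ v → v ∈ lookup (neighbourhoods G) u
    fwd {u} {v} p = lookup⇒[]= v _ (trans (entry u v) (dec-true (u ~? v) p))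

    bwd : ∀ {u v} → v ∈ lookup (neighbourhoods G) u → u ~ v
    bwd {u} {v} q with u ~? v | trans (sym (entry u v)) ([]=⇒lookup q)
    ... | yes p | _  = p
    ... | no _  | ()

  neighbourhoods-≐ : ∀ {u v} → (u ~ v → u ≈ v) × (u ≈ v → u ~ v)
  neighbourhoods-≐ = to , from
    where
    to : ∀ {u v} → u ~ v → u ≈ v
    to p = (λ { refl → ~-irr p }) , inj₁ (fwd p)
    from : ∀ {u v} → u ≈ v → u ~ v
    from (_ , inj₁ q) = bwd q
    from (_ , inj₂ q) = ~-sym (bwd q)

ex-upper : ∀ {h n} (H : Graph h) (G : Graph n) → Free H G → length (triangles G) ≤ ex n H
ex-upper {h} {n} H G free = ≤-trans (≤-reflexive (cong length same))
  (All-lookup (xs≤max 0 _) (∈-map⁺ (length ∘ triangles)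
    (∈-filter⁺ (free? H)
      (∈-map⁺ fromNeighbourhoods (∈-allVecs ∈-allSubsets (neighbourhoods G))) free′)))
  where
  G′ = fromNeighbourhoods (neighbourhoods G)
  to : ∀ {u v} → Graph._~_ G u v → Graph._~_ G′ u v
  to = proj₁ (neighbourhoods-≐ G)
  from : ∀ {u v} → Graph._~_ G′ u v → Graph._~_ G u v
  from = proj₂ (neighbourhoods-≐ G)
  free′ : Free H G′
  free′ (f , inj , hom) = free (f , inj , λ u v e → from (hom u v e))
  same : triangles G ≡ triangles G′
  same = filter-≐ (isTriangle? G) (isTriangle? G′)
    ( (λ (o , a , b , c) → o , to a , to b , to c)
    , (λ (o , a , b , c) → o , from a , from b , from c)) (cartesianProduct (allFin n) (cartesianProduct (allFin n) (allFin n)))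

ex-attained : ∀ {h n} (H : Graph h) → ∃[ G ] Free {n = n} H G →
              ∃[ G ] Free {n = n} H G × length (triangles G) ≡ ex n H
ex-attained {n = n} H (G₀ , free₀)
  with argmax-sel (λ m → m) 0 (map (length ∘ triangles) (filter (free? H) (allGraphs n)))
... | inj₁ eq = G₀ , free₀ ,
      trans (n≤0⇒n≡0 (≤-trans (ex-upper H G₀ free₀) (≤-reflexive eq))) (sym eq)
... | inj₂ mem with ∈-map⁻ (length ∘ triangles) mem
...   | G , G∈ , eq = G , proj₂ (∈-filter⁻ (free? H) {xs = allGraphs n} G∈) , sym eq

-- f = o(g) for f, g : ℕ → ℕ, with ε ranging over the reciprocals 1 / (k + 1).
_=o_ : (ℕ → ℕ) → (ℕ → ℕ) → Set
f =o g = ∀ k → ∃[ N ] (∀ n → N ≤ n → suc k * f n ≤ g n)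

{-# OPTIONS --safe #-}
module Submission where

-- Let s = σ(T) and let G be T▵-free on n vertices. Call an edge big if it lies in at least K
-- triangles, K a large constant, and small otherwise. A copy of T made of big edges extends
-- greedily to T▵, so there are O(n) big edges; similarly only O(n) triangles consist of small edges.
-- By Mantel's theorem, with a defect for these O(n) triangles, there are at most n²/4 + O(1) small
-- edges. The few vertices of high degree in the big graph meet only εn² small edges, and almost every
-- other triangle contains a small edge xy whose third vertex either is a high vertex joined to x and y
-- by big edges or is a "friend" of x (or of y), a low vertex joined to it by a big edge. Delete small
-- edges lying in fewer than s such triangles, at a total cost of at most (s − 1)n²/4. If anything
-- robust survives, T▵ embeds: take a nonempty independent set I of T with |I| + |T − I| ≤ s. Either many
-- surviving edges have |I| common high neighbours, which then serve as the images of I, or none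
-- has, and T − I is embedded along friendships. In both cases the count |I| + |T − I| ≤ s leaves an
-- unused third vertex for every edge that needs one.
-- For the lower bound, take the join of s − 1 independent vertices and the balanced bipartite graph.

open import Data.Bool.Base using (Bool; true; false; _∧_; _∨_; not; if_then_else_)
open import Data.Empty using (⊥; ⊥-elim)
open import Data.Fin.Base using (Fin; zero; suc; inject₁; fromℕ; splitAt; join; _↑ˡ_; _↑ʳ_) renaming (_<_ to _<ᶠ_)
open import Data.Fin.Properties
  using (_≟_; suc-injective; any?; injective⇒≤; join-splitAt; splitAt-↑ˡ; splitAt-↑ʳ; toℕ-↑ˡ; toℕ-↑ʳ; toℕ<n)
  renaming (_<?_ to _<ᶠ?_; <-cmp to <ᶠ-cmp; <-asym to <ᶠ-asym; <-irrefl to <ᶠ-irrefl; <-trans to <ᶠ-trans)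
open import Data.Fin.Subset using (Subset; inside; outside; ∣_∣; ⁅_⁆) renaming (_∈_ to _∈ˢ_; ⊥ to ∅)
open import Data.Fin.Subset.Properties using (_∈?_; nonempty?; ∣⁅x⁆∣≡1; x∈⁅y⁆⇒x≡y; x∈⁅x⁆; ∉⊥; ∣⊥∣≡0)
open import Data.List.Base
  using (List; []; _∷_; length; lookup; map; _++_; tabulate; filter; allFin; cartesianProduct)
open import Data.List.Extrema.Nat using (argmax-sel)
open import Data.List.Membership.Propositional using (_∈_; _∉_; lose)
open import Data.List.Membership.Propositional.Properties
  using (∈-++⁺ˡ; ∈-++⁺ʳ; ∈-map⁺; ∈-map⁻; ∈-tabulate⁺; ∈-tabulate⁻; ∈-lookup; ∈-filter⁺; ∈-filter⁻; ∈-cartesianProduct⁺; ∈-allFin)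
open import Data.List.Properties using (length-++; length-tabulate; filter-++; filter-all; filter-notAll)
open import Data.List.Relation.Unary.All as All using (All; []; _∷_)
open import Data.List.Relation.Unary.AllPairs using ([]; _∷_)
open import Data.List.Relation.Unary.Any using (here; there)
open import Data.List.Relation.Unary.Unique.Propositional using (Unique)
open import Data.List.Relation.Unary.Unique.Propositional.Properties using (cartesianProduct⁺; filter⁺; allFin⁺)
open import Data.Nat.Base
open import Data.Nat.Induction using (<-wellFounded)
open import Data.Nat.Properties hiding (_≟_; suc-injective)
open import Data.Nat.Tactic.RingSolver using (solve-∀)
open import Data.Product.Base using (Σ; ∃; ∃₂; _×_; _,_; proj₁; proj₂)
open import Data.Product.Properties using (≡-dec)
open import Data.Sum.Base using (_⊎_; inj₁; inj₂; [_,_]′)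
open import Data.Unit.Base using (tt)
open import Data.Vec.Base using ([]; _∷_) renaming (tabulate to tabulateᵛ)
open import Data.Vec.Properties using (lookup∘tabulate; []=⇒lookup; lookup⇒[]=)
open import Function.Base using (_∘_; id)
open import Function.Definitions using (Injective)
open import Induction.WellFounded using (Acc; acc)
open import Relation.Binary.Construct.Closure.ReflexiveTransitive using (Star; ε; _◅_; _◅◅_; reverse; gmap)
open import Relation.Binary.Definitions using (tri<; tri≈; tri>)
open import Relation.Binary.PropositionalEquality
open import Relation.Nullary using (¬_; Dec; yes; no; does; contradiction)
open import Relation.Nullary.Decidable using (¬?; _×-dec_)
open import Relation.Unary using (Decidable)
open import Algebra.Properties.Semiring.Sum +-*-semiring
  using (sum; sum-cong-≗; ∑-distrib-+; ∑-comm; *-distribˡ-sum; *-distribʳ-sum)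
open import Defs renaming (_∨_ to _∨ᴳ_)

-- Counting with Boolean predicates

-- The constant s - 1 is sharp, so no third vertex may be wasted, whereas O(n) losses are free.
-- Hence the third vertices at an edge xy are split into disjoint classes (common high neighbours,
-- friends of x, friends of y), and a count of s means s distinct vertices. Edges with friends at
-- both ends form a class of size O(n) and are dropped; an edge that still has friends is directed
-- away from its end with friends, and this orientation decides which end may carry a vertex of I.
-- The O(n) bounds on classes of edges have one source: a subgraph of large minimum degree in the
-- class would contain T▵, so the class is degenerate.
--
-- The constants are fixed in the order m, ε, D. The threshold K depends on m alone. Bounds of the
-- form C n may depend on D; the only other error term is a multiple of (number of high vertices) n,
-- whose coefficient is free of D, so that D can be chosen to make it small. Counts run over ordered
-- tuples, which turns (s - 1) n²/4 into 3 (s - 1) n² for twelve times the number of triangles.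

∧-true : ∀ {a b} → a ∧ b ≡ true → a ≡ true × b ≡ true
∧-true {true} {true} _ = refl , refl

∧-intro : ∀ {a b} → a ≡ true → b ≡ true → a ∧ b ≡ true
∧-intro refl refl = refl

∨-true : ∀ {a b} → a ∨ b ≡ true → a ≡ true ⊎ b ≡ true
∨-true {true}  _ = inj₁ refl
∨-true {false} q = inj₂ q

∨-introˡ : ∀ {a b} → a ≡ true → a ∨ b ≡ true
∨-introˡ refl = refl

∨-introʳ : ∀ {a b} → b ≡ true → a ∨ b ≡ true
∨-introʳ {true}  _ = refl
∨-introʳ {false} q = q

∨-false : ∀ {a b} → a ∨ b ≡ false → a ≡ false × b ≡ false
∨-false {false} {false} _ = refl , refl

not-true : ∀ {a} → not a ≡ true → a ≡ false
not-true {false} _ = refl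

clash : ∀ {A : Set} {a} → a ≡ true → a ≡ false → A
clash refl ()

true⊎false : ∀ b → b ≡ true ⊎ b ≡ false
true⊎false true  = inj₁ refl
true⊎false false = inj₂ refl

does-true : ∀ {A : Set} {d : Dec A} → does d ≡ true → A
does-true {d = yes a} _ = a

does-intro : ∀ {A : Set} (d : Dec A) → A → does d ≡ true
does-intro (yes _) _ = refl
does-intro (no ¬a) a = contradiction a ¬a

infix 7 _==_

_==_ : ∀ {n} → Fin n → Fin n → Bool
x == y = does (x ≟ y)

==-refl : ∀ {n} (x : Fin n) → x == x ≡ true
==-refl x = does-intro (x ≟ x) refl

==-true : ∀ {n} {x y : Fin n} → x == y ≡ true → x ≡ y
==-true {x = x} {y} = does-true {d = x ≟ y}

==-false : ∀ {n} {x y : Fin n} → x == y ≡ false → x ≢ y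
==-false {x = x} q refl = clash (==-refl x) q

𝟙 : Bool → ℕ
𝟙 true  = 1
𝟙 false = 0

𝟙≤1 : ∀ b → 𝟙 b ≤ 1
𝟙≤1 true  = ≤-refl
𝟙≤1 false = z≤n

𝟙-∧ : ∀ a b → 𝟙 (a ∧ b) ≡ 𝟙 a * 𝟙 b
𝟙-∧ true  b = sym (+-identityʳ (𝟙 b))
𝟙-∧ false b = refl

𝟙-mono : ∀ {a b} → (a ≡ true → b ≡ true) → 𝟙 a ≤ 𝟙 b
𝟙-mono {false} h = z≤n
𝟙-mono {true}  h rewrite h refl = ≤-refl

𝟙*-mono : ∀ {a b m n} → (a ≡ true → b ≡ true) → (a ≡ true → m ≤ n) → 𝟙 a * m ≤ 𝟙 b * n
𝟙*-mono {false} h k = z≤n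
𝟙*-mono {true}  h k rewrite h refl = +-monoˡ-≤ 0 (k refl)

sum-mono : ∀ {n} {f g : Fin n → ℕ} → (∀ x → f x ≤ g x) → sum f ≤ sum g
sum-mono {zero}  h = z≤n
sum-mono {suc n} h = +-mono-≤ (h zero) (sum-mono (h ∘ suc))

sum-≤-const : ∀ {n} {f : Fin n → ℕ} {c} → (∀ x → f x ≤ c) → sum f ≤ n * c
sum-≤-const {zero}  h = z≤n
sum-≤-const {suc n} h = +-mono-≤ (h zero) (sum-≤-const (h ∘ suc))

sum-zero : ∀ {n} {f : Fin n → ℕ} → (∀ x → f x ≡ 0) → sum f ≡ 0
sum-zero {n} h = n≤0⇒n≡0 (≤-trans (sum-≤-const (≤-reflexive ∘ h)) (≤-reflexive (*-zeroʳ n)))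

term≤sum : ∀ {n} (f : Fin n → ℕ) x → f x ≤ sum f
term≤sum f zero    = m≤m+n (f zero) _
term≤sum f (suc x) = ≤-trans (term≤sum (f ∘ suc) x) (m≤n+m _ (f zero))

sum-mono-< : ∀ {n} {f g : Fin n → ℕ} → (∀ x → f x ≤ g x) → ∀ x → f x < g x → sum f < sum g
sum-mono-< h zero    q = +-mono-<-≤ q (sum-mono (h ∘ suc))
sum-mono-< h (suc x) q = +-mono-≤-< (h zero) (sum-mono-< (h ∘ suc) x q)

==-suc : ∀ {n} (x y : Fin n) → suc x == suc y ≡ x == y
==-suc x y with x ≟ y
... | yes _ = refl
... | no _  = refl

sum-δ : ∀ {n} (f : Fin n → ℕ) a → sum (λ x → 𝟙 (x == a) * f x) ≡ f a
sum-δ {suc n} f zero = trans (cong₂ _+_ (+-identityʳ (f zero)) (sum-zero {n} {λ x → 𝟙 (suc x == zero) * f (suc x)} λ _ → refl)) (+-identityʳ _)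
sum-δ {suc n} f (suc a) = trans (sum-cong-≗ λ x → cong (λ b → 𝟙 b * f (suc x)) (==-suc x a)) (sum-δ (f ∘ suc) a)

# : ∀ {n} → (Fin n → Bool) → ℕ
# p = sum (𝟙 ∘ p)

#≤n : ∀ {n} (p : Fin n → Bool) → # p ≤ n
#≤n p = ≤-trans (sum-≤-const (𝟙≤1 ∘ p)) (≤-reflexive (*-identityʳ _))

#-mono : ∀ {n} {p q : Fin n → Bool} → (∀ x → p x ≡ true → q x ≡ true) → # p ≤ # q
#-mono h = sum-mono λ x → 𝟙-mono (h x)

#-pos : ∀ {n} {p : Fin n → Bool} x → p x ≡ true → 0 < # p
#-pos {p = p} x q = ≤-trans (≤-reflexive (cong 𝟙 (sym q))) (term≤sum (𝟙 ∘ p) x)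

#-∃ : ∀ {n} {p : Fin n → Bool} → 0 < # p → ∃ λ x → p x ≡ true
#-∃ {suc n} {p} h with p zero in eq
... | true  = zero , eq
... | false = let x , q = #-∃ {n} {p ∘ suc} h in suc x , q

#-none : ∀ {n} {p : Fin n → Bool} → (∀ x → p x ≡ false) → # p ≡ 0
#-none h = sum-zero λ x → cong 𝟙 (h x)

#-split : ∀ {n} (p q r : Fin n → Bool) → (∀ x → p x ≡ true → q x ≡ true ⊎ r x ≡ true) → # p ≤ # q + # r
#-split p q r h = ≤-trans (sum-mono pt) (≤-reflexive (∑-distrib-+ (𝟙 ∘ q) (𝟙 ∘ r)))
  where
  pt : ∀ x → 𝟙 (p x) ≤ 𝟙 (q x) + 𝟙 (r x)
  pt x with p x | h x
  ... | false | _ = z≤n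
  ... | true  | k with k refl
  ...   | inj₁ e rewrite e = s≤s z≤n
  ...   | inj₂ e rewrite e = m≤n+m 1 (𝟙 (q x))

#-== : ∀ {n} (a : Fin n) → # (_== a) ≡ 1
#-== a = trans (sum-cong-≗ λ x → sym (*-identityʳ (𝟙 (x == a)))) (sum-δ (λ _ → 1) a)

some : ∀ {n} → (Fin n → Bool) → Bool
some {zero}  p = false
some {suc n} p = p zero ∨ some (p ∘ suc)

some-intro : ∀ {n} (p : Fin n → Bool) x → p x ≡ true → some p ≡ true
some-intro p zero    q = ∨-introˡ q
some-intro p (suc x) q = ∨-introʳ {p zero} (some-intro (p ∘ suc) x q)

some-elim : ∀ {n} (p : Fin n → Bool) → some p ≡ true → ∃ λ x → p x ≡ true
some-elim {suc n} p h with ∨-true {p zero} h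
... | inj₁ q = zero , q
... | inj₂ q = let x , r = some-elim (p ∘ suc) q in suc x , r

some-none : ∀ {n} (p : Fin n → Bool) → some p ≡ false → ∀ x → p x ≡ false
some-none p h x with p x in eq
... | false = refl
... | true  = clash (some-intro p x eq) h

𝟙-some≤# : ∀ {n} (p : Fin n → Bool) → 𝟙 (some p) ≤ # p
𝟙-some≤# p with some p in eq
... | false = z≤n
... | true  = let x , q = some-elim p eq in #-pos x q

abstract
  -- Here q u w says that the used element u excludes the candidate w.
  pick : ∀ {n} {A : Set} (p : Fin n → Bool) (q : A → Fin n → Bool) c (U : List A) →
         (∀ u → u ∈ U → # (q u) ≤ c) → length U * c < # p →
         ∃ λ w → p w ≡ true × (∀ u → u ∈ U → q u w ≡ false)
  pick p q c [] _ h = let w , e = #-∃ h in w , e , λ _ ()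
  pick {n} p q c (u ∷ U) bd h =
    let w , e , f = pick p′ q c U (λ v v∈ → bd v (there v∈)) h′
        e₁ , e₂ = ∧-true {p w} e
    in w , e₁ , λ { _ (here refl) → not-true e₂ ; v (there v∈) → f v v∈ }
    where
    p′ : Fin n → Bool
    p′ x = p x ∧ not (q u x)
    cover : ∀ x → p x ≡ true → q u x ≡ true ⊎ p′ x ≡ true
    cover x e with q u x
    ... | true  = inj₁ refl
    ... | false = inj₂ (∧-intro e refl)
    h′ : length U * c < # p′
    h′ = +-cancelˡ-< c _ _ (<-≤-trans h (≤-trans (#-split p (q u) p′ cover) (+-monoˡ-≤ _ (bd u (here refl)))))

  pick-fresh : ∀ {n} (p : Fin n → Bool) (U : List (Fin n)) → length U < # p → ∃ λ w → p w ≡ true × w ∉ U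
  pick-fresh p U h =
    let w , e , f = pick p (λ u x → x == u) 1 U (λ u _ → ≤-reflexive (#-== u))
                      (≤-<-trans (≤-reflexive (*-identityʳ _)) h)
    in w , e , λ w∈ → clash (==-refl w) (f w w∈)

-- Graphs as symmetric Boolean relations: weights and deletions

BRel : ℕ → Set
BRel n = Fin n → Fin n → Bool

infix 4 _≼_

_≼_ : ∀ {n} → BRel n → BRel n → Set
S ≼ R = ∀ x y → S x y ≡ true → R x y ≡ true

Symᵇ : ∀ {n} → BRel n → Set
Symᵇ S = ∀ x y → S x y ≡ true → S y x ≡ true

Irrᵇ : ∀ {n} → BRel n → Set
Irrᵇ S = ∀ x → S x x ≡ false

-- The sum runs over ordered pairs, so for a symmetric irreflexive relation `size` is twice the
-- number of edges.
weight : ∀ {n} → BRel n → (Fin n → Fin n → ℕ) → ℕ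
weight S f = sum λ x → sum λ y → 𝟙 (S x y) * f x y

size : ∀ {n} → BRel n → ℕ
size S = weight S λ _ _ → 1

-- Size bounds are stated with `support` instead of n because the supports of the pieces of a
-- relation can be summed more cheaply than one n for each piece.
support : ∀ {n} → BRel n → ℕ
support S = # λ x → some (S x)

size≡∑# : ∀ {n} (S : BRel n) → size S ≡ sum λ x → # (S x)
size≡∑# S = sum-cong-≗ λ x → sum-cong-≗ λ y → *-identityʳ (𝟙 (S x y))

weight-mono : ∀ {n} {S R : BRel n} {f g} → S ≼ R → (∀ x y → S x y ≡ true → f x y ≤ g x y) → weight S f ≤ weight R g
weight-mono h k = sum-mono λ x → sum-mono λ y → 𝟙*-mono (h x y) (k x y)

weight-≤ : ∀ {n} (S : BRel n) {f} c → (∀ x y → S x y ≡ true → f x y ≤ c) → weight S f ≤ c * size S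
weight-≤ S {f} c h = begin
  weight S f  ≤⟨ sum-mono (λ x → sum-mono λ y → pt x y) ⟩
  sum (λ x → sum λ y → c * (𝟙 (S x y) * 1))  ≡⟨ sum-cong-≗ (λ x → sym (*-distribˡ-sum c (λ y → 𝟙 (S x y) * 1))) ⟩
  sum (λ x → c * sum λ y → 𝟙 (S x y) * 1)  ≡⟨ sym (*-distribˡ-sum c (λ x → sum λ y → 𝟙 (S x y) * 1)) ⟩
  c * size S  ∎
  where
  open ≤-Reasoning
  pt : ∀ x y → 𝟙 (S x y) * f x y ≤ c * (𝟙 (S x y) * 1)
  pt x y with S x y in eq
  ... | false = z≤n
  ... | true  = ≤-trans (≤-reflexive (+-identityʳ _)) (≤-trans (h x y eq) (≤-reflexive (sym (*-identityʳ c))))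

-- Both orientations go, so symmetry survives; `N = (_== y)` deletes a single edge and a larger `N`
-- a star at `x`.
del : ∀ {n} → BRel n → Fin n → (Fin n → Bool) → BRel n
del S x N a b = S a b ∧ not ((a == x ∧ N b) ∨ (b == x ∧ N a))

module _ {n} (S : BRel n) (x : Fin n) (N : Fin n → Bool) where

  del-≼ : del S x N ≼ S
  del-≼ a b e = proj₁ (∧-true e)

  del-sym : Symᵇ S → Symᵇ (del S x N)
  del-sym s a b e with ∧-true {S a b} e
  ... | e₁ , e₂ = ∧-intro (s a b e₁) (trans (cong not (∨-comm′ (b == x ∧ N a) (a == x ∧ N b))) e₂)
    where
    ∨-comm′ : ∀ p q → p ∨ q ≡ q ∨ p
    ∨-comm′ true  true  = refl
    ∨-comm′ true  false = refl
    ∨-comm′ false true  = refl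
    ∨-comm′ false false = refl

  del-gone : ∀ y → N y ≡ true → del S x N x y ≡ false
  del-gone y e rewrite ==-refl x | e with S x y
  ... | true  = refl
  ... | false = refl

  size-del : Symᵇ S → ∀ y → x ≢ y → S x y ≡ true → N y ≡ true → size (del S x N) + 2 ≤ size S
  size-del sy y x≢y e Ny = begin
    size (del S x N) + 2
      ≡⟨ cong₂ _+_ (size≡∑# (del S x N)) (sym two) ⟩
    sum (λ a → # (del S x N a)) + sum (λ a → sum λ b → h a b)
      ≡⟨ sym (∑-distrib-+ _ (λ a → sum (h a))) ⟩
    sum (λ a → # (del S x N a) + sum (h a))
      ≡⟨ sum-cong-≗ (λ a → sym (∑-distrib-+ (𝟙 ∘ del S x N a) (h a))) ⟩
    sum (λ a → sum λ b → 𝟙 (del S x N a b) + h a b)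
      ≤⟨ sum-mono (λ a → sum-mono (pt a)) ⟩
    sum (λ a → # (S a))
      ≡⟨ sym (size≡∑# S) ⟩
    size S ∎
    where
    open ≤-Reasoning
    h : Fin n → Fin n → ℕ
    h a b = 𝟙 (a == x) * 𝟙 (b == y) + 𝟙 (a == y) * 𝟙 (b == x)
    row : ∀ u v a → sum (λ b → 𝟙 (a == u) * 𝟙 (b == v)) ≡ 𝟙 (a == u) * 1
    row u v a = trans (sym (*-distribˡ-sum (𝟙 (a == u)) (λ b → 𝟙 (b == v)))) (cong (𝟙 (a == u) *_) (#-== v))
    one : ∀ u v → sum (λ a → sum λ b → 𝟙 (a == u) * 𝟙 (b == v)) ≡ 1
    one u v = trans (sum-cong-≗ (row u v)) (sum-δ (λ _ → 1) u)
    two : sum (λ a → sum (h a)) ≡ 2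
    two = trans (sum-cong-≗ λ a → ∑-distrib-+ (λ b → 𝟙 (a == x) * 𝟙 (b == y)) (λ b → 𝟙 (a == y) * 𝟙 (b == x)))
          (trans (∑-distrib-+ (λ a → sum λ b → 𝟙 (a == x) * 𝟙 (b == y)) (λ a → sum λ b → 𝟙 (a == y) * 𝟙 (b == x)))
                 (cong₂ _+_ (one x y) (one y x)))
    pt : ∀ a b → 𝟙 (del S x N a b) + h a b ≤ 𝟙 (S a b)
    pt a b with a ≟ x | b ≟ y | a ≟ y | b ≟ x
    ... | yes refl | yes refl | yes a≡y | _       = contradiction a≡y x≢y
    ... | yes refl | yes refl | no _ | yes b≡x    = contradiction (sym b≡x) x≢y
    ... | yes refl | yes refl | no _ | no _ rewrite e | Ny = ≤-refl
    ... | yes refl | no _ | yes a≡y | _           = contradiction a≡y x≢y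
    ... | yes refl | no _ | no _ | yes refl       = ≤-trans (≤-reflexive (+-identityʳ _)) (𝟙-mono {b = S a b} λ r → proj₁ (∧-true r))
    ... | yes refl | no _ | no _ | no _           = ≤-trans (≤-reflexive (+-identityʳ _)) (𝟙-mono {b = S a b} λ r → proj₁ (∧-true r))
    ... | no _ | _ | yes refl | yes refl rewrite sy b a e | Ny = ≤-refl
    ... | no _ | _ | yes refl | no _              = ≤-trans (≤-reflexive (+-identityʳ _)) (𝟙-mono {b = S a b} λ r → proj₁ (∧-true r))
    ... | no _ | _ | no _ | _                     = ≤-trans (≤-reflexive (+-identityʳ _)) (𝟙-mono {b = S a b} λ r → proj₁ (∧-true r))

  weight-del : Symᵇ S → ∀ f →
    weight S f ≤ weight (del S x N) f + sum λ y → 𝟙 (S x y ∧ N y) * (f x y + f y x)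
  weight-del sy f = begin
    weight S f
      ≤⟨ sum-mono (λ a → sum-mono (pt a)) ⟩
    sum (λ a → sum λ b → A a b + (B a b + C a b))
      ≡⟨ sum-cong-≗ (λ a → trans (∑-distrib-+ (A a) (λ b → B a b + C a b)) (cong (sum (A a) +_) (∑-distrib-+ (B a) (C a)))) ⟩
    sum (λ a → sum (A a) + (sum (B a) + sum (C a)))
      ≡⟨ trans (∑-distrib-+ (sum ∘ A) (λ a → sum (B a) + sum (C a))) (cong (sum (sum ∘ A) +_) (∑-distrib-+ (sum ∘ B) (sum ∘ C))) ⟩
    sum (sum ∘ A) + (sum (sum ∘ B) + sum (sum ∘ C))
      ≡⟨ cong (sum (sum ∘ A) +_) (cong₂ _+_ sumB sumC) ⟩
    sum (sum ∘ A) + (sum (λ b → 𝟙 (S x b ∧ N b) * f x b) + sum (λ b → 𝟙 (S x b ∧ N b) * f b x))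
      ≡⟨ cong (sum (sum ∘ A) +_) (sym (∑-distrib-+ (λ b → 𝟙 (S x b ∧ N b) * f x b) _)) ⟩
    sum (sum ∘ A) + sum (λ b → 𝟙 (S x b ∧ N b) * f x b + 𝟙 (S x b ∧ N b) * f b x)
      ≡⟨ cong (sum (sum ∘ A) +_) (sum-cong-≗ λ b → sym (*-distribˡ-+ (𝟙 (S x b ∧ N b)) (f x b) (f b x))) ⟩
    weight (del S x N) f + sum (λ y → 𝟙 (S x y ∧ N y) * (f x y + f y x)) ∎
    where
    open ≤-Reasoning
    A B C : Fin n → Fin n → ℕ
    A a b = 𝟙 (del S x N a b) * f a b
    B a b = 𝟙 (a == x) * (𝟙 (S x b ∧ N b) * f x b)
    C a b = 𝟙 (b == x) * (𝟙 (S x a ∧ N a) * f a x)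
    sumB : sum (sum ∘ B) ≡ sum (λ b → 𝟙 (S x b ∧ N b) * f x b)
    sumB = trans (∑-comm B) (sum-cong-≗ λ b → sum-δ (λ _ → 𝟙 (S x b ∧ N b) * f x b) x)
    sumC : sum (sum ∘ C) ≡ sum (λ a → 𝟙 (S x a ∧ N a) * f a x)
    sumC = sum-cong-≗ λ a → sum-δ (λ _ → 𝟙 (S x a ∧ N a) * f a x) x
    pt : ∀ a b → 𝟙 (S a b) * f a b ≤ A a b + (B a b + C a b)
    pt a b with S a b in eq
    ... | false = z≤n
    ... | true with a ≟ x | b ≟ x
    ...   | no _ | no _ = m≤m+n (1 * f a b) _
    ...   | yes refl | no _ with N b
    ...     | true  rewrite eq = ≤-trans (≤-reflexive (sym (+-identityʳ _))) (m≤m+n (1 * f a b + 0) _)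
    ...     | false = m≤m+n (1 * f a b) _
    pt a b | true | no _ | yes refl with N a
    ...     | true  rewrite sy a b eq = ≤-reflexive (sym (+-identityʳ _))
    ...     | false = m≤m+n (1 * f a b) _
    pt a b | true | yes refl | yes refl with N b
    ...     | true  rewrite eq = ≤-trans (≤-reflexive (sym (+-identityʳ _))) (m≤m+n (1 * f a b + 0) _)
    ...     | false = m≤m+n (1 * f a b) _

-- Repeatedly deleting cheap edges (cost 2a each) and cheap stars E S j x: a star that has been
-- deleted stays empty, so each of the indices (j , x) is charged κ at most once.
module Peel {n m} (S₀ : BRel n) (irr : Irrᵇ S₀)
  (E : BRel n → Fin m → Fin n → Fin n → Bool)
  (E⊂ : ∀ S j x y → E S j x y ≡ true → S x y ≡ true)
  (E-mono : ∀ S R j x y → S ≼ R → E S j x y ≡ true → E R j x y ≡ true)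
  (τ : BRel n → ℕ) (a κ : ℕ)
  where

  indices : BRel n → ℕ
  indices S = sum λ j → # λ x → some (E S j x)

  Progress : BRel n → Set
  Progress S = τ S ≡ 0
    ⊎ (∃₂ λ x y → S x y ≡ true × τ S ≤ τ (del S x (_== y)) + 2 * a)
    ⊎ (∃₂ λ j x → ∃ λ y → E S j x y ≡ true × τ S ≤ τ (del S x (E S j x)) + κ)

  private
    E-some : ∀ S R → S ≼ R → ∀ j x → some (E S j x) ≡ true → some (E R j x) ≡ true
    E-some S R h j x e = let y , q = some-elim (E S j x) e in some-intro (E R j x) y (E-mono S R j x y h q)

    indices-mono : ∀ S R → S ≼ R → indices S ≤ indices R
    indices-mono S R h = sum-mono λ j → #-mono (E-some S R h j)

    -- By monotonicity of `E`, what remains of the star lies inside the deleted star, so it is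
    -- empty; no other star can become nonempty.
    indices-< : ∀ S j x y → E S j x y ≡ true → indices (del S x (E S j x)) < indices S
    indices-< S j x y e =
      sum-mono-< (λ i → #-mono (E-some S′ S le i)) j
        (sum-mono-< (λ z → 𝟙-mono (E-some S′ S le j z)) x lt)
      where
      S′ = del S x (E S j x)
      le : S′ ≼ S
      le = del-≼ S x (E S j x)
      none : some (E S′ j x) ≡ false
      none with some (E S′ j x) in eq
      ... | false = refl
      ... | true  = let z , q = some-elim (E S′ j x) eq in
                    clash (E⊂ S′ j x z q) (del-gone S x (E S j x) z (E-mono S′ S j x z le q))
      lt : 𝟙 (some (E S′ j x)) < 𝟙 (some (E S j x))
      lt rewrite none | some-intro (E S j x) y e = s≤s z≤n

  -- Induction on `size`. An edge deletion lowers `size` by at least 2, which pays for its cost 2a;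
  -- a star deletion lowers `indices` by at least 1, which pays for κ.
  peel : (∀ S → Symᵇ S → S ≼ S₀ → Progress S) →
         ∀ S → Symᵇ S → S ≼ S₀ → τ S ≤ a * size S + κ * indices S
  peel progress S sy le = go S sy le (<-wellFounded (size S))
    where
    open ≤-Reasoning
    ≢-of : ∀ {S x y} → S ≼ S₀ → S x y ≡ true → x ≢ y
    ≢-of {x = x} h e refl = clash (h x x e) (irr x)
    go : ∀ S → Symᵇ S → S ≼ S₀ → Acc _<_ (size S) → τ S ≤ a * size S + κ * indices S
    go S sy le (acc rs) with progress S sy le
    ... | inj₁ z = ≤-trans (≤-reflexive z) z≤n
    ... | inj₂ (inj₁ (x , y , e , h)) = begin
      τ S  ≤⟨ h ⟩
      τ S′ + 2 * a  ≤⟨ +-monoˡ-≤ (2 * a) (go S′ (del-sym S x _ sy) le′ (rs lt)) ⟩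
      a * size S′ + κ * indices S′ + 2 * a  ≡⟨ cong (_+ 2 * a) (+-comm (a * size S′) _) ⟩
      κ * indices S′ + a * size S′ + 2 * a  ≡⟨ +-assoc (κ * indices S′) _ _ ⟩
      κ * indices S′ + (a * size S′ + 2 * a)  ≡⟨ cong (κ * indices S′ +_) (trans (cong (a * size S′ +_) (*-comm 2 a)) (sym (*-distribˡ-+ a _ 2))) ⟩
      κ * indices S′ + a * (size S′ + 2)  ≤⟨ +-mono-≤ (*-monoʳ-≤ κ (indices-mono S′ S (del-≼ S x _))) (*-monoʳ-≤ a sz) ⟩
      κ * indices S + a * size S  ≡⟨ +-comm (κ * indices S) _ ⟩
      a * size S + κ * indices S  ∎
      where
      S′ = del S x (_== y)
      le′ : S′ ≼ S₀
      le′ u v q = le u v (del-≼ S x _ u v q)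
      sz : size S′ + 2 ≤ size S
      sz = size-del S x (_== y) sy y (≢-of le e) e (==-refl y)
      lt : size S′ < size S
      lt = <-≤-trans (m<m+n (size S′) (s≤s z≤n)) sz
    ... | inj₂ (inj₂ (j , x , y , e , h)) = begin
      τ S  ≤⟨ h ⟩
      τ S′ + κ  ≤⟨ +-monoˡ-≤ κ (go S′ (del-sym S x _ sy) le′ (rs lt)) ⟩
      a * size S′ + κ * indices S′ + κ  ≡⟨ +-assoc (a * size S′) _ κ ⟩
      a * size S′ + (κ * indices S′ + κ)  ≡⟨ cong (a * size S′ +_) (trans (+-comm _ κ) (sym (*-suc κ _))) ⟩
      a * size S′ + κ * suc (indices S′)  ≤⟨ +-mono-≤ (*-monoʳ-≤ a (≤-trans (m≤m+n _ 2) sz)) (*-monoʳ-≤ κ (indices-< S j x y e)) ⟩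
      a * size S + κ * indices S  ∎
      where
      S′ = del S x (E S j x)
      le′ : S′ ≼ S₀
      le′ u v q = le u v (del-≼ S x _ u v q)
      sz : size S′ + 2 ≤ size S
      sz = size-del S x (E S j x) sy y (≢-of le (E⊂ S j x y e)) (E⊂ S j x y e) e
      lt : size S′ < size S
      lt = <-≤-trans (m<m+n (size S′) (s≤s z≤n)) sz

-- Degenerate graphs have few edges

∑-𝟙*≤ : ∀ {n} (N : Fin n → Bool) {f : Fin n → ℕ} c → (∀ y → N y ≡ true → f y ≤ c) →
        sum (λ y → 𝟙 (N y) * f y) ≤ c * # N
∑-𝟙*≤ N {f} c h = ≤-trans (sum-mono pt) (≤-reflexive (sym (*-distribˡ-sum c (𝟙 ∘ N))))
  where
  pt : ∀ y → 𝟙 (N y) * f y ≤ c * 𝟙 (N y)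
  pt y with N y in eq
  ... | false = z≤n
  ... | true  = ≤-trans (≤-reflexive (+-identityʳ _)) (≤-trans (h y eq) (≤-reflexive (sym (*-identityʳ c))))

MinDegree : ∀ {n} → ℕ → BRel n → Set
MinDegree M S = ∀ x y → S x y ≡ true → M ≤ # (S x)

-- Peeling with full stars as the only family and no cheap single edges: while edges are left, some
-- non-isolated vertex has degree below `M`, and deleting its star removes fewer than 2M ordered
-- pairs. Each non-isolated vertex is charged once.
degenerate-size : ∀ {n} (S₀ : BRel n) M → Symᵇ S₀ → Irrᵇ S₀ →
  (∀ S → Symᵇ S → S ≼ S₀ → MinDegree M S → ∀ x y → S x y ≡ false) →
  size S₀ ≤ 2 * M * support S₀
degenerate-size {n} S₀ M sy irr none =
  ≤-trans (P.peel progress S₀ sy λ _ _ e → e) (≤-reflexive (cong (2 * M *_) (+-identityʳ _)))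
  where
  E : BRel n → Fin 1 → Fin n → Fin n → Bool
  E S _ = S
  module P = Peel S₀ irr E (λ _ _ _ _ e → e) (λ S R _ x y h → h x y) size 0 (2 * M)
  poor : BRel n → Fin n → Bool
  poor S x = some (S x) ∧ does (# (S x) <? M)
  progress : ∀ S → Symᵇ S → S ≼ S₀ → P.Progress S
  progress S s le with some (poor S) in eq
  ... | true = inj₂ (inj₂ (zero , x , y , Sxy , ≤-trans (weight-del S x (S x) s _) (+-monoʳ-≤ _ bound)))
    where
    x = proj₁ (some-elim (poor S) eq)
    xp : some (S x) ≡ true × does (# (S x) <? M) ≡ true
    xp = ∧-true (proj₂ (some-elim (poor S) eq))
    y = proj₁ (some-elim (S x) (proj₁ xp))
    Sxy = proj₂ (some-elim (S x) (proj₁ xp))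
    open ≤-Reasoning
    bound : sum (λ y → 𝟙 (S x y ∧ S x y) * 2) ≤ 2 * M
    bound = begin
      sum (λ y → 𝟙 (S x y ∧ S x y) * 2)  ≤⟨ ∑-𝟙*≤ (λ y → S x y ∧ S x y) 2 (λ _ _ → ≤-refl) ⟩
      2 * # (λ y → S x y ∧ S x y)  ≤⟨ *-monoʳ-≤ 2 (#-mono {p = λ y → S x y ∧ S x y} {q = S x} λ y e → proj₁ (∧-true e)) ⟩
      2 * # (S x)  ≤⟨ *-monoʳ-≤ 2 (<⇒≤ (does-true {d = # (S x) <? M} (proj₂ xp))) ⟩
      2 * M  ∎
  ... | false = inj₁ (sum-zero λ x → sum-zero λ y → cong (λ b → 𝟙 b * 1) (none S s le deg x y))
    where
    deg : MinDegree M S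
    deg x y e with # (S x) <? M in eqd
    ... | no ¬lt = ≮⇒≥ ¬lt
    ... | yes lt = clash (∧-intro (some-intro (S x) y e) (does-intro (# (S x) <? M) lt)) (some-none (poor S) eq x)

-- Rooted trees and their triangle blowups

-- A rooted tree with m edges, built leaf by leaf. Vertex 0 is the newest one; edge i joins
-- vertex inject₁ i to its parent.
data Tree : ℕ → Set where
  root : Tree 0
  grow : ∀ {m} → Fin (suc m) → Tree m → Tree (suc m)

parent : ∀ {m} → Tree m → Fin m → Fin (suc m)
parent (grow a t) zero    = suc a
parent (grow a t) (suc i) = suc (parent t i)

record Blowup {m n} (t : Tree m) (g : BRel n) : Set where
  field
    φ        : Fin (suc m) → Fin n
    ω        : Fin m → Fin n
    φ-inj    : ∀ i j → φ i ≡ φ j → i ≡ j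
    ω-inj    : ∀ i j → ω i ≡ ω j → i ≡ j
    disjoint : ∀ i j → φ i ≢ ω j
    base     : ∀ i → g (φ (inject₁ i)) (φ (parent t i)) ≡ true
    left     : ∀ i → g (φ (inject₁ i)) (ω i) ≡ true
    right    : ∀ i → g (φ (parent t i)) (ω i) ≡ true

infixr 5 _∷ᶠ_

_∷ᶠ_ : ∀ {A : Set} {n} → A → (Fin n → A) → Fin (suc n) → A
(x ∷ᶠ f) zero    = x
(x ∷ᶠ f) (suc i) = f i

∷ᶠ-inj : ∀ {A : Set} {n} {x : A} {f : Fin n → A} → (∀ i → f i ≢ x) → (∀ i j → f i ≡ f j → i ≡ j) →
         ∀ i j → (x ∷ᶠ f) i ≡ (x ∷ᶠ f) j → i ≡ j
∷ᶠ-inj h k zero    zero    e = refl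
∷ᶠ-inj h k zero    (suc j) e = contradiction (sym e) (h j)
∷ᶠ-inj h k (suc i) zero    e = contradiction e (h i)
∷ᶠ-inj h k (suc i) (suc j) e = cong suc (k i j e)

abstract
  -- Greedy systems of distinct representatives for the indices selected by c.
  sdr : ∀ {n} m (c : Fin m → Bool) (Ok : Fin m → Fin n → Set) (junk : Fin n) (U : List (Fin n)) →
    (∀ i → c i ≡ true → ∀ ws → length ws < # c → ∃ λ w → Ok i w × w ∉ U × w ∉ ws) →
    ∃₂ λ (ω : Fin m → Fin n) (ws : List (Fin n)) → length ws ≡ # c
      × (∀ i → c i ≡ true → Ok i (ω i) × ω i ∉ U × ω i ∈ ws)
      × (∀ i j → c i ≡ true → c j ≡ true → ω i ≡ ω j → i ≡ j)
  sdr zero c Ok junk U h = (λ ()) , [] , refl , (λ ()) , λ ()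
  sdr {n} (suc m) c Ok junk U h with sdr m (c ∘ suc) (Ok ∘ suc) junk U (λ i ci ws l → h (suc i) ci ws (≤-trans l (m≤n+m _ (𝟙 (c zero)))))
  ... | ω , ws , len , ok , inj with c zero in eq
  ...   | false = junk ∷ᶠ ω , ws , len , ok′ , inj′
    where
    ok′ : ∀ i → c i ≡ true → Ok i ((junk ∷ᶠ ω) i) × (junk ∷ᶠ ω) i ∉ U × (junk ∷ᶠ ω) i ∈ ws
    ok′ zero    ci = clash ci eq
    ok′ (suc i) ci = ok i ci
    inj′ : ∀ i j → c i ≡ true → c j ≡ true → (junk ∷ᶠ ω) i ≡ (junk ∷ᶠ ω) j → i ≡ j
    inj′ zero    _       ci cj e = clash ci eq
    inj′ (suc i) zero    ci cj e = clash cj eq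
    inj′ (suc i) (suc j) ci cj e = cong suc (inj i j ci cj e)
  ...   | true with h zero eq ws (≤-reflexive (cong suc len))
  ...     | w , okw , w∉U , w∉ws = w ∷ᶠ ω , w ∷ ws , cong suc len , ok′ , inj′
    where
    ok′ : ∀ i → c i ≡ true → Ok i ((w ∷ᶠ ω) i) × (w ∷ᶠ ω) i ∉ U × (w ∷ᶠ ω) i ∈ w ∷ ws
    ok′ zero    ci = okw , w∉U , here refl
    ok′ (suc i) ci = let a , b , d = ok i ci in a , b , there d
    inj′ : ∀ i j → c i ≡ true → c j ≡ true → (w ∷ᶠ ω) i ≡ (w ∷ᶠ ω) j → i ≡ j
    inj′ zero    zero    ci cj e = refl
    inj′ zero    (suc j) ci cj refl = contradiction (proj₂ (proj₂ (ok j cj))) w∉ws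
    inj′ (suc i) zero    ci cj refl = contradiction (proj₂ (proj₂ (ok i ci))) w∉ws
    inj′ (suc i) (suc j) ci cj e = cong suc (inj i j ci cj e)

module _ {n} (g S : BRel n) (irr : Irrᵇ g) (sy : Symᵇ S) (L : ℕ)
  (extend : ∀ a → (∃ λ b → S a b ≡ true) → ∀ U → length U ≤ L →
    ∃₂ λ b w → S a b ≡ true × b ∉ U × w ∉ U × g b a ≡ true × g b w ≡ true × g a w ≡ true)
  where

  -- The tree is built leaf by leaf. After k edges exactly 2k + 1 vertices are used, and every
  -- placed vertex keeps a neighbour in `S`, so any of them can become the parent of the next leaf.
  greedy : ∀ {m} (t : Tree m) → 2 * m ≤ suc L → (∃₂ λ a b → S a b ≡ true) → Blowup t g
  greedy t h e = proj₁ (go t h e)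
    where
    open Blowup
    go : ∀ {m} (t : Tree m) → 2 * m ≤ suc L → (∃₂ λ a b → S a b ≡ true) →
         ∃₂ λ (E : Blowup t g) (U : List (Fin n)) → length U ≡ suc (2 * m)
           × (∀ i → φ E i ∈ U) × (∀ i → ω E i ∈ U) × (∀ i → ∃ λ b → S (φ E i) b ≡ true)
    go root h (a , b , e) =
      record { φ = λ _ → a ; ω = λ () ; φ-inj = λ { zero zero _ → refl } ; ω-inj = λ () ; disjoint = λ _ ()
             ; base = λ () ; left = λ () ; right = λ () } ,
      a ∷ [] , refl , (λ _ → here refl) , (λ ()) , λ _ → b , e
    go {suc m} (grow a t) h e with go t (≤-trans (*-monoʳ-≤ 2 (n≤1+n m)) h) e
    ... | E , U , len , inφ , inω , act
      with extend (φ E a) (act a) U (≤-trans (≤-reflexive len) (s≤s⁻¹ (≤-trans (≤-reflexive (sym (*-suc 2 m))) h)))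
    ...   | b , w , Sab , b∉U , w∉U , gba , gbw , gaw = record
        { φ = b ∷ᶠ φ E ; ω = w ∷ᶠ ω E
        ; φ-inj = ∷ᶠ-inj (λ i q → b∉U (subst (_∈ U) q (inφ i))) (φ-inj E)
        ; ω-inj = ∷ᶠ-inj (λ i q → w∉U (subst (_∈ U) q (inω i))) (ω-inj E)
        ; disjoint = λ where
            zero    zero    refl → clash gbw (irr b)
            zero    (suc j) refl → b∉U (inω j)
            (suc i) zero    refl → w∉U (inφ i)
            (suc i) (suc j) q    → disjoint E i j q
        ; base  = λ { zero → gba ; (suc i) → base E i }
        ; left  = λ { zero → gbw ; (suc i) → left E i }
        ; right = λ { zero → gaw ; (suc i) → right E i }
        } ,
        b ∷ w ∷ U ,
        trans (cong (2 +_) len) (cong suc (sym (*-suc 2 m))) ,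
        (λ { zero → here refl ; (suc i) → there (there (inφ i)) }) ,
        (λ { zero → there (here refl) ; (suc i) → there (there (inω i)) }) ,
        (λ { zero → φ E a , sy (φ E a) b Sab ; (suc i) → act i })

-- Here q a u b says that the used vertex u forbids the child b of a.
sparse : ∀ {n} (g S₀ : BRel n) → Irrᵇ g → Symᵇ S₀ → Irrᵇ S₀ →
  ∀ {m} (t : Tree m) → ¬ Blowup t g → ∀ L → 2 * m ≤ suc L →
  (q : Fin n → Fin n → Fin n → Bool) (c : ℕ) → (∀ a u → # (q a u) ≤ c) →
  (∀ a b U → S₀ a b ≡ true → length U ≤ L → (∀ u → u ∈ U → q a u b ≡ false) →
    b ∉ U × (∃ λ w → w ∉ U × g b a ≡ true × g b w ≡ true × g a w ≡ true)) →
  size S₀ ≤ 2 * suc (L * c) * support S₀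
sparse {n} g S₀ irr sy irr₀ t free L h q c bd wit =
  degenerate-size S₀ (suc (L * c)) sy irr₀ none
  where
  none : ∀ S → Symᵇ S → S ≼ S₀ → MinDegree (suc (L * c)) S → ∀ x y → S x y ≡ false
  none S s le deg x y with S x y in eq
  ... | false = refl
  ... | true  = ⊥-elim (free (greedy g S irr s L extend t h (x , y , eq)))
    where
    extend : ∀ a → (∃ λ b → S a b ≡ true) → ∀ U → length U ≤ L →
      ∃₂ λ b w → S a b ≡ true × b ∉ U × w ∉ U × g b a ≡ true × g b w ≡ true × g a w ≡ true
    extend a (b₀ , e₀) U lU =
      -- At most `L` used vertices forbid at most `c` children each, so a degree above `L * c`
      -- leaves a child.
      let b , e , f = pick (S a) (q a) c U (λ u _ → bd a u) (≤-trans (s≤s (*-monoˡ-≤ c lU)) (deg a b₀ e₀))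
          b∉U , w , w∉U , r = wit a b U (le a b e) lU f
      in b , w , e , b∉U , w∉U , r

-- Big edges, small edges and friends

∧-symᵇ : ∀ {n} {R S : BRel n} → Symᵇ R → Symᵇ S → Symᵇ (λ x y → R x y ∧ S x y)
∧-symᵇ {R = R} r s x y e = let a , b = ∧-true {R x y} e in ∧-intro (r x y a) (s x y b)

≼-irr : ∀ {n} {S R : BRel n} → S ≼ R → Irrᵇ R → Irrᵇ S
≼-irr {S = S} h i x with S x x in eq
... | false = refl
... | true  = clash (h x x eq) (i x)

-- Throughout, D is the cut-off above which a vertex has high degree in the graph of big edges.
module Classes {n} (g : BRel n) (gs : Symᵇ g) (gi : Irrᵇ g) (m D : ℕ) where

  codeg : Fin n → Fin n → ℕ
  codeg x y = # λ w → g x w ∧ g y w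

  -- More than the m + 1 images of tree vertices, m third vertices already fixed and m chosen
  -- greedily: a big edge always has a spare common neighbour.
  K : ℕ
  K = suc (suc m + m + m)

  rich : Fin n → Fin n → Bool
  rich x y = does (K ≤? codeg x y)

  big small : BRel n
  big   x y = g x y ∧ rich x y
  small x y = g x y ∧ not (rich x y)

  codeg-comm : ∀ x y → codeg x y ≤ codeg y x
  codeg-comm x y = #-mono {p = λ w → g x w ∧ g y w} {q = λ w → g y w ∧ g x w} λ w e → let a , b = ∧-true {g x w} e in ∧-intro b a

  rich-intro : ∀ {x y} → K ≤ codeg x y → rich x y ≡ true
  rich-intro {x} {y} = does-intro (K ≤? codeg x y)

  rich-elim : ∀ {x y} → rich x y ≡ true → K ≤ codeg x y
  rich-elim {x} {y} = does-true {d = K ≤? codeg x y}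

  rich-sym : Symᵇ rich
  rich-sym x y e = rich-intro (≤-trans (rich-elim e) (codeg-comm x y))

  big-sym : Symᵇ big
  big-sym = ∧-symᵇ gs rich-sym

  small-sym : Symᵇ small
  small-sym = ∧-symᵇ gs λ x y e → poor-sym x y e
    where
    poor-sym : Symᵇ (λ x y → not (rich x y))
    poor-sym x y e with rich y x in eq
    ... | false = refl
    ... | true  = clash (rich-sym y x eq) (not-true e)

  big→g : big ≼ g
  big→g x y e = proj₁ (∧-true e)

  small→g : small ≼ g
  small→g x y e = proj₁ (∧-true e)

  big-irr : Irrᵇ big
  big-irr = ≼-irr big→g gi

  small-irr : Irrᵇ small
  small-irr = ≼-irr small→g gi

  big-codeg : ∀ {x y} → big x y ≡ true → K ≤ codeg x y
  big-codeg e = rich-elim (proj₂ (∧-true e))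

  small-codeg : ∀ {x y} → small x y ≡ true → codeg x y ≤ K
  small-codeg {x} {y} e = <⇒≤ (≰⇒> λ h → clash (rich-intro h) (not-true (proj₂ (∧-true {g x y} e))))

  big-small : ∀ {x y} {A : Set} → big x y ≡ true → small x y ≡ true → A
  big-small {x} {y} e f = clash (proj₂ (∧-true {g x y} e)) (not-true (proj₂ (∧-true {g x y} f)))

  big⊎small : ∀ x y → g x y ≡ true → big x y ≡ true ⊎ small x y ≡ true
  big⊎small x y e with rich x y
  ... | true  = inj₁ (∧-intro e refl)
  ... | false = inj₂ (∧-intro e refl)

  hi : Fin n → Bool
  hi x = does (D <? # (big x))

  hi-elim : ∀ {x} → hi x ≡ true → D < # (big x)
  hi-elim {x} = does-true {d = D <? # (big x)}

  lo-deg : ∀ {x} → hi x ≡ false → # (big x) ≤ D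
  lo-deg {x} e = ≮⇒≥ λ h → clash (does-intro (D <? # (big x)) h) e

  core : BRel n
  core x y = small x y ∧ (not (hi x) ∧ not (hi y))

  core→small : core ≼ small
  core→small x y e = proj₁ (∧-true e)

  core-loˡ : ∀ {x y} → core x y ≡ true → hi x ≡ false
  core-loˡ {x} {y} e = not-true (proj₁ (∧-true (proj₂ (∧-true {small x y} e))))

  core-loʳ : ∀ {x y} → core x y ≡ true → hi y ≡ false
  core-loʳ {x} {y} e = not-true (proj₂ (∧-true {not (hi x)} (proj₂ (∧-true {small x y} e))))

  core-sym : Symᵇ core
  core-sym = ∧-symᵇ {R = small} small-sym λ x y e → let a , b = ∧-true {not (hi x)} e in ∧-intro b a

  core-irr : Irrᵇ core
  core-irr = ≼-irr core→small small-irr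

  -- The triangles of a subgraph S of `core` are counted at an edge x y of S through their third
  -- vertex, which is either high and joined to x and y by big edges, or a friend of x or of y.
  common : Fin n → Fin n → Fin n → Bool
  common x y w = hi w ∧ (big x w ∧ big y w)

  friend : BRel n → Fin n → Fin n → Fin n → Bool
  friend S x y w = big x w ∧ S w y

  -- The edge is directed from the end that has a friend. If `w` is a friend of the tail `x`, then
  -- `w y` is an arc to the same head, with `x` as a friend of `w`; embeddings along friendships
  -- therefore never lose the tail property.
  arc : BRel n → BRel n
  arc S x y = S x y ∧ some (friend S x y)

  cn : BRel n → Fin n → Fin n → ℕ
  cn S x y = # (common x y) + (# (friend S x y) + # (friend S y x))

  third : BRel n → Fin n → Fin n → Fin n → Bool
  third S x y w = common x y w ∨ (friend S x y w ∨ friend S y x w)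

  friend-mono : ∀ {S R} → S ≼ R → ∀ x y w → friend S x y w ≡ true → friend R x y w ≡ true
  friend-mono h x y w e = let a , b = ∧-true {big x w} e in ∧-intro a (h w y b)

  arc-mono : ∀ {S R} → S ≼ R → arc S ≼ arc R
  arc-mono {S} {R} h x y e with ∧-true {S x y} e
  ... | a , b = let w , q = some-elim (friend S x y) b in
                ∧-intro (h x y a) (some-intro (friend R x y) w (friend-mono h x y w q))

  arc→ : ∀ {S} → arc S ≼ S
  arc→ x y e = proj₁ (∧-true e)

  arc-intro : ∀ {S x y w} → S x y ≡ true → friend S x y w ≡ true → arc S x y ≡ true
  arc-intro {S} {x} {y} {w} a b = ∧-intro a (some-intro (friend S x y) w b)

  arc-friend : ∀ {S x y} → arc S x y ≡ true → ∃ λ w → friend S x y w ≡ true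
  arc-friend {S} {x} {y} e = some-elim (friend S x y) (proj₂ (∧-true {S x y} e))

  module _ {S : BRel n} (sub : S ≼ core) (sy : Symᵇ S) where

    friend-lo : ∀ {x y w} → friend S x y w ≡ true → hi w ≡ false
    friend-lo {x} {y} {w} e = core-loˡ (sub w y (proj₂ (∧-true {big x w} e)))

    S-big : ∀ {x y} {A : Set} → S x y ≡ true → big x y ≡ true → A
    S-big e f = big-small f (core→small _ _ (sub _ _ e))

    third-g : ∀ x y w → third S x y w ≡ true → g x w ≡ true × g y w ≡ true
    third-g x y w e with ∨-true {common x y w} e
    ... | inj₁ c = let a , b = ∧-true {big x w} (proj₂ (∧-true {hi w} c)) in big→g _ _ a , big→g _ _ b
    ... | inj₂ f with ∨-true {friend S x y w} f
    ...   | inj₁ c = let a , b = ∧-true {big x w} c in big→g _ _ a , small→g _ _ (core→small _ _ (sub _ _ (sy _ _ b)))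
    ...   | inj₂ c = let a , b = ∧-true {big y w} c in small→g _ _ (core→small _ _ (sub _ _ (sy _ _ b))) , big→g _ _ a

    -- The three classes are disjoint: common neighbours are high while friends are low, and a
    -- friend of both ends would make an edge both big and small.
    cn≤third : ∀ x y → cn S x y ≤ # (third S x y)
    cn≤third x y = ≤-trans
      (≤-reflexive (sym (trans (∑-distrib-+ (𝟙 ∘ common x y) (λ w → 𝟙 (friend S x y w) + 𝟙 (friend S y x w)))
        (cong (# (common x y) +_) (∑-distrib-+ (𝟙 ∘ friend S x y) (𝟙 ∘ friend S y x))))))
      (sum-mono pt)
      where
      pt : ∀ w → 𝟙 (common x y w) + (𝟙 (friend S x y w) + 𝟙 (friend S y x w)) ≤ 𝟙 (third S x y w)
      pt w with common x y w in c | friend S x y w in f | friend S y x w in h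
      ... | true  | true  | _     = clash (proj₁ (∧-true {hi w} c)) (friend-lo f)
      ... | true  | false | true  = clash (proj₁ (∧-true {hi w} c)) (friend-lo h)
      ... | true  | false | false = ≤-refl
      ... | false | true  | true  = S-big (proj₂ (∧-true {big x w} f)) (big-sym _ _ (proj₁ (∧-true {big y w} h)))
      ... | false | true  | false = ≤-refl
      ... | false | false | true  = ≤-refl
      ... | false | false | false = ≤-refl

  -- The common end of both embeddings. Third vertices that need care are prescribed by `ω₁` on the
  -- edges selected by `c`; all other tree edges lie on big edges, and their third vertices can be
  -- chosen last, since `K` exceeds everything used.
  module Finish {t : Tree m} (φ : Fin (suc m) → Fin n) (φ-inj : ∀ i j → φ i ≡ φ j → i ≡ j)
    (c : Fin m → Bool) (ω₁ : Fin m → Fin n)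
    (ω₁-inj : ∀ i j → c i ≡ true → c j ≡ true → ω₁ i ≡ ω₁ j → i ≡ j)
    (off : ∀ i j → c j ≡ true → φ i ≢ ω₁ j)
    (tri : ∀ i → c i ≡ true → g (φ (inject₁ i)) (φ (parent t i)) ≡ true
       × g (φ (inject₁ i)) (ω₁ i) ≡ true × g (φ (parent t i)) (ω₁ i) ≡ true)
    (rest : ∀ i → c i ≡ false → big (φ (inject₁ i)) (φ (parent t i)) ≡ true)
    where

    private
      U : List (Fin n)
      U = tabulate φ ++ tabulate ω₁

      choose : ∀ i → not (c i) ≡ true → ∀ ws → length ws < # (not ∘ c) →
               ∃ λ w → (g (φ (inject₁ i)) w ∧ g (φ (parent t i)) w) ≡ true × w ∉ U × w ∉ ws
      choose i ci ws h =
        let w , e , f = pick-fresh (λ w → g (φ (inject₁ i)) w ∧ g (φ (parent t i)) w) (U ++ ws)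
                          (≤-trans bound (big-codeg (rest i (not-true ci))))
        in w , e , f ∘ ∈-++⁺ˡ , f ∘ ∈-++⁺ʳ U
        where
        open ≤-Reasoning
        bound : length (U ++ ws) < K
        bound = begin-strict
          length (U ++ ws)  ≡⟨ length-++ U ⟩
          length U + length ws  ≡⟨ cong (_+ length ws) (length-++ (tabulate φ)) ⟩
          length (tabulate φ) + length (tabulate ω₁) + length ws ≡⟨ cong₂ (λ a b → a + b + length ws) (length-tabulate φ) (length-tabulate ω₁) ⟩
          suc m + m + length ws  ≤⟨ +-monoʳ-≤ (suc m + m) (<⇒≤ (<-≤-trans h (#≤n (not ∘ c)))) ⟩
          suc m + m + m  <⟨ ≤-refl ⟩
          K  ∎

      sel : ∃₂ λ (ω : Fin m → Fin n) (ws : List (Fin n)) → length ws ≡ # (not ∘ c)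
        × (∀ i → not (c i) ≡ true → (g (φ (inject₁ i)) (ω i) ∧ g (φ (parent t i)) (ω i)) ≡ true × ω i ∉ U × ω i ∈ ws)
        × (∀ i j → not (c i) ≡ true → not (c j) ≡ true → ω i ≡ ω j → i ≡ j)
      sel = sdr m (not ∘ c) (λ i w → (g (φ (inject₁ i)) w ∧ g (φ (parent t i)) w) ≡ true) (φ zero) U choose

      ω₂ : Fin m → Fin n
      ω₂ = proj₁ sel
      ω₂-ok = proj₁ (proj₂ (proj₂ (proj₂ sel)))
      ω₂-inj = proj₂ (proj₂ (proj₂ (proj₂ sel)))

      ω : Fin m → Fin n
      ω i = if c i then ω₁ i else ω₂ i

      nc : ∀ {i} → c i ≡ false → not (c i) ≡ true
      nc e = cong not e

      fresh₂ : ∀ {i} → c i ≡ false → ω₂ i ∉ U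
      fresh₂ {i} e = proj₁ (proj₂ (ω₂-ok i (nc e)))

    blowup : Blowup t g
    blowup = record
      { φ = φ ; ω = ω ; φ-inj = φ-inj ; ω-inj = inj ; disjoint = dis
      ; base = bs ; left = lf ; right = rt }
      where
      inj : ∀ i j → ω i ≡ ω j → i ≡ j
      inj i j e with c i in ci | c j in cj
      ... | true  | true  = ω₁-inj i j ci cj e
      ... | true  | false = contradiction (subst (_∈ U) e (∈-++⁺ʳ (tabulate φ) (∈-tabulate⁺ {f = ω₁} i))) (fresh₂ cj)
      ... | false | true  = contradiction (subst (_∈ U) (sym e) (∈-++⁺ʳ (tabulate φ) (∈-tabulate⁺ {f = ω₁} j))) (fresh₂ ci)
      ... | false | false = ω₂-inj i j (nc ci) (nc cj) e
      dis : ∀ i j → φ i ≢ ω j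
      dis i j e with c j in cj
      ... | true  = off i j cj e
      ... | false = fresh₂ cj (subst (_∈ U) e (∈-++⁺ˡ (∈-tabulate⁺ {f = φ} i)))
      bs : ∀ i → g (φ (inject₁ i)) (φ (parent t i)) ≡ true
      bs i with c i in ci
      ... | true  = proj₁ (tri i ci)
      ... | false = big→g _ _ (rest i ci)
      lf : ∀ i → g (φ (inject₁ i)) (ω i) ≡ true
      lf i with c i in ci
      ... | true  = proj₁ (proj₂ (tri i ci))
      ... | false = proj₁ (∧-true (proj₁ (ω₂-ok i (nc ci))))
      rt : ∀ i → g (φ (parent t i)) (ω i) ≡ true
      rt i with c i in ci
      ... | true  = proj₂ (proj₂ (tri i ci))
      ... | false = proj₂ (∧-true {g (φ (inject₁ i)) (ω₂ i)} (proj₁ (ω₂-ok i (nc ci))))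

-- Sparse classes of edges, and the embedding through high vertices

-- The edges of T - I, where I is the colour class of `col`.
rr : ∀ {m} → Tree m → (Fin (suc m) → Bool) → Fin m → Bool
rr t col i = not (col (inject₁ i)) ∧ not (col (parent t i))

#-==-∨ : ∀ {n} (u : Fin n) (p : Fin n → Bool) {c} → # p ≤ c → # (λ b → b == u ∨ p b) ≤ suc c
#-==-∨ u p h = ≤-trans (#-split (λ b → b == u ∨ p b) (_== u) p λ _ → ∨-true) (+-mono-≤ (≤-reflexive (#-== u)) h)

module _ {n} (g : BRel n) (gs : Symᵇ g) (gi : Irrᵇ g) (m D : ℕ) where
  open Classes g gs gi m D

  -- Vertices that a new vertex has to avoid on account of a used vertex `u`. A high `u` excludes
  -- only itself, since its big neighbourhood has no useful bound.
  near-low : Fin n → Fin n → Bool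
  near-low u b = b == u ∨ (not (hi u) ∧ big u b)

  #-near-low : ∀ u → # (near-low u) ≤ suc D
  #-near-low u = #-==-∨ u (λ b → not (hi u) ∧ big u b) le
    where
    le : # (λ b → not (hi u) ∧ big u b) ≤ D
    le with hi u in eq
    ... | false = lo-deg eq
    ... | true  = ≤-trans (≤-reflexive (#-none {n} {p = λ _ → false} λ _ → refl)) z≤n

module Sparse {n} (g : BRel n) (gs : Symᵇ g) (gi : Irrᵇ g) {m} (t : Tree m) (free : ¬ Blowup t g) (D : ℕ) where
  open Classes g gs gi m D

  smallT : BRel n
  smallT x y = small x y ∧ some (λ w → small x w ∧ small y w)

  twin : BRel n
  twin x y = arc core x y ∧ arc core y x

  private
    to-n : ∀ {a c} b → a ≤ b * c → c ≤ n → a ≤ b * n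
    to-n b h k = ≤-trans h (*-monoʳ-≤ b k)

    2m<K : ∀ k → k ≤ 2 * m → suc k < K
    2m<K k h = s≤s (s≤s (≤-trans h (≤-trans (≤-reflexive (cong (m +_) (+-identityʳ m))) (m≤m+n (m + m) m))))

  size-big : size big ≤ 2 * suc (2 * m * 1) * n
  size-big = to-n (2 * suc (2 * m * 1)) (sparse g big gi big-sym big-irr t free (2 * m) (n≤1+n _) (λ a u b → b == u) 1
                    (λ a u → ≤-reflexive (#-== u)) wit) (#≤n _)
    where
    wit : ∀ a b U → big a b ≡ true → length U ≤ 2 * m → (∀ u → u ∈ U → b == u ≡ false) →
      b ∉ U × (∃ λ w → w ∉ U × g b a ≡ true × g b w ≡ true × g a w ≡ true)
    wit a b U e lU f =
      let w , p , w∉ = pick-fresh (λ w → g b w ∧ g a w) U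
                         (<-trans (n<1+n _) (<-≤-trans (2m<K _ lU) (big-codeg (big-sym a b e))))
          p₁ , p₂ = ∧-true {g b w} p
      in (λ b∈ → clash (==-refl b) (f b b∈)) , w , w∉ , gs a b (big→g a b e) , p₁ , p₂

  size-smallT : size smallT ≤ 2 * suc (2 * m * suc K) * n
  size-smallT = to-n (2 * suc (2 * m * suc K)) (sparse g smallT gi sy irr t free (2 * m) (n≤1+n _) q (suc K) bd wit) (#≤n _)
    where
    sy : Symᵇ smallT
    sy x y e with ∧-true {small x y} e
    ... | a , b = let w , p = some-elim (λ w → small x w ∧ small y w) b
                      p₁ , p₂ = ∧-true {small x w} p
                  in ∧-intro (small-sym x y a) (some-intro (λ w → small y w ∧ small x w) w (∧-intro p₂ p₁))
    irr : Irrᵇ smallT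
    irr = ≼-irr {S = smallT} {R = small} (λ x y e → proj₁ (∧-true {small x y} e)) small-irr
    q : Fin n → Fin n → Fin n → Bool
    q a u b = b == u ∨ (small a u ∧ (g a b ∧ g u b))
    bd : ∀ a u → # (q a u) ≤ suc K
    bd a u = #-==-∨ u (λ b → small a u ∧ (g a b ∧ g u b)) le
      where
      le : # (λ b → small a u ∧ (g a b ∧ g u b)) ≤ K
      le with small a u in eq
      ... | true  = small-codeg eq
      ... | false = ≤-trans (≤-reflexive (#-none {n} {p = λ _ → false} λ _ → refl)) z≤n
    wit : ∀ a b U → smallT a b ≡ true → length U ≤ 2 * m → (∀ u → u ∈ U → q a u b ≡ false) →
      b ∉ U × (∃ λ w → w ∉ U × g b a ≡ true × g b w ≡ true × g a w ≡ true)
    wit a b U e lU f with ∧-true {small a b} e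
    ... | e₁ , e₂ with some-elim (λ w → small a w ∧ small b w) e₂
    ...   | w , p with ∧-true {small a w} p
    ...     | aw , bw = (λ b∈ → clash (==-refl b) (proj₁ (∨-false (f b b∈)))) , w , w∉ ,
                        gs a b gab , small→g b w bw , small→g a w aw
      where
      gab : g a b ≡ true
      gab = small→g a b e₁
      w∉ : w ∉ U
      w∉ w∈ = clash (∧-intro aw (∧-intro gab (gs b w (small→g b w bw)))) (proj₂ (∨-false {b == w} (f w w∈)))

  -- In a twin whichever end is new has a friend, and this serves as the third vertex. A friend is
  -- low, so if it were used, the new end would lie in the big neighbourhood of a low used vertex,
  -- which its choice excludes.
  size-twin : size twin ≤ 2 * suc (2 * m * suc D) * n
  size-twin = to-n (2 * suc (2 * m * suc D)) (sparse g twin gi sy irr t free (2 * m) (n≤1+n _) (λ _ → near-low g gs gi m D) (suc D) (λ _ → #-near-low g gs gi m D) wit) (#≤n _)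
    where
    sy : Symᵇ twin
    sy x y e = let a , b = ∧-true {arc core x y} e in ∧-intro b a
    irr : Irrᵇ twin
    irr = ≼-irr {S = twin} {R = core} (λ x y e → arc→ {core} x y (proj₁ (∧-true {arc core x y} e))) core-irr
    wit : ∀ a b U → twin a b ≡ true → length U ≤ 2 * m → (∀ u → u ∈ U → near-low g gs gi m D u b ≡ false) →
      b ∉ U × (∃ λ w → w ∉ U × g b a ≡ true × g b w ≡ true × g a w ≡ true)
    wit a b U e lU f with ∧-true {arc core a b} e
    ... | e₁ , e₂ with arc-friend {core} e₂
    ...   | w , p with ∧-true {big b w} p
    ...     | bw , wa = (λ b∈ → clash (==-refl b) (proj₁ (∨-false (f b b∈)))) , w , w∉ ,
                        small→g b a (core→small b a (arc→ {core} b a e₂)) , big→g b w bw ,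
                        small→g a w (core→small a w (core-sym w a wa))
      where
      w∉ : w ∉ U
      w∉ w∈ = clash (∧-intro (cong not (core-loˡ {w} {a} wa)) (big-sym b w bw)) (proj₂ (∨-false {b == w} (f w w∈)))

-- The independent set I = {i | col i} goes to the set Z of common high neighbours, the rest of the
-- tree into S, so that only the edges off I need a third vertex chosen with care.
module HighEmbedding {n} (g : BRel n) (gs : Symᵇ g) (gi : Irrᵇ g) {m} (t : Tree m) (D : ℕ)
  (col : Fin (suc m) → Bool)
  (indep : ∀ i → col (inject₁ i) ≡ true → col (parent t i) ≡ true → ⊥)
  (s : ℕ) (budget : # col + # (rr t col) ≤ s)
  where
  open Classes g gs gi m D

  -- Room to avoid `near-low` of up to m + 1 placed vertices, at most `suc D` vertices for each.
  M : ℕ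
  M = suc (suc m * suc D)

  module _ (S S₁ : BRel n) (sy : Symᵇ S) (S≼S₁ : S ≼ S₁) (sy₁ : Symᵇ S₁) (S₁≼core : S₁ ≼ core)
    (Z : Fin n → Bool) (Z-hi : ∀ z → Z z ≡ true → hi z ≡ true)
    (Z-big : ∀ x y z → S x y ≡ true → Z z ≡ true → big x z ≡ true)
    (#col≤#Z : # col ≤ # Z)
    (full : ∀ x y → S x y ≡ true → s ≤ cn S₁ x y)
    (deg : MinDegree M S)
    (x₀ y₀ : Fin n) (e₀ : S x₀ y₀ ≡ true)
    where

    private
      Active : Fin n → Set
      Active x = ∃ λ y → S x y ≡ true

      active-lo : ∀ {x} → Active x → hi x ≡ false
      active-lo (y , e) = core-loˡ (S₁≼core _ _ (S≼S₁ _ _ e))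

      -- The whole of T is placed in `S`, including I, with no big edge between placed vertices. The
      -- images of I are replaced by elements of `Z` afterwards.
      place : ∀ {k} (t′ : Tree k) → k ≤ m → ∃₂ λ (φ : Fin (suc k) → Fin n) (U : List (Fin n)) →
        length U ≡ suc k × (∀ i → φ i ∈ U) × (∀ i → Active (φ i))
        × (∀ i → S (φ (inject₁ i)) (φ (parent t′ i)) ≡ true)
        × (∀ i j → i ≢ j → φ i ≢ φ j × big (φ i) (φ j) ≡ false)
      place root _ = (λ _ → x₀) , x₀ ∷ [] , refl , (λ _ → here refl) , (λ _ → y₀ , e₀) , (λ ()) ,
        λ { zero zero ne → contradiction refl ne }
      place {suc k} (grow a t′) k<m with place t′ (<⇒≤ k<m)
      ... | φ , U , len , mem , act , edge , sep = b ∷ᶠ φ , b ∷ U , cong suc len ,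
        (λ { zero → here refl ; (suc i) → there (mem i) }) ,
        (λ { zero → φ a , sy _ _ e ; (suc i) → act i }) ,
        (λ { zero → sy _ _ e ; (suc i) → edge i }) ,
        (λ { zero    zero    ne → contradiction refl ne
           ; zero    (suc j) ne → (λ q → proj₁ (new j) (sym q)) , flip-big (proj₂ (new j))
           ; (suc i) zero    ne → new i
           ; (suc i) (suc j) ne → sep i j (ne ∘ cong suc) })
        where
        got : ∃ λ w → S (φ a) w ≡ true × (∀ u → u ∈ U → near-low g gs gi m D u w ≡ false)
        got = pick (S (φ a)) (near-low g gs gi m D) (suc D) U (λ u _ → #-near-low g gs gi m D u)
                (≤-trans (s≤s (*-monoˡ-≤ (suc D) (≤-trans (≤-reflexive len) (m≤n⇒m≤1+n k<m))))
                         (deg (φ a) (proj₁ (act a)) (proj₂ (act a))))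
        b = proj₁ got
        e : S (φ a) b ≡ true
        e = proj₁ (proj₂ got)
        new : ∀ j → φ j ≢ b × big (φ j) b ≡ false
        new j with ∨-false {b == φ j} (proj₂ (proj₂ got) (φ j) (mem j))
        ... | f₁ , f₂ rewrite active-lo (act j) = (λ q → ==-false f₁ (sym q)) , f₂
        flip-big : ∀ {x y} → big x y ≡ false → big y x ≡ false
        flip-big {x} {y} f with big y x in eq
        ... | false = refl
        ... | true  = clash (big-sym y x eq) f

    abstract
      high-blowup : Blowup t g
      high-blowup with place t ≤-refl
                     | sdr (suc m) col (λ _ w → Z w ≡ true) x₀ []
                         (λ i _ ws l → let w , e , f = pick-fresh Z ws (<-≤-trans l #col≤#Z) in w , e , (λ ()) , f)
      ... | φ₀ , _ , _ , _ , act , edge , sep | ζ , zs , lenz , okz , injz = build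
        where
        φ : Fin (suc m) → Fin n
        φ i = if col i then ζ i else φ₀ i
        φ-I : ∀ {i} → col i ≡ true → φ i ≡ ζ i
        φ-I e rewrite e = refl
        φ-R : ∀ {i} → col i ≡ false → φ i ≡ φ₀ i
        φ-R e rewrite e = refl
        ζ-hi : ∀ {i} → col i ≡ true → hi (ζ i) ≡ true
        ζ-hi {i} e = Z-hi _ (proj₁ (okz i e))
        ζ-big : ∀ {i} → col i ≡ true → ∀ {x} → Active x → big x (ζ i) ≡ true
        ζ-big {i} e (y , f) = Z-big _ y _ f (proj₁ (okz i e))
        φ-inj : ∀ i j → φ i ≡ φ j → i ≡ j
        φ-inj i j q with true⊎false (col i) | true⊎false (col j)
        ... | inj₁ ci | inj₁ cj = injz i j ci cj (trans (sym (φ-I ci)) (trans q (φ-I cj)))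
        ... | inj₁ ci | inj₂ cj = clash (trans (cong hi (trans (sym (φ-R cj)) (trans (sym q) (φ-I ci)))) (ζ-hi ci)) (active-lo (act j))
        ... | inj₂ ci | inj₁ cj = clash (trans (cong hi (trans (sym (φ-R ci)) (trans q (φ-I cj)))) (ζ-hi cj)) (active-lo (act i))
        ... | inj₂ ci | inj₂ cj with i ≟ j
        ...   | yes e = e
        ...   | no ne = contradiction (trans (sym (φ-R ci)) (trans q (φ-R cj))) (proj₁ (sep i j ne))
        c : Fin m → Bool
        c = rr t col
        c-off : ∀ i → c i ≡ true → col (inject₁ i) ≡ false × col (parent t i) ≡ false
        c-off i e = let a , b = ∧-true {not (col (inject₁ i))} e in not-true a , not-true b
        Ok : Fin m → Fin n → Set
        Ok i w = third S₁ (φ₀ (inject₁ i)) (φ₀ (parent t i)) w ≡ true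
        φ₀-sep : ∀ i j → big (φ₀ i) (φ₀ j) ≡ false
        φ₀-sep i j with i ≟ j
        ... | yes refl = big-irr (φ₀ i)
        ... | no ne    = proj₂ (sep i j ne)
        -- A third vertex is high or joined to one of the ends by a big edge, whereas the placed
        -- vertices are low and no two of them form a big edge. Only the images in `Z` have to be
        -- avoided explicitly.
        avoid : ∀ i j k w → third S₁ (φ₀ i) (φ₀ j) w ≡ true → w ∉ zs → w ≢ φ k
        avoid i j k w e w∉ q with true⊎false (col k)
        ... | inj₁ ck = w∉ (subst (_∈ zs) (sym (trans q (φ-I ck))) (proj₂ (proj₂ (okz k ck))))
        ... | inj₂ ck with trans q (φ-R ck)
        ...   | refl with ∨-true {common (φ₀ i) (φ₀ j) (φ₀ k)} e
        ...     | inj₁ h = clash (proj₁ (∧-true {hi (φ₀ k)} h)) (active-lo (act k))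
        ...     | inj₂ h with ∨-true {friend S₁ (φ₀ i) (φ₀ j) (φ₀ k)} h
        ...       | inj₁ h₁ = clash (proj₁ (∧-true {big (φ₀ i) (φ₀ k)} h₁)) (φ₀-sep i k)
        ...       | inj₂ h₂ = clash (proj₁ (∧-true {big (φ₀ j) (φ₀ k)} h₂)) (φ₀-sep j k)
        choose : ∀ i → c i ≡ true → ∀ ws → length ws < # c → ∃ λ w → Ok i w × w ∉ tabulate φ × w ∉ ws
        choose i ci ws l =
          let w , e , f = pick-fresh (third S₁ (φ₀ (inject₁ i)) (φ₀ (parent t i))) (zs ++ ws) bound
          in w , e ,
             (λ w∈ → let k , q = ∈-tabulate⁻ {f = φ} w∈ in avoid (inject₁ i) (parent t i) k w e (f ∘ ∈-++⁺ˡ) q) ,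
             f ∘ ∈-++⁺ʳ zs
          where
          open ≤-Reasoning
          -- The budget is spent on the |I| images in `Z` and on the earlier third vertices, fewer
          -- than the number of edges of T - I.
          bound : length (zs ++ ws) < # (third S₁ (φ₀ (inject₁ i)) (φ₀ (parent t i)))
          bound = begin-strict
            length (zs ++ ws)  ≡⟨ length-++ zs ⟩
            length zs + length ws  ≡⟨ cong (_+ length ws) lenz ⟩
            # col + length ws  <⟨ +-monoʳ-< (# col) l ⟩
            # col + # c  ≤⟨ budget ⟩
            s  ≤⟨ full _ _ (edge i) ⟩
            cn S₁ (φ₀ (inject₁ i)) (φ₀ (parent t i)) ≤⟨ cn≤third S₁≼core sy₁ _ _ ⟩
            # (third S₁ (φ₀ (inject₁ i)) (φ₀ (parent t i))) ∎
        rest : ∀ i → c i ≡ false → big (φ (inject₁ i)) (φ (parent t i)) ≡ true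
        rest i ci with true⊎false (col (inject₁ i)) | true⊎false (col (parent t i))
        ... | inj₁ a | inj₁ b = ⊥-elim (indep i a b)
        ... | inj₁ a | inj₂ b = trans (cong₂ big (φ-I a) (φ-R b)) (big-sym _ _ (ζ-big a (act _)))
        ... | inj₂ a | inj₁ b = trans (cong₂ big (φ-R a) (φ-I b)) (ζ-big b (act _))
        ... | inj₂ a | inj₂ b = clash (∧-intro (cong not a) (cong not b)) ci
        build : Blowup t g
        build with sdr m c Ok x₀ (tabulate φ) choose
        ... | ω , ws , _ , ok , inj = Finish.blowup {t = t} φ φ-inj c ω inj
                (λ i j cj q → proj₁ (proj₂ (ok j cj)) (subst (_∈ tabulate φ) q (∈-tabulate⁺ {f = φ} i)))
                tri rest
          where
          tri : ∀ i → c i ≡ true → g (φ (inject₁ i)) (φ (parent t i)) ≡ true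
             × g (φ (inject₁ i)) (ω i) ≡ true × g (φ (parent t i)) (ω i) ≡ true
          tri i ci rewrite φ-R (proj₁ (c-off i ci)) | φ-R (proj₂ (c-off i ci)) =
            small→g _ _ (core→small _ _ (S₁≼core _ _ (S≼S₁ _ _ (edge i)))) ,
            third-g S₁≼core sy₁ _ _ _ (proj₁ (ok i ci))

-- Edges with many common high neighbours

size-cover : ∀ {n k} (S : BRel n) (R : Fin k → BRel n) →
  (∀ x y → S x y ≡ true → ∃ λ z → R z x y ≡ true) → size S ≤ sum (size ∘ R)
size-cover {n} S R h = begin
  size S  ≤⟨ sum-mono (λ x → sum-mono (pt x)) ⟩
  sum (λ x → sum λ y → sum λ z → 𝟙 (R z x y) * 1)  ≡⟨ sum-cong-≗ (λ x → ∑-comm (λ y z → 𝟙 (R z x y) * 1)) ⟩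
  sum (λ x → sum λ z → sum λ y → 𝟙 (R z x y) * 1)  ≡⟨ ∑-comm (λ x z → sum λ y → 𝟙 (R z x y) * 1) ⟩
  sum (size ∘ R)  ∎
  where
  open ≤-Reasoning
  pt : ∀ x y → 𝟙 (S x y) * 1 ≤ sum λ z → 𝟙 (R z x y) * 1
  pt x y with S x y in eq
  ... | false = z≤n
  ... | true  = let z , e = h x y eq in
                ≤-trans (≤-reflexive (cong (λ b → 𝟙 b * 1) (sym e))) (term≤sum (λ z → 𝟙 (R z x y) * 1) z)

#-insert : ∀ {n} (Z : Fin n → Bool) z → Z z ≡ false → suc (# Z) ≤ # (λ w → w == z ∨ Z w)
#-insert Z z h = ≤-trans
  (≤-reflexive (sym (trans (∑-distrib-+ (λ w → 𝟙 (w == z)) (𝟙 ∘ Z)) (cong (_+ # Z) (#-== z)))))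
  (sum-mono pt)
  where
  pt : ∀ w → 𝟙 (w == z) + 𝟙 (Z w) ≤ 𝟙 (w == z ∨ Z w)
  pt w with w == z in eq
  ... | false = ≤-refl
  ... | true rewrite ==-true {x = w} {z} eq | h = ≤-refl

module Heavy {n} (g : BRel n) (gs : Symᵇ g) (gi : Irrᵇ g) {m} (t : Tree m) (free : ¬ Blowup t g) (D : ℕ)
  (col : Fin (suc m) → Bool)
  (indep : ∀ i → col (inject₁ i) ≡ true → col (parent t i) ≡ true → ⊥)
  (s : ℕ) (budget : # col + # (rr t col) ≤ s)
  (S₁ : BRel n) (sy₁ : Symᵇ S₁) (S₁≼core : S₁ ≼ Classes.core g gs gi m D)
  where
  open Classes g gs gi m D
  open HighEmbedding g gs gi t D col indep s budget

  common-sym : ∀ {x y z} → common x y z ≡ true → common y x z ≡ true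
  common-sym {x} {y} {z} e =
    let a , b = ∧-true {hi z} e ; c , d = ∧-true {big x z} b in ∧-intro a (∧-intro d c)

  heavy : BRel n
  heavy x y = S₁ x y ∧ (does (# col ≤? # (common x y)) ∧ does (s ≤? cn S₁ x y))

  -- The j missing elements of Z are chosen one at a time among the common high neighbours.
  fixed-size : ∀ j (S₀ : BRel n) (Z : Fin n → Bool) → Symᵇ S₀ → S₀ ≼ S₁ →
    (∀ x y → S₀ x y ≡ true → s ≤ cn S₁ x y) →
    (∀ x y z → S₀ x y ≡ true → Z z ≡ true → hi z ≡ true × big x z ≡ true) →
    # col ≤ # Z + j →
    (∀ x y → S₀ x y ≡ true → j ≤ # λ z → common x y z ∧ not (Z z)) →
    size S₀ ≤ 2 * M * D ^ j * support S₀
  fixed-size zero S₀ Z sy le full Z-ok enough _ =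
    ≤-trans (degenerate-size S₀ M sy (≼-irr (λ x y e → S₁≼core x y (le x y e)) core-irr) none)
            (≤-reflexive (cong (_* support S₀) (sym (*-identityʳ (2 * M)))))
    where
    none : ∀ S → Symᵇ S → S ≼ S₀ → MinDegree M S → ∀ x y → S x y ≡ false
    none S s′ le′ deg x y with S x y in eq
    ... | false = refl
    ... | true  = ⊥-elim (free (high-blowup S S₁ s′ (λ a b e → le a b (le′ a b e)) sy₁ S₁≼core Z (λ z q → proj₁ (Z-ok x y z (le′ x y eq) q))
                    (λ a b z e q → proj₂ (Z-ok a b z (le′ a b e) q)) (≤-trans enough (≤-reflexive (+-identityʳ (# Z))))
                    (λ a b e → full a b (le′ a b e)) deg x y eq))
  fixed-size (suc j) S₀ Z sy le full Z-ok enough rest = begin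
    size S₀  ≤⟨ size-cover S₀ R cover ⟩
    sum (λ z → size (R z))  ≤⟨ sum-mono each ⟩
    sum (λ z → C * support (R z))  ≡⟨ sym (*-distribˡ-sum C (λ z → support (R z))) ⟩
    C * sum (λ z → support (R z))  ≤⟨ *-monoʳ-≤ C supports ⟩
    C * (D * support S₀)  ≡⟨ sym (*-assoc C D (support S₀)) ⟩
    C * D * support S₀  ≡⟨ cong (_* support S₀) (trans (*-assoc (2 * M) (D ^ j) D) (cong (2 * M *_) (*-comm (D ^ j) D))) ⟩
    2 * M * D ^ suc j * support S₀  ∎
    where
    open ≤-Reasoning
    C = 2 * M * D ^ j
    R : Fin n → BRel n
    R z x y = S₀ x y ∧ (common x y z ∧ not (Z z))
    cover : ∀ x y → S₀ x y ≡ true → ∃ λ z → R z x y ≡ true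
    cover x y e = let z , f = #-∃ (≤-trans (s≤s z≤n) (rest x y e)) in z , ∧-intro e f
    R≼ : ∀ z → R z ≼ S₀
    R≼ z x y e = proj₁ (∧-true e)
    R-common : ∀ z x y → R z x y ≡ true → common x y z ≡ true × Z z ≡ false
    R-common z x y e = let a , b = ∧-true {common x y z} (proj₂ (∧-true {S₀ x y} e)) in a , not-true b
    each : ∀ z → size (R z) ≤ C * support (R z)
    each z with Z z in Zz
    ... | true  = ≤-trans (≤-reflexive (sum-zero λ x → sum-zero λ y → gone x y)) z≤n
      where
      gone : ∀ x y → 𝟙 (S₀ x y ∧ (common x y z ∧ false)) * 1 ≡ 0
      gone x y with S₀ x y | common x y z
      ... | true  | true  = refl
      ... | true  | false = refl
      ... | false | _     = refl
    -- Matching on `Z z` has replaced it by `false` in the goal. `R′` exposes this Boolean, so that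
    -- the bound for `R z` can be transported.
    ... | false = subst (λ b → size (R′ (not b)) ≤ C * support (R′ (not b))) Zz
                    (fixed-size j (R z) Z′ R-sym (λ x y e → le x y (R≼ z x y e)) (λ x y e → full x y (R≼ z x y e)) Z′-ok enough′ rest′)
      where
      R′ : Bool → BRel n
      R′ b x y = S₀ x y ∧ (common x y z ∧ b)
      Z′ : Fin n → Bool
      Z′ w = w == z ∨ Z w
      R-sym : Symᵇ (R z)
      R-sym x y e = let a , _ = R-common z x y e in
        ∧-intro (sy x y (R≼ z x y e)) (∧-intro (common-sym {x} {y} a) (cong not Zz))
      Z′-ok : ∀ x y w → R z x y ≡ true → Z′ w ≡ true → hi w ≡ true × big x w ≡ true
      Z′-ok x y w e f with ∨-true {w == z} f
      ... | inj₂ q = Z-ok x y w (R≼ z x y e) q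
      ... | inj₁ q rewrite ==-true {x = w} {z} q =
            let a , b = ∧-true {hi z} (proj₁ (R-common z x y e)) in a , proj₁ (∧-true {big x z} b)
      enough′ : # col ≤ # Z′ + j
      enough′ = ≤-trans enough (≤-trans (≤-reflexive (+-suc (# Z) j)) (+-monoˡ-≤ j (#-insert Z z Zz)))
      rest′ : ∀ x y → R z x y ≡ true → j ≤ # λ w → common x y w ∧ not (Z′ w)
      rest′ x y e = s≤s⁻¹ (≤-trans (rest x y (R≼ z x y e))
        (≤-trans (#-split (λ w → common x y w ∧ not (Z w)) (_== z) (λ w → common x y w ∧ not (Z′ w)) split)
                 (+-monoˡ-≤ _ (≤-reflexive (#-== z)))))
        where
        split : ∀ w → common x y w ∧ not (Z w) ≡ true → w == z ≡ true ⊎ common x y w ∧ not (Z′ w) ≡ true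
        split w f with w == z
        ... | true  = inj₁ refl
        ... | false = inj₂ f
    -- An active vertex of `R z` has `z` as a big neighbour, and being low it has at most `D` such
    -- neighbours. Hence each chosen element of `Z` costs a factor `D` and not a factor n.
    supports : sum (λ z → support (R z)) ≤ D * support S₀
    supports = begin
      sum (λ z → # λ x → some (R z x))  ≤⟨ sum-mono (λ z → sum-mono λ x → pt z x) ⟩
      sum (λ z → sum λ x → 𝟙 (some (S₀ x)) * 𝟙 (big x z))  ≡⟨ ∑-comm (λ z x → 𝟙 (some (S₀ x)) * 𝟙 (big x z)) ⟩
      sum (λ x → sum λ z → 𝟙 (some (S₀ x)) * 𝟙 (big x z))  ≡⟨ sum-cong-≗ (λ x → sym (*-distribˡ-sum (𝟙 (some (S₀ x))) (λ z → 𝟙 (big x z)))) ⟩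
      sum (λ x → 𝟙 (some (S₀ x)) * # (big x))  ≤⟨ ∑-𝟙*≤ (λ x → some (S₀ x)) D (λ x e →
        let y , f = some-elim (S₀ x) e in lo-deg (core-loˡ {x} {y} (S₁≼core x y (le x y f)))) ⟩
      D * support S₀  ∎
      where
      pt : ∀ z x → 𝟙 (some (R z x)) ≤ 𝟙 (some (S₀ x)) * 𝟙 (big x z)
      pt z x = ≤-trans (𝟙-mono {b = some (S₀ x) ∧ big x z} λ e →
        let y , f = some-elim (R z x) e
        in ∧-intro (some-intro (S₀ x) y (R≼ z x y f)) (proj₁ (∧-true {big x z} (proj₂ (∧-true {hi z} (proj₁ (R-common z x y f)))))))
        (≤-reflexive (𝟙-∧ (some (S₀ x)) (big x z)))

  cn-comm : ∀ x y → cn S₁ x y ≤ cn S₁ y x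
  cn-comm x y = +-mono-≤ (#-mono {p = common x y} λ z → common-sym {x} {y} {z})
    (≤-reflexive (+-comm (# (friend S₁ x y)) _))

  heavy-sym : Symᵇ heavy
  heavy-sym x y e with ∧-true {S₁ x y} e
  ... | a , b with ∧-true {does (# col ≤? # (common x y))} b
  ...   | c , d = ∧-intro (sy₁ x y a) (∧-intro
    (does-intro (# col ≤? _) (≤-trans (does-true {d = # col ≤? # (common x y)} c) (#-mono {p = common x y} λ z → common-sym {x} {y} {z})))
    (does-intro (s ≤? _) (≤-trans (does-true {d = s ≤? cn S₁ x y} d) (cn-comm x y))))

  size-heavy : size heavy ≤ 2 * M * D ^ # col * n
  size-heavy = ≤-trans
    (fixed-size (# col) heavy (λ _ → false) heavy-sym (λ x y e → proj₁ (∧-true e))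
      (λ x y e → does-true {d = s ≤? cn S₁ x y} (proj₂ (∧-true {does (# col ≤? # (common x y))} (proj₂ (∧-true {S₁ x y} e)))))
      (λ _ _ _ _ ()) (m≤n+m (# col) (# {n} λ _ → false))
      (λ x y e → ≤-trans (does-true {d = # col ≤? # (common x y)} (proj₁ (∧-true (proj₂ (∧-true {S₁ x y} e)))))
                         (#-mono {p = common x y} λ z q → ∧-intro q refl)))
    (*-monoʳ-≤ (2 * M * D ^ # col) (#≤n _))

-- The embedding along friendships

abstract
  remove : ∀ {A : Set} {x : A} {l} → x ∈ l → ∃ λ l′ → length l ≡ suc (length l′) × (∀ y → y ∈ l → y ≢ x → y ∈ l′)
  remove {l = _ ∷ l} (here refl) = l , refl , λ { _ (here q) ne → contradiction q ne ; _ (there y∈) _ → y∈ }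
  remove {l = z ∷ l} (there x∈) with remove x∈
  ... | l′ , len , f = z ∷ l′ , cong suc len , λ { _ (here q) _ → here q ; y (there y∈) ne → there (f y y∈ ne) }

#-inject₁ : ∀ {m} (p : Fin (suc m) → Bool) → p (fromℕ m) ≡ true → suc (# (p ∘ inject₁)) ≤ # p
#-inject₁ {zero}  p e = #-pos {p = p} zero e
#-inject₁ {suc m} p e =
  ≤-trans (≤-reflexive (sym (+-suc (𝟙 (p zero)) _))) (+-monoʳ-≤ (𝟙 (p zero)) (#-inject₁ (p ∘ suc) e))

-- Balls in a graph of maximum degree at most `D`: each further step multiplies the size by at most
-- 1 + D.
module Near {n} (link : BRel n) (link-sym : Symᵇ link) (D : ℕ) (deg : ∀ x → # (link x) ≤ D) where

  abstract
    near : ℕ → BRel n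
    near zero    x y = y == x
    near (suc r) x y = near r x y ∨ some (λ v → near r x v ∧ link v y)

    near-# : ∀ r x → # (near r x) ≤ suc D ^ r
    near-# zero    x = ≤-reflexive (#-== x)
    near-# (suc r) x = ≤-trans (#-split (near (suc r) x) (near r x) (λ y → some (λ v → near r x v ∧ link v y)) λ _ → ∨-true)
      (≤-trans (+-monoʳ-≤ _ step) (*-monoʳ-≤ (suc D) (near-# r x)))
      where
      open ≤-Reasoning
      step : # (λ y → some (λ v → near r x v ∧ link v y)) ≤ D * # (near r x)
      step = begin
        # (λ y → some (λ v → near r x v ∧ link v y))  ≤⟨ sum-mono (λ y → 𝟙-some≤# (λ v → near r x v ∧ link v y)) ⟩
        sum (λ y → # (λ v → near r x v ∧ link v y))  ≡⟨ sum-cong-≗ (λ y → sum-cong-≗ λ v → 𝟙-∧ (near r x v) (link v y)) ⟩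
        sum (λ y → sum λ v → 𝟙 (near r x v) * 𝟙 (link v y))  ≡⟨ ∑-comm (λ y v → 𝟙 (near r x v) * 𝟙 (link v y)) ⟩
        sum (λ v → sum λ y → 𝟙 (near r x v) * 𝟙 (link v y))  ≡⟨ sum-cong-≗ (λ v → sym (*-distribˡ-sum (𝟙 (near r x v)) (λ y → 𝟙 (link v y)))) ⟩
        sum (λ v → 𝟙 (near r x v) * # (link v))  ≤⟨ ∑-𝟙*≤ (near r x) D (λ v _ → deg v) ⟩
        D * # (near r x)  ∎

    near-step : ∀ {r x y z} → near r x y ≡ true → link y z ≡ true → near (suc r) x z ≡ true
    near-step {r} {x} {y} {z} h e = ∨-introʳ {near r x z} (some-intro (λ v → near r x v ∧ link v z) y (∧-intro h e))

    near-mono : ∀ {r r′ x y} → r ≤ r′ → near r x y ≡ true → near r′ x y ≡ true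
    near-mono h = go (≤⇒≤′ h)
      where
      go : ∀ {r r′ x y} → r ≤′ r′ → near r x y ≡ true → near r′ x y ≡ true
      go ≤′-refl     e = e
      go (≤′-step p) e = ∨-introˡ (go p e)

    near-refl : ∀ r x → near r x x ≡ true
    near-refl r x = near-mono {0} {r} {x} {x} z≤n (==-refl x)

    -- The last link of the walk from `b` to `x` is removed there and appended, reversed, to the
    -- walk from `a`, until the second walk is empty.
    near-meet : ∀ r r′ {a b x} → near r a x ≡ true → near r′ b x ≡ true → near (r + r′) a b ≡ true
    near-meet r zero {a} {b} {x} h e rewrite ==-true {x = x} {b} e = near-mono {r} {r + 0} {a} {b} (m≤m+n r 0) h
    near-meet r (suc r′) {a} {b} {x} h e with ∨-true {near r′ b x} e
    ... | inj₁ q = near-mono {r + r′} {r + suc r′} {a} {b} (+-monoʳ-≤ r (n≤1+n r′)) (near-meet r r′ {a} {b} {x} h q)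
    ... | inj₂ q with some-elim (λ v → near r′ b v ∧ link v x) q
    ...   | v , f with ∧-true {near r′ b v} f
    ...     | f₁ , f₂ = subst (λ k → near k a b ≡ true) (sym (+-suc r r′))
                          (near-meet (suc r) r′ {a} {b} {v} (near-step {r} {a} {x} {v} h (link-sym v x f₂)) f₁)

    near-sym : ∀ r {a b} → near r a b ≡ true → near r b a ≡ true
    near-sym r {a} {b} e = near-meet 0 r {b} {a} {b} (==-refl b) e

abstract
  -- Entries are pairs of a vertex and its centre; the result is the cluster of the centre `c`.
  mates : ∀ {n} → Fin n → List (Fin n × Fin n) → List (Fin n)
  mates c []            = []
  mates c ((x , d) ∷ u) = if d == c then x ∷ mates c u else mates c u

  mates-[] : ∀ {n} (c : Fin n) → mates c [] ≡ []
  mates-[] c = refl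

  ∈-mates : ∀ {n} {c x : Fin n} {u} → (x , c) ∈ u → x ∈ mates c u
  ∈-mates {c = c} {u = (x , d) ∷ u} (here refl) rewrite ==-refl c = here refl
  ∈-mates {c = c} {u = (x , d) ∷ u} (there h) with d == c
  ... | true  = there (∈-mates h)
  ... | false = ∈-mates h

  mates-hit : ∀ {n} (c x : Fin n) u → mates c ((x , c) ∷ u) ≡ x ∷ mates c u
  mates-hit c x u rewrite ==-refl c = refl

  mates-miss : ∀ {n} {c d : Fin n} x u → d ≢ c → mates c ((x , d) ∷ u) ≡ mates c u
  mates-miss {c = c} {d} x u ne with d == c in eq
  ... | false = refl
  ... | true  = contradiction (==-true eq) ne

  mates-none : ∀ {n} (c : Fin n) u → (∀ x → (x , c) ∉ u) → mates c u ≡ []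
  mates-none c [] h = refl
  mates-none c ((x , d) ∷ u) h =
    trans (mates-miss {c = c} {d} x u λ { refl → h x (here refl) }) (mates-none c u λ x x∈ → h x (there x∈))

-- No edge has |I| common high neighbours, so every edge of S is an arc in exactly one direction.
-- I is sent to heads of arcs and the rest of the tree to tails; a component of T - I is embedded
-- along friendships, inside a small ball around the image (the centre) of its top vertex.
module LowEmbedding {n} (g : BRel n) (gs : Symᵇ g) (gi : Irrᵇ g) {m} (t : Tree m) (D : ℕ)
  (col : Fin (suc m) → Bool)
  (indep : ∀ i → col (inject₁ i) ≡ true → col (parent t i) ≡ true → ⊥)
  (s : ℕ) (budget : # col + # (rr t col) ≤ s) (col-root : col (fromℕ m) ≡ true)
  where
  open Classes g gs gi m D

  -- Used vertices are within distance m of their centres, so a link between two clusters puts their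
  -- centres at distance at most 2m + 1. Centres further apart than `radius` exclude such links.
  radius : ℕ
  radius = suc m + suc m

  β : ℕ
  β = suc D ^ radius

  -- At most 2m + 1 vertices are used, and each forbids a ball of at most `β` vertices around its
  -- centre.
  M : ℕ
  M = suc (suc (2 * m) * β)

  link : BRel n
  link x y = big x y ∧ (not (hi x) ∧ not (hi y))

  link-sym : Symᵇ link
  link-sym = ∧-symᵇ {R = big} big-sym λ x y e → let a , b = ∧-true {not (hi x)} e in ∧-intro b a

  link-deg : ∀ x → # (link x) ≤ D
  link-deg x with hi x in eq
  ... | false = ≤-trans (#-mono {p = λ y → big x y ∧ not (hi y)} {q = big x} λ y e → proj₁ (∧-true e)) (lo-deg eq)
  ... | true  = ≤-trans (≤-reflexive (#-none {p = λ y → big x y ∧ false} λ y → ∧-false (big x y))) z≤n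
    where
    ∧-false : ∀ b → b ∧ false ≡ false
    ∧-false true  = refl
    ∧-false false = refl

  open Near link link-sym D link-deg

  module _ (S : BRel n) (sy : Symᵇ S) (S≼core : S ≼ core)
    (few : ∀ x y → S x y ≡ true → # (common x y) < # col)
    (full : ∀ x y → S x y ≡ true → s ≤ cn S x y)
    (oneway : ∀ x y → arc S x y ≡ true → arc S y x ≡ true → ⊥)
    (outdeg : ∀ x y → arc S x y ≡ true → M ≤ # (arc S x))
    (indeg : ∀ x y → arc S x y ≡ true → M ≤ # (λ z → arc S z y))
    where

    private
      arc-S : ∀ {x y} → arc S x y ≡ true → S x y ≡ true
      arc-S = arc→ {S} _ _

      friend-link : ∀ {x y w} → S x y ≡ true → friend S x y w ≡ true → link x w ≡ true
      friend-link {x} {y} {w} e f = let a , b = ∧-true {big x w} f in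
        ∧-intro a (∧-intro (cong not (core-loˡ (S≼core x y e))) (cong not (core-loˡ (S≼core w y b))))

      link-irr : ∀ {x} → link x x ≡ true → ⊥
      link-irr {x} e = clash (proj₁ (∧-true {big x x} e)) (big-irr x)

      -- Of at least |I| + |T - I| third vertices, fewer than |I| are common high neighbours, and
      -- `oneway` rules out friends of `y`. What is left are friends of `x`, more than |T - I| of
      -- them.
      #friend : ∀ {x y} → arc S x y ≡ true → # (rr t col) < # (friend S x y)
      #friend {x} {y} e = +-cancelˡ-< (# col) _ _ (begin-strict
        # col + # (rr t col)  ≤⟨ budget ⟩
        s  ≤⟨ full x y (arc-S e) ⟩
        # (common x y) + (# (friend S x y) + # (friend S y x))  ≡⟨ cong (λ k → # (common x y) + (# (friend S x y) + k)) none ⟩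
        # (common x y) + (# (friend S x y) + 0)  ≡⟨ cong (# (common x y) +_) (+-identityʳ _) ⟩
        # (common x y) + # (friend S x y)  <⟨ +-monoˡ-< _ (few x y (arc-S e)) ⟩
        # col + # (friend S x y)  ∎)
        where
        open ≤-Reasoning
        none : # (friend S y x) ≡ 0
        none = #-none λ w → nw w
          where
          nw : ∀ w → friend S y x w ≡ false
          nw w with friend S y x w in eq
          ... | false = refl
          ... | true  = ⊥-elim (oneway x y e (arc-intro {S} (sy x y (arc-S e)) eq))

      edge⇒arc : ∀ {x y} → S x y ≡ true → arc S x y ≡ true ⊎ arc S y x ≡ true
      edge⇒arc {x} {y} e with some (friend S x y) in f₁ | some (friend S y x) in f₂
      ... | true  | _     = inj₁ (∧-intro e refl)
      ... | false | true  = inj₂ (∧-intro (sy x y e) refl)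
      ... | false | false = contradiction (begin-strict
        # (common x y)  <⟨ few x y e ⟩
        # col  ≤⟨ m≤m+n (# col) _ ⟩
        # col + # (rr t col)  ≤⟨ budget ⟩
        s  ≤⟨ full x y e ⟩
        # (common x y) + (# (friend S x y) + # (friend S y x))  ≡⟨ cong₂ (λ k l → # (common x y) + (k + l)) (#-none {p = friend S x y} (some-none (friend S x y) f₁)) (#-none {p = friend S y x} (some-none (friend S y x) f₂)) ⟩
        # (common x y) + 0  ≡⟨ +-identityʳ _ ⟩
        # (common x y)  ∎) (<-irrefl refl)
        where open ≤-Reasoning

    -- The tree edges that meet I, by the end that lies in I: the parent for `entry`, the child for
    -- `pend`. As the root is in I, every component of T - I is opened by an `entry` edge, whose
    -- lower end becomes a centre.
    entry pend : ∀ {k} → Tree k → (Fin (suc k) → Bool) → Fin k → Bool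
    entry t′ c i = not (c (inject₁ i)) ∧ c (parent t′ i)
    pend  t′ c i = c (inject₁ i) ∧ not (c (parent t′ i))

    -- Every vertex used so far is recorded with its centre.
    record Placed {k} (t′ : Tree k) (c : Fin (suc k) → Bool) : Set where
      field
        φ κ       : Fin (suc k) → Fin n
        ω         : Fin k → Fin n
        used      : List (Fin n × Fin n)
        len       : length used ≤ suc (2 * k)
        φ-used    : ∀ i → (φ i , κ i) ∈ used
        ω-used    : ∀ i → entry t′ c i ≡ true → (ω i , κ (inject₁ i)) ∈ used
        near-used : ∀ x d → (x , d) ∈ used → near k d x ≡ true
        lo-used   : ∀ x d → (x , d) ∈ used → hi x ≡ false
        separate  : ∀ x d x′ d′ → (x , d) ∈ used → (x′ , d′) ∈ used → d ≢ d′ → near radius d d′ ≡ false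
        -- The centre, the friend that serves as third vertex of its `entry` edge, and at most one
        -- further vertex for each edge of T - I.
        cluster   : ∀ d → length (mates d used) ≤ 2 + # (rr t′ c)
        φ-inj     : ∀ i j → φ i ≡ φ j → i ≡ j
        ω-inj     : ∀ i j → entry t′ c i ≡ true → entry t′ c j ≡ true → ω i ≡ ω j → i ≡ j
        disjoint  : ∀ i j → entry t′ c j ≡ true → φ i ≢ ω j
        head      : ∀ i → c i ≡ true → ∃ λ x → arc S x (φ i) ≡ true
        tail      : ∀ i → c i ≡ false → ∃ λ y → arc S (φ i) y ≡ true
        e-edge    : ∀ i → entry t′ c i ≡ true → arc S (φ (inject₁ i)) (φ (parent t′ i)) ≡ true
                      × friend S (φ (inject₁ i)) (φ (parent t′ i)) (ω i) ≡ true
        p-edge    : ∀ i → pend t′ c i ≡ true → arc S (φ (parent t′ i)) (φ (inject₁ i)) ≡ true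
        r-edge    : ∀ i → rr t′ c i ≡ true → big (φ (inject₁ i)) (φ (parent t′ i)) ≡ true

    private
      -- A vertex close to a used vertex with another centre would bring the two centres together.
      module _ {k} {t′ : Tree k} {c} (P : Placed t′ c) (k≤m : k ≤ m) where
        open Placed P

        same-centre : ∀ {x d w d′} → (x , d) ∈ used → (w , d′) ∈ used → link x w ≡ true → d′ ≡ d
        same-centre {x} {d} {w} {d′} x∈ w∈ e with d′ ≟ d
        ... | yes q = q
        ... | no ne = clash (near-mono (+-mono-≤ (≤-trans k≤m (n≤1+n m)) (s≤s k≤m))
                        (near-meet k (suc k) (near-used w d′ w∈) (near-step (near-used x d x∈) e)))
                        (separate w d′ x d w∈ x∈ ne)

        Far : Fin n → Set
        Far b = ∀ x d → (x , d) ∈ used → near radius d b ≡ false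

        far-centre : ∀ {b} → Far b → ∀ x → (x , b) ∉ used
        far-centre far x x∈ = clash (near-refl radius _) (far x _ x∈)

        far-fresh : ∀ {b} → Far b → ∀ d → (b , d) ∉ used
        far-fresh far d b∈ =
          clash (near-mono (≤-trans k≤m (≤-trans (n≤1+n m) (m≤m+n (suc m) (suc m)))) (near-used _ d b∈)) (far _ d b∈)

        far-link : ∀ {b w} → Far b → link b w ≡ true → ∀ d → (w , d) ∉ used
        far-link {b} {w} far e d w∈ =
          clash (near-mono (≤-trans (s≤s k≤m) (m≤m+n (suc m) (suc m))) (near-step (near-used w d w∈) (link-sym b w e))) (far w d w∈)

        far-sep : ∀ {b} → Far b → ∀ x d → (x , d) ∈ used → near radius b d ≡ false
        far-sep {b} far x d x∈ with near radius b d in eq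
        ... | false = refl
        ... | true  = clash (near-sym radius eq) (far x d x∈)

        φ-fresh : ∀ {b} → (∀ d → (b , d) ∉ used) → ∀ i → φ i ≢ b
        φ-fresh h i refl = h _ (φ-used i)

        ω-fresh : ∀ {b} → (∀ d → (b , d) ∉ used) → ∀ i → entry t′ c i ≡ true → ω i ≢ b
        ω-fresh h i e refl = h _ (ω-used i e)

        abstract
          pick-far : (p : Fin n → Bool) → M ≤ # p → ∃ λ b → p b ≡ true × Far b
          pick-far p h =
            let b , e , f = pick p (λ u → near radius (proj₂ u)) β used (λ u _ → near-# radius (proj₂ u))
                  (≤-trans (s≤s (*-monoˡ-≤ β (≤-trans len (s≤s (*-monoʳ-≤ 2 k≤m))))) h)
            in b , e , λ x d x∈ → f (x , d) x∈

    private
      module Step {k} (a : Fin (suc k)) (t′ : Tree k) (c : Fin (suc (suc k)) → Bool) (k≤m : k ≤ m)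
        (P : Placed t′ (c ∘ suc)) where
        open Placed P

        used≤ : ∀ {x y : Fin n × Fin n} → length (x ∷ y ∷ used) ≤ suc (2 * suc k)
        used≤ = ≤-trans (s≤s (s≤s len)) (≤-reflexive (cong suc (sym (*-suc 2 k))))

        -- The parent is a tail, and its large out-degree gives a head far from all centres. The
        -- third vertex is left to `Complete`, where the final set of used vertices is known; the
        -- value `b` of `ω` here is a placeholder.
        pend-step : c zero ≡ true → c (suc a) ≡ false → Placed (grow a t′) c
        pend-step c0 ca = record
          { φ = b ∷ᶠ φ ; κ = b ∷ᶠ κ ; ω = b ∷ᶠ ω ; used = (b , b) ∷ used
          ; len = ≤-trans (n≤1+n _) (used≤ {b , b} {b , b})
          ; φ-used = λ { zero → here refl ; (suc i) → there (φ-used i) }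
          ; ω-used = λ { zero e → ⊥-elim (no-entry e) ; (suc i) e → there (ω-used i e) }
          ; near-used = λ { x d (here refl) → near-refl (suc k) b ; x d (there x∈) → near-mono (n≤1+n k) (near-used x d x∈) }
          ; lo-used = λ { x d (here refl) → core-loʳ (S≼core (φ a) b (arc-S Sab)) ; x d (there x∈) → lo-used x d x∈ }
          ; separate = λ { x d x′ d′ (here refl) (here refl) ne → contradiction refl ne
                         ; x d x′ d′ (here refl) (there h) ne → far-sep P k≤m far x′ d′ h
                         ; x d x′ d′ (there h) (here refl) ne → far x d h
                         ; x d x′ d′ (there h) (there h′) ne → separate x d x′ d′ h h′ ne }
          ; cluster = cl
          ; φ-inj = ∷ᶠ-inj (φ-fresh P k≤m fresh) φ-inj
          ; ω-inj = λ { zero j e _ _ → ⊥-elim (no-entry e) ; (suc i) zero _ e _ → ⊥-elim (no-entry e)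
                      ; (suc i) (suc j) e e′ q → cong suc (ω-inj i j e e′ q) }
          ; disjoint = λ { i zero e _ → no-entry e ; zero (suc j) e q → ω-fresh P k≤m fresh j e (sym q)
                         ; (suc i) (suc j) e q → disjoint i j e q }
          ; head = λ { zero _ → φ a , Sab ; (suc i) e → head i e }
          ; tail = λ { zero e → clash c0 e ; (suc i) e → tail i e }
          ; e-edge = λ { zero e → ⊥-elim (no-entry e) ; (suc i) e → e-edge i e }
          ; p-edge = λ { zero _ → Sab ; (suc i) e → p-edge i e }
          ; r-edge = λ { zero e → clash c0 (not-true (proj₁ (∧-true e))) ; (suc i) e → r-edge i e } }
          where
          got = pick-far P k≤m (arc S (φ a)) (outdeg _ _ (proj₂ (tail a ca)))
          b = proj₁ got
          Sab : arc S (φ a) b ≡ true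
          Sab = proj₁ (proj₂ got)
          far = proj₂ (proj₂ got)
          fresh : ∀ d → (b , d) ∉ used
          fresh = far-fresh P k≤m far
          no-entry : entry (grow a t′) c zero ≡ true → ⊥
          no-entry e = clash c0 (not-true (proj₁ (∧-true e)))
          rr0 : # (rr t′ (c ∘ suc)) ≤ # (rr (grow a t′) c)
          rr0 = m≤n+m _ (𝟙 (rr (grow a t′) c zero))
          cl : ∀ d → length (mates d ((b , b) ∷ used)) ≤ 2 + # (rr (grow a t′) c)
          cl d with b ≟ d
          ... | no ne rewrite mates-miss b used ne = ≤-trans (cluster d) (+-monoʳ-≤ 2 rr0)
          ... | yes refl rewrite mates-hit b b used | mates-none b used (far-centre P k≤m far) = s≤s z≤n

        entry-step : c zero ≡ false → c (suc a) ≡ true → Placed (grow a t′) c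
        entry-step c0 ca = record
          { φ = b ∷ᶠ φ ; κ = b ∷ᶠ κ ; ω = w ∷ᶠ ω ; used = (b , b) ∷ (w , b) ∷ used
          ; len = used≤ {b , b} {w , b}
          ; φ-used = λ { zero → here refl ; (suc i) → there (there (φ-used i)) }
          ; ω-used = λ { zero e → there (here refl) ; (suc i) e → there (there (ω-used i e)) }
          ; near-used = λ { x d (here refl) → near-refl (suc k) b
                          ; x d (there (here refl)) → near-step (near-refl k b) bw
                          ; x d (there (there x∈)) → near-mono (n≤1+n k) (near-used x d x∈) }
          ; lo-used = λ { x d (here refl) → core-loˡ (S≼core b (φ a) (arc-S Sba))
                        ; x d (there (here refl)) → friend-lo S≼core sy fr
                        ; x d (there (there x∈)) → lo-used x d x∈ }
          ; separate = sep
          ; cluster = cl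
          ; φ-inj = ∷ᶠ-inj (φ-fresh P k≤m fresh) φ-inj
          ; ω-inj = λ { zero zero _ _ _ → refl
                      ; zero (suc j) _ e q → contradiction (sym q) (ω-fresh P k≤m fresh′ j e)
                      ; (suc i) zero e _ q → contradiction q (ω-fresh P k≤m fresh′ i e)
                      ; (suc i) (suc j) e e′ q → cong suc (ω-inj i j e e′ q) }
          ; disjoint = λ { zero zero e q → link-irr (subst (λ z → link b z ≡ true) (sym q) bw)
                         ; (suc i) zero e q → φ-fresh P k≤m fresh′ i q
                         ; zero (suc j) e q → ω-fresh P k≤m fresh j e (sym q)
                         ; (suc i) (suc j) e q → disjoint i j e q }
          ; head = λ { zero e → clash e c0 ; (suc i) e → head i e }
          ; tail = λ { zero _ → φ a , Sba ; (suc i) e → tail i e }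
          ; e-edge = λ { zero _ → Sba , fr ; (suc i) e → e-edge i e }
          ; p-edge = λ { zero e → clash (proj₁ (∧-true e)) c0 ; (suc i) e → p-edge i e }
          ; r-edge = λ { zero e → clash ca (not-true (proj₂ (∧-true {not (c zero)} e))) ; (suc i) e → r-edge i e } }
          where
          got = pick-far P k≤m (λ x → arc S x (φ a)) (indeg _ _ (proj₂ (head a ca)))
          b = proj₁ got
          Sba : arc S b (φ a) ≡ true
          Sba = proj₁ (proj₂ got)
          far = proj₂ (proj₂ got)
          w = proj₁ (arc-friend {S} Sba)
          fr : friend S b (φ a) w ≡ true
          fr = proj₂ (arc-friend {S} Sba)
          bw : link b w ≡ true
          bw = friend-link (arc-S Sba) fr
          fresh : ∀ d → (b , d) ∉ used
          fresh = far-fresh P k≤m far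
          fresh′ : ∀ d → (w , d) ∉ used
          fresh′ = far-link P k≤m far bw
          centre : ∀ x d → (x , d) ∈ (b , b) ∷ (w , b) ∷ used → d ≡ b ⊎ (x , d) ∈ used
          centre x d (here refl) = inj₁ refl
          centre x d (there (here refl)) = inj₁ refl
          centre x d (there (there h)) = inj₂ h
          sep : ∀ x d x′ d′ → (x , d) ∈ (b , b) ∷ (w , b) ∷ used → (x′ , d′) ∈ (b , b) ∷ (w , b) ∷ used →
                d ≢ d′ → near radius d d′ ≡ false
          sep x d x′ d′ h h′ ne with centre x d h | centre x′ d′ h′
          ... | inj₁ refl | inj₁ refl = contradiction refl ne
          ... | inj₁ refl | inj₂ q    = far-sep P k≤m far x′ d′ q
          ... | inj₂ q    | inj₁ refl = far x d q
          ... | inj₂ q    | inj₂ q′   = separate x d x′ d′ q q′ ne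
          rr0 : # (rr t′ (c ∘ suc)) ≤ # (rr (grow a t′) c)
          rr0 = m≤n+m _ (𝟙 (rr (grow a t′) c zero))
          cl : ∀ d → length (mates d ((b , b) ∷ (w , b) ∷ used)) ≤ 2 + # (rr (grow a t′) c)
          cl d with b ≟ d
          ... | no ne rewrite mates-miss b ((w , b) ∷ used) ne | mates-miss w used ne = ≤-trans (cluster d) (+-monoʳ-≤ 2 rr0)
          ... | yes refl rewrite mates-hit b b ((w , b) ∷ used) | mates-hit b w used | mates-none b used (far-centre P k≤m far) = s≤s (s≤s z≤n)

        -- An edge of T - I goes to the big edge between the tail `φ a` and one of its friends `b`,
        -- which is a tail in turn with the same head `y`. Used friends of `φ a` lie in its own
        -- cluster, and that cluster without `φ a` has at most |T - I| vertices, fewer than there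
        -- are friends.
        inner-step : c zero ≡ false → c (suc a) ≡ false → # (rr (grow a t′) c) ≤ # (rr t col) → Placed (grow a t′) c
        inner-step c0 ca rr≤ = record
          { φ = b ∷ᶠ φ ; κ = κ a ∷ᶠ κ ; ω = b ∷ᶠ ω ; used = (b , κ a) ∷ used
          ; len = ≤-trans (n≤1+n _) (used≤ {b , b} {b , b})
          ; φ-used = λ { zero → here refl ; (suc i) → there (φ-used i) }
          ; ω-used = λ { zero e → ⊥-elim (no-entry e) ; (suc i) e → there (ω-used i e) }
          ; near-used = λ { x d (here refl) → near-step (near-used _ _ (φ-used a)) xb ; x d (there x∈) → near-mono (n≤1+n k) (near-used x d x∈) }
          ; lo-used = λ { x d (here refl) → friend-lo S≼core sy fr ; x d (there x∈) → lo-used x d x∈ }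
          ; separate = λ { x d x′ d′ (here refl) (here refl) ne → contradiction refl ne
                         ; x d x′ d′ (here refl) (there h) ne → separate _ d x′ d′ (φ-used a) h ne
                         ; x d x′ d′ (there h) (here refl) ne → separate x d _ d′ h (φ-used a) ne
                         ; x d x′ d′ (there h) (there h′) ne → separate x d x′ d′ h h′ ne }
          ; cluster = cl
          ; φ-inj = ∷ᶠ-inj (φ-fresh P k≤m fresh) φ-inj
          ; ω-inj = λ { zero j e _ _ → ⊥-elim (no-entry e) ; (suc i) zero _ e _ → ⊥-elim (no-entry e)
                      ; (suc i) (suc j) e e′ q → cong suc (ω-inj i j e e′ q) }
          ; disjoint = λ { i zero e _ → no-entry e ; zero (suc j) e q → ω-fresh P k≤m fresh j e (sym q)
                         ; (suc i) (suc j) e q → disjoint i j e q }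
          ; head = λ { zero e → clash e c0 ; (suc i) e → head i e }
          ; tail = λ { zero _ → y , arc-intro {S} (proj₂ (∧-true {big (φ a) b} fr)) (∧-intro (big-sym _ _ (proj₁ (∧-true fr))) (arc-S Say)) ; (suc i) e → tail i e }
          ; e-edge = λ { zero e → ⊥-elim (no-entry e) ; (suc i) e → e-edge i e }
          ; p-edge = λ { zero e → clash (proj₁ (∧-true e)) c0 ; (suc i) e → p-edge i e }
          ; r-edge = λ { zero _ → big-sym _ _ (proj₁ (∧-true fr)) ; (suc i) e → r-edge i e } }
          where
          y = proj₁ (tail a ca)
          Say : arc S (φ a) y ≡ true
          Say = proj₂ (tail a ca)
          rest = remove (∈-mates (φ-used a))
          rr1 : # (rr (grow a t′) c) ≡ suc (# (rr t′ (c ∘ suc)))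
          rr1 rewrite c0 | ca = refl
          short : length (proj₁ rest) < # (friend S (φ a) y)
          short = begin-strict
            length (proj₁ rest)  ≤⟨ s≤s⁻¹ (≤-trans (≤-reflexive (sym (proj₁ (proj₂ rest)))) (cluster (κ a))) ⟩
            suc (# (rr t′ (c ∘ suc)))  ≡⟨ sym rr1 ⟩
            # (rr (grow a t′) c)  ≤⟨ rr≤ ⟩
            # (rr t col)  <⟨ #friend Say ⟩
            # (friend S (φ a) y)  ∎
            where open ≤-Reasoning
          got = pick-fresh (friend S (φ a) y) (proj₁ rest) short
          b = proj₁ got
          fr : friend S (φ a) y b ≡ true
          fr = proj₁ (proj₂ got)
          xb : link (φ a) b ≡ true
          xb = friend-link (arc-S Say) fr
          fresh : ∀ d → (b , d) ∉ used
          fresh d b∈ = proj₂ (proj₂ got) (proj₂ (proj₂ rest) b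
            (∈-mates (subst (λ z → (b , z) ∈ used) (same-centre P k≤m (φ-used a) b∈ xb) b∈))
            λ q → link-irr (subst (λ z → link (φ a) z ≡ true) q xb))
          no-entry : entry (grow a t′) c zero ≡ true → ⊥
          no-entry e = clash (proj₂ (∧-true {not (c zero)} e)) ca
          cl : ∀ d → length (mates d ((b , κ a) ∷ used)) ≤ 2 + # (rr (grow a t′) c)
          cl d with κ a ≟ d
          ... | no ne rewrite mates-miss b used ne = ≤-trans (cluster d) (+-monoʳ-≤ 2 (m≤n+m _ (𝟙 (rr (grow a t′) c zero))))
          ... | yes refl rewrite mates-hit (κ a) b used = ≤-trans (s≤s (cluster (κ a))) (≤-reflexive (cong (2 +_) (sym rr1)))

      placed : ∀ {x₀ y₀} → arc S x₀ y₀ ≡ true → ∀ {k} (t′ : Tree k) (c : Fin (suc k) → Bool) → k ≤ m → c (fromℕ k) ≡ true →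
        (∀ i → c (inject₁ i) ≡ true → c (parent t′ i) ≡ true → ⊥) → # (rr t′ c) ≤ # (rr t col) → Placed t′ c
      placed {x₀} {y₀} e₀ root c _ c0 _ _ = record
        { φ = λ _ → y₀ ; κ = λ _ → y₀ ; ω = λ () ; used = (y₀ , y₀) ∷ [] ; len = ≤-refl
        ; φ-used = λ _ → here refl ; ω-used = λ ()
        ; near-used = λ { x d (here refl) → near-refl 0 y₀ }
        ; lo-used = λ { x d (here refl) → core-loʳ (S≼core x₀ y₀ (arc-S e₀)) }
        ; separate = λ { x d x′ d′ (here refl) (here refl) ne → contradiction refl ne }
        ; cluster = cl
        ; φ-inj = λ { zero zero _ → refl } ; ω-inj = λ () ; disjoint = λ _ ()
        ; head = λ _ _ → x₀ , e₀
        ; tail = λ { zero e → clash c0 e }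
        ; e-edge = λ () ; p-edge = λ () ; r-edge = λ () }
        where
        cl : ∀ d → length (mates d ((y₀ , y₀) ∷ [])) ≤ 2
        cl d with y₀ ≟ d
        ... | yes refl rewrite mates-hit y₀ y₀ [] | mates-[] y₀ = s≤s z≤n
        ... | no ne rewrite mates-miss y₀ [] ne | mates-[] d = z≤n
      placed e₀ (grow {k} a t′) c k<m cr ind rr≤
        with placed e₀ t′ (c ∘ suc) (<⇒≤ k<m) cr (λ i → ind (suc i)) (≤-trans (m≤n+m _ (𝟙 (rr (grow a t′) c zero))) rr≤)
           | true⊎false (c zero) | true⊎false (c (suc a))
      ... | P | inj₁ c0 | inj₁ ca = ⊥-elim (ind zero c0 ca)
      ... | P | inj₁ c0 | inj₂ ca = Step.pend-step a t′ c (<⇒≤ k<m) P c0 ca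
      ... | P | inj₂ c0 | inj₁ ca = Step.entry-step a t′ c (<⇒≤ k<m) P c0 ca
      ... | P | inj₂ c0 | inj₂ ca = Step.inner-step a t′ c (<⇒≤ k<m) P c0 ca rr≤

      module Complete (P : Placed t col) where
        open Placed P

        p e r : Fin m → Bool
        p = pend t col
        e = entry t col
        r = rr t col

        -- The root lies in I but is nobody's child, so the children in I number at most |I| - 1.
        -- This unit pays for the extra friend that a cluster contains.
        #p<#col : suc (# p) ≤ # col
        #p<#col = ≤-trans (s≤s (#-mono {p = p} {q = col ∘ inject₁} λ i q → proj₁ (∧-true q))) (#-inject₁ col col-root)

        U : List (Fin n)
        U = map proj₁ used

        φ∈U : ∀ i → φ i ∈ U
        φ∈U i = ∈-map⁺ proj₁ (φ-used i)

        ω∈U : ∀ i → e i ≡ true → ω i ∈ U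
        ω∈U i q = ∈-map⁺ proj₁ (ω-used i q)

        Ok : Fin m → Fin n → Set
        Ok i w = third S (φ (parent t i)) (φ (inject₁ i)) w ≡ true

        -- Used vertices are low and friends of the head do not exist, so a used third vertex is a
        -- friend of the tail `x` from its own cluster. There are at most 1 + |T - I| of those, and
        -- together with the fewer than `# p` vertices in `ws` they stay below |I| + |T - I|.
        choose : ∀ i → p i ≡ true → ∀ ws → length ws < # p → ∃ λ w → Ok i w × w ∉ U × w ∉ ws
        choose i pi ws l = w , ok , w∉U , f ∘ ∈-++⁺ʳ others
          where
          x = φ (parent t i)
          y = φ (inject₁ i)
          d = κ (parent t i)
          Sxy : arc S x y ≡ true
          Sxy = p-edge i pi
          rest = remove (∈-mates (φ-used (parent t i)))
          others = proj₁ rest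
          unused : ∀ w d′ → third S x y w ≡ true → w ∉ others → (w , d′) ∉ used
          unused w d′ ok w∉ w∈ with ∨-true {common x y w} ok
          ... | inj₁ h = clash (proj₁ (∧-true {hi w} h)) (lo-used w d′ w∈)
          ... | inj₂ h with ∨-true {friend S x y w} h
          ...   | inj₂ h₂ = oneway x y Sxy (arc-intro {S} (sy x y (arc-S Sxy)) h₂)
          ...   | inj₁ h₁ = w∉ (proj₂ (proj₂ rest) w
                  (∈-mates (subst (λ z → (w , z) ∈ used) (same-centre P ≤-refl (φ-used (parent t i)) w∈ (friend-link (arc-S Sxy) h₁)) w∈))
                  λ q → link-irr (subst (λ z → link x z ≡ true) q (friend-link (arc-S Sxy) h₁)))
          open ≤-Reasoning
          bound : length (others ++ ws) < # (third S x y)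
          bound = begin-strict
            length (others ++ ws)  ≡⟨ length-++ others ⟩
            length others + length ws  ≤⟨ +-monoˡ-≤ _ (s≤s⁻¹ (≤-trans (≤-reflexive (sym (proj₁ (proj₂ rest)))) (cluster d))) ⟩
            suc (# r) + length ws  ≡⟨ sym (+-suc (# r) (length ws)) ⟩
            # r + suc (length ws)  ≤⟨ +-monoʳ-≤ (# r) l ⟩
            # r + # p  <⟨ +-monoʳ-< (# r) #p<#col ⟩
            # r + # col  ≡⟨ +-comm (# r) (# col) ⟩
            # col + # r  ≤⟨ budget ⟩
            s  ≤⟨ full x y (arc-S Sxy) ⟩
            cn S x y  ≤⟨ cn≤third S≼core sy x y ⟩
            # (third S x y)  ∎
          got = pick-fresh (third S x y) (others ++ ws) bound
          w = proj₁ got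
          ok : third S x y w ≡ true
          ok = proj₁ (proj₂ got)
          f : w ∉ others ++ ws
          f = proj₂ (proj₂ got)
          w∉U : w ∉ U
          w∉U w∈ with ∈-map⁻ proj₁ w∈
          ... | (_ , d′) , u∈ , refl = unused w d′ ok (f ∘ ∈-++⁺ˡ) u∈

        kind : ∀ i → not (r i) ≡ true → p i ≡ true ⊎ (p i ≡ false × e i ≡ true)
        kind i q with true⊎false (col (inject₁ i)) | true⊎false (col (parent t i))
        ... | inj₁ a | inj₁ b = ⊥-elim (indep i a b)
        ... | inj₁ a | inj₂ b = inj₁ (∧-intro a (cong not b))
        ... | inj₂ a | inj₁ b = inj₂ (cong (_∧ not (col (parent t i))) a , ∧-intro (cong not a) b)
        ... | inj₂ a | inj₂ b = clash (∧-intro (cong not a) (cong not b)) (not-true q)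

        module Assemble (ω′ : Fin m → Fin n) (ws : List (Fin n))
          (ok : ∀ i → p i ≡ true → Ok i (ω′ i) × ω′ i ∉ U × ω′ i ∈ ws)
          (inj : ∀ i j → p i ≡ true → p j ≡ true → ω′ i ≡ ω′ j → i ≡ j) where

          ω₁ : Fin m → Fin n
          ω₁ i = if p i then ω′ i else ω i

          ω₁-p : ∀ {i} → p i ≡ true → ω₁ i ≡ ω′ i
          ω₁-p q rewrite q = refl

          ω₁-e : ∀ {i} → p i ≡ false → ω₁ i ≡ ω i
          ω₁-e q rewrite q = refl

          ω₁-inj : ∀ i j → not (r i) ≡ true → not (r j) ≡ true → ω₁ i ≡ ω₁ j → i ≡ j
          ω₁-inj i j ri rj q with kind i ri | kind j rj
          ... | inj₁ a | inj₁ b = inj i j a b (trans (sym (ω₁-p a)) (trans q (ω₁-p b)))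
          ... | inj₁ a | inj₂ (b , c) = contradiction (subst (_∈ U) (trans (sym (ω₁-e b)) (trans (sym q) (ω₁-p a))) (ω∈U j c)) (proj₁ (proj₂ (ok i a)))
          ... | inj₂ (b , c) | inj₁ a = contradiction (subst (_∈ U) (trans (sym (ω₁-e b)) (trans q (ω₁-p a))) (ω∈U i c)) (proj₁ (proj₂ (ok j a)))
          ... | inj₂ (a , b) | inj₂ (c , d) = ω-inj i j b d (trans (sym (ω₁-e a)) (trans q (ω₁-e c)))

          off : ∀ i j → not (r j) ≡ true → φ i ≢ ω₁ j
          off i j rj q with kind j rj
          ... | inj₁ a       = proj₁ (proj₂ (ok j a)) (subst (_∈ U) (trans q (ω₁-p a)) (φ∈U i))
          ... | inj₂ (b , c) = disjoint i j c (trans q (ω₁-e b))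

          tri : ∀ i → not (r i) ≡ true → g (φ (inject₁ i)) (φ (parent t i)) ≡ true
            × g (φ (inject₁ i)) (ω₁ i) ≡ true × g (φ (parent t i)) (ω₁ i) ≡ true
          tri i ri with kind i ri
          ... | inj₁ a rewrite ω₁-p a =
                let u , v = third-g S≼core sy _ _ _ (proj₁ (ok i a))
                in gs _ _ (small→g _ _ (core→small _ _ (S≼core _ _ (arc-S (p-edge i a))))) , v , u
          ... | inj₂ (b , c) rewrite ω₁-e b =
                let h , f = e-edge i c
                    u , v = third-g S≼core sy _ _ _ (∨-introʳ {common (φ (inject₁ i)) (φ (parent t i)) (ω i)} (∨-introˡ f))
                in small→g _ _ (core→small _ _ (S≼core _ _ (arc-S h))) , u , v

          result : Blowup t g
          result = Finish.blowup {t = t} φ φ-inj (not ∘ r) ω₁ ω₁-inj off tri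
            λ i q → r-edge i (not-false q)
            where
            not-false : ∀ {a} → not a ≡ false → a ≡ true
            not-false {true} _ = refl

        embedding : Blowup t g
        embedding with sdr m p Ok (φ zero) U choose
        ... | ω′ , ws , _ , ok , inj = Assemble.result ω′ ws ok inj

    abstract
      low-blowup : ∀ x y → S x y ≡ true → Blowup t g
      low-blowup x y e with edge⇒arc e
      ... | inj₁ a = Complete.embedding (placed a t col ≤-refl col-root indep ≤-refl)
      ... | inj₂ a = Complete.embedding (placed a t col ≤-refl col-root indep ≤-refl)

-- Deleting edges in few triangles

weight-+ : ∀ {n} (S : BRel n) f h → weight S (λ x y → f x y + h x y) ≡ weight S f + weight S h
weight-+ S f h = trans
  (sum-cong-≗ λ x → trans (sum-cong-≗ λ y → *-distribˡ-+ (𝟙 (S x y)) (f x y) (h x y))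
                          (∑-distrib-+ (λ y → 𝟙 (S x y) * f x y) (λ y → 𝟙 (S x y) * h x y)))
  (∑-distrib-+ (λ x → sum λ y → 𝟙 (S x y) * f x y) (λ x → sum λ y → 𝟙 (S x y) * h x y))

bool-ext : ∀ {a b} → (a ≡ true → b ≡ true) → (b ≡ true → a ≡ true) → a ≡ b
bool-ext {true}  {true}  _ _ = refl
bool-ext {true}  {false} h _ = sym (h refl)
bool-ext {false} {true}  _ k = k refl
bool-ext {false} {false} _ _ = refl

module Friends {n} (g : BRel n) (gs : Symᵇ g) (gi : Irrᵇ g) (m D : ℕ) where
  open Classes g gs gi m D

  friends : BRel n → Fin n → Fin n → ℕ
  friends S x y = # (friend S x y)

  -- For `S` inside `core` each counted triangle contributes exactly 2: one with a common high
  -- neighbour through both orientations of its edge, one with a friend through each of its two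
  -- edges in `S`.
  τ : BRel n → ℕ
  τ S = weight S λ x y → # (common x y) + # (friend S x y)

  -- Double counting of triangles with a big edge `a z`: the roles of `a b` and `z b` are exchanged.
  weight-friends : ∀ R S → weight R (friends S) ≡ weight S (friends R)
  weight-friends R S = begin
    weight R (friends S)
      ≡⟨ sum-cong-≗ (λ a → sum-cong-≗ λ b → *-distribˡ-sum (𝟙 (R a b)) (λ z → 𝟙 (friend S a b z))) ⟩
    sum (λ a → sum λ b → sum λ z → 𝟙 (R a b) * 𝟙 (friend S a b z))
      ≡⟨ ∑-comm (λ a b → sum λ z → 𝟙 (R a b) * 𝟙 (friend S a b z)) ⟩
    sum (λ b → sum λ a → sum λ z → 𝟙 (R a b) * 𝟙 (friend S a b z))
      ≡⟨ sum-cong-≗ (λ b → ∑-comm (λ a z → 𝟙 (R a b) * 𝟙 (friend S a b z))) ⟩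
    sum (λ b → sum λ z → sum λ a → 𝟙 (R a b) * 𝟙 (friend S a b z))
      ≡⟨ sum-cong-≗ (λ b → sum-cong-≗ λ z → sum-cong-≗ λ a → pt a b z) ⟩
    sum (λ b → sum λ z → sum λ a → 𝟙 (S z b) * 𝟙 (friend R z b a))
      ≡⟨ ∑-comm (λ b z → sum λ a → 𝟙 (S z b) * 𝟙 (friend R z b a)) ⟩
    sum (λ z → sum λ b → sum λ a → 𝟙 (S z b) * 𝟙 (friend R z b a))
      ≡⟨ sum-cong-≗ (λ z → sum-cong-≗ λ b → sym (*-distribˡ-sum (𝟙 (S z b)) (λ a → 𝟙 (friend R z b a)))) ⟩
    weight S (friends R) ∎
    where
    open ≡-Reasoning
    pt : ∀ a b z → 𝟙 (R a b) * 𝟙 (friend S a b z) ≡ 𝟙 (S z b) * 𝟙 (friend R z b a)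
    pt a b z rewrite bool-ext (big-sym z a) (big-sym a z) with R a b | S z b | big a z
    ... | true  | true  | c     = refl
    ... | true  | false | true  = refl
    ... | true  | false | false = refl
    ... | false | true  | true  = refl
    ... | false | true  | false = refl
    ... | false | false | c     = refl

  common-flip : ∀ x y → # (common y x) ≤ # (common x y)
  common-flip x y = #-mono {p = common y x} {q = common x y} λ z e →
    let a , b = ∧-true {hi z} e ; c , d = ∧-true {big y z} b in ∧-intro a (∧-intro d c)

  -- The factor 2 is the multiplicity with which `τ` counts triangles. A triangle with a friend has
  -- two edges in `S`; `weight-friends` moves the second one into the position where `weight-del`
  -- applies again.
  τ-del : ∀ S x N → Symᵇ S → τ S ≤ τ (del S x N) + 2 * sum λ y → 𝟙 (S x y ∧ N y) * cn S x y
  τ-del S x N sy = begin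
    τ S  ≡⟨ weight-+ S c (friends S) ⟩
    weight S c + weight S (friends S)  ≤⟨ +-mono-≤ (weight-del S x N sy c) friends-del ⟩
    (weight S′ c + X) + (weight S′ (friends S′) + Y + Y)
                                                  ≡⟨ arith (weight S′ c) X (weight S′ (friends S′)) Y ⟩
    (weight S′ c + weight S′ (friends S′)) + (X + (Y + Y))
                                                  ≡⟨ cong₂ _+_ (sym (weight-+ S′ c (friends S′))) refl ⟩
    τ S′ + (X + (Y + Y))  ≤⟨ +-monoʳ-≤ (τ S′) total ⟩
    τ S′ + 2 * sum (λ y → 𝟙 (S x y ∧ N y) * cn S x y) ∎
    where
    open ≤-Reasoning
    S′ = del S x N
    c : Fin n → Fin n → ℕ
    c x y = # (common x y)
    I : Fin n → ℕ
    I y = 𝟙 (S x y ∧ N y)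
    X = sum λ y → I y * (c x y + c y x)
    Y = sum λ y → I y * (friends S x y + friends S y x)
    friends-≤ : ∀ u v → friends S′ u v ≤ friends S u v
    friends-≤ u v = #-mono {p = friend S′ u v} {q = friend S u v} (friend-mono {S′} {S} (del-≼ S x N) u v)
    friends-del : weight S (friends S) ≤ weight S′ (friends S′) + Y + Y
    friends-del = begin
      weight S (friends S)  ≤⟨ weight-del S x N sy (friends S) ⟩
      weight S′ (friends S) + Y  ≡⟨ cong (_+ Y) (weight-friends S′ S) ⟩
      weight S (friends S′) + Y  ≤⟨ +-monoˡ-≤ Y (weight-del S x N sy (friends S′)) ⟩
      weight S′ (friends S′) + sum (λ y → I y * (friends S′ x y + friends S′ y x)) + Y
                                      ≤⟨ +-monoˡ-≤ Y (+-monoʳ-≤ (weight S′ (friends S′)) (sum-mono λ y → *-monoʳ-≤ (I y) (+-mono-≤ (friends-≤ x y) (friends-≤ y x)))) ⟩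
      weight S′ (friends S′) + Y + Y  ∎
    arith : ∀ a b c d → (a + b) + (c + d + d) ≡ (a + c) + (b + (d + d))
    arith = solve-∀
    total : X + (Y + Y) ≤ 2 * sum (λ y → I y * cn S x y)
    total = begin
      X + (Y + Y)
        ≡⟨ cong (X +_) (sym (∑-distrib-+ (λ y → I y * (friends S x y + friends S y x)) (λ y → I y * (friends S x y + friends S y x)))) ⟩
      X + sum (λ y → I y * (friends S x y + friends S y x) + I y * (friends S x y + friends S y x))
        ≡⟨ sym (∑-distrib-+ (λ y → I y * (c x y + c y x)) _) ⟩
      sum (λ y → I y * (c x y + c y x) + (I y * (friends S x y + friends S y x) + I y * (friends S x y + friends S y x)))
        ≤⟨ sum-mono pt ⟩
      sum (λ y → 2 * (I y * cn S x y))
        ≡⟨ sym (*-distribˡ-sum 2 (λ y → I y * cn S x y)) ⟩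
      2 * sum (λ y → I y * cn S x y) ∎
      where
      pt : ∀ y → I y * (c x y + c y x) + (I y * (friends S x y + friends S y x) + I y * (friends S x y + friends S y x)) ≤ 2 * (I y * cn S x y)
      pt y = begin
        i * (c x y + c y x) + (i * f + i * f)  ≤⟨ +-monoˡ-≤ _ (*-monoʳ-≤ i (+-monoʳ-≤ (c x y) (common-flip x y))) ⟩
        i * (c x y + c x y) + (i * f + i * f)  ≡⟨ cong (_+ (i * f + i * f)) (*-distribˡ-+ i (c x y) (c x y)) ⟩
        (i * c x y + i * c x y) + (i * f + i * f) ≡⟨ swap4 (i * c x y) (i * f) ⟩
        2 * (i * c x y + i * f)  ≡⟨ cong (2 *_) (sym (*-distribˡ-+ i (c x y) f)) ⟩
        2 * (i * cn S x y)  ∎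
        where
        i = I y
        f = friends S x y + friends S y x
        swap4 : ∀ p q → (p + p) + (q + q) ≡ 2 * (p + q)
        swap4 = solve-∀

module Final {n} (g : BRel n) (gs : Symᵇ g) (gi : Irrᵇ g) {m} (t : Tree m) (free : ¬ Blowup t g) (D : ℕ)
  (col : Fin (suc m) → Bool)
  (indep : ∀ i → col (inject₁ i) ≡ true → col (parent t i) ≡ true → ⊥)
  (a : ℕ) (budget : # col + # (rr t col) ≤ suc a) (col-root : col (fromℕ m) ≡ true)
  where
  open Classes g gs gi m D public
  open Friends g gs gi m D public
  open Sparse g gs gi t free D public

  S₁ : BRel n
  S₁ x y = core x y ∧ not (twin x y)

  S₁≼core : S₁ ≼ core
  S₁≼core x y e = proj₁ (∧-true e)

  not-sym : ∀ {R : BRel n} → Symᵇ R → Symᵇ (λ x y → not (R x y))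
  not-sym {R} s x y e with R y x in eq
  ... | false = refl
  ... | true  = clash (s y x eq) (not-true e)

  S₁-sym : Symᵇ S₁
  S₁-sym = ∧-symᵇ {R = core} core-sym (not-sym {twin} λ x y e → let p , q = ∧-true {arc core x y} e in ∧-intro q p)

  open Heavy g gs gi t free D col indep (suc a) budget S₁ S₁-sym S₁≼core public
    using (heavy; heavy-sym; size-heavy)

  S₂ : BRel n
  S₂ x y = S₁ x y ∧ not (heavy x y)

  S₂≼S₁ : S₂ ≼ S₁
  S₂≼S₁ x y e = proj₁ (∧-true e)

  S₂≼core : S₂ ≼ core
  S₂≼core x y e = S₁≼core x y (S₂≼S₁ x y e)

  S₂-sym : Symᵇ S₂
  S₂-sym = ∧-symᵇ {R = S₁} S₁-sym (not-sym {heavy} heavy-sym)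

  open LowEmbedding g gs gi t D col indep (suc a) budget col-root using (M; low-blowup)

  cn-mono : ∀ {S R} → S ≼ R → ∀ x y → cn S x y ≤ cn R x y
  cn-mono {S} {R} h x y = +-monoʳ-≤ (# (common x y))
    (+-mono-≤ (#-mono {p = friend S x y} (friend-mono {S} {R} h x y)) (#-mono {p = friend S y x} (friend-mono {S} {R} h y x)))

  cn-≤ : ∀ {S x y} → S ≼ core → Symᵇ S → S x y ≡ true → cn S x y ≤ K + (K + K)
  cn-≤ {S} {x} {y} h sy e = +-mono-≤ (le (common x y) λ w q → ∨-introˡ q)
    (+-mono-≤ (le (friend S x y) λ w q → ∨-introʳ {common x y w} (∨-introˡ q))
              (le (friend S y x) λ w q → ∨-introʳ {common x y w} (∨-introʳ {friend S x y w} q)))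
    where
    le : ∀ p → (∀ w → p w ≡ true → third S x y w ≡ true) → # p ≤ K
    le p k = ≤-trans (#-mono {p = p} {q = λ w → g x w ∧ g y w} λ w q →
        let u , v = third-g h sy x y w (k w q) in ∧-intro u v)
      (small-codeg (core→small x y (h x y e)))

  -- Out-stars and in-stars of arcs. When no nonempty star of either kind has fewer than `M` edges,
  -- the two degree hypotheses of the low embedding hold.
  E : BRel n → Fin 2 → Fin n → Fin n → Bool
  E S zero       x y = arc S x y
  E S (suc zero) x y = S x y ∧ arc S y x

  E⊂ : ∀ S j x y → E S j x y ≡ true → S x y ≡ true
  E⊂ S zero       x y e = arc→ {S} x y e
  E⊂ S (suc zero) x y e = proj₁ (∧-true e)

  E-mono : ∀ S R j x y → S ≼ R → E S j x y ≡ true → E R j x y ≡ true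
  E-mono S R zero       x y h e = arc-mono {S} {R} h x y e
  E-mono S R (suc zero) x y h e = let p , q = ∧-true {S x y} e in ∧-intro (h x y p) (arc-mono {S} {R} h y x q)

  -- A cheap star has fewer than `M` edges, each in at most 3K counted triangles, and `τ` counts a
  -- triangle twice.
  κ : ℕ
  κ = 2 * ((K + (K + K)) * M)

  open module P = Peel S₂ (≼-irr S₂≼core core-irr) E E⊂ E-mono τ a κ using (Progress; indices; peel)

  module _ (S : BRel n) (sy : Symᵇ S) (le : S ≼ S₂) where

    S≼core : S ≼ core
    S≼core x y e = S₂≼core x y (le x y e)

    -- All hypotheses of `low-blowup` are met: a surviving edge with |I| common high neighbours
    -- would have been heavy, since it still has s third vertices, and an arc in both directions
    -- would have been a twin.
    no-rest : (∀ x y → S x y ≡ true → suc a ≤ cn S x y) →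
      (∀ j x y → E S j x y ≡ true → M ≤ # (E S j x)) → ∀ x y → S x y ≡ false
    no-rest full deg x y with S x y in eq
    ... | false = refl
    ... | true  = ⊥-elim (free (low-blowup S sy S≼core few full oneway (λ x y e → deg zero x y e) indeg x y eq))
      where
      few : ∀ x y → S x y ≡ true → # (common x y) < # col
      few x y e = ≰⇒> λ h → clash
        (∧-intro (S₂≼S₁ x y (le x y e)) (∧-intro (does-intro (# col ≤? # (common x y)) h)
          (does-intro (suc a ≤? cn S₁ x y) (≤-trans (full x y e) (cn-mono {S} {S₁} (λ u v q → S₂≼S₁ u v (le u v q)) x y)))))
        (not-true (proj₂ (∧-true {S₁ x y} (le x y e))))
      oneway : ∀ x y → arc S x y ≡ true → arc S y x ≡ true → ⊥
      oneway x y e f = clash (∧-intro (arc-mono {S} {core} S≼core x y e) (arc-mono {S} {core} S≼core y x f))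
        (not-true (proj₂ (∧-true {core x y} (S₂≼S₁ x y (le x y (arc→ {S} x y e))))))
      indeg : ∀ x y → arc S x y ≡ true → M ≤ # (λ z → arc S z y)
      indeg x y e = ≤-trans (deg (suc zero) y x (∧-intro (sy x y (arc→ {S} x y e)) e))
        (#-mono {p = λ z → S y z ∧ arc S z y} {q = λ z → arc S z y} λ z q → proj₂ (∧-true {S y z} q))

    progress : Progress S
    progress with some (λ x → some λ y → S x y ∧ does (cn S x y <? suc a)) in eq
    ... | true = inj₂ (inj₁ (x , y , Sxy , ≤-trans (τ-del S x (_== y) sy) (+-monoʳ-≤ (τ (del S x (_== y))) (*-monoʳ-≤ 2 bound))))
      where
      p₁ = some-elim (λ x → some λ y → S x y ∧ does (cn S x y <? suc a)) eq
      x = proj₁ p₁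
      p₂ = some-elim (λ y → S x y ∧ does (cn S x y <? suc a)) (proj₂ p₁)
      y = proj₁ p₂
      Sxy : S x y ≡ true
      Sxy = proj₁ (∧-true (proj₂ p₂))
      open ≤-Reasoning
      bound : sum (λ z → 𝟙 (S x z ∧ z == y) * cn S x z) ≤ a
      bound = begin
        sum (λ z → 𝟙 (S x z ∧ z == y) * cn S x z)  ≤⟨ sum-mono (λ z → *-monoˡ-≤ (cn S x z) (𝟙-mono {S x z ∧ z == y} {z == y} λ q → proj₂ (∧-true {S x z} q))) ⟩
        sum (λ z → 𝟙 (z == y) * cn S x z)  ≡⟨ sum-δ (cn S x) y ⟩
        cn S x y  ≤⟨ s≤s⁻¹ (does-true {d = cn S x y <? suc a} (proj₂ (∧-true {S x y} (proj₂ p₂)))) ⟩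
        a  ∎
    ... | false with some (λ j → some λ x → some (E S j x) ∧ does (# (E S j x) <? M)) in eq′
    ...   | true = inj₂ (inj₂ (j , x , y , Ey , ≤-trans (τ-del S x (E S j x) sy) (+-monoʳ-≤ (τ (del S x (E S j x))) (*-monoʳ-≤ 2 bound))))
      where
      p₁ = some-elim (λ j → some λ x → some (E S j x) ∧ does (# (E S j x) <? M)) eq′
      j = proj₁ p₁
      p₂ = some-elim (λ x → some (E S j x) ∧ does (# (E S j x) <? M)) (proj₂ p₁)
      x = proj₁ p₂
      p₃ = some-elim (E S j x) (proj₁ (∧-true (proj₂ p₂)))
      y = proj₁ p₃
      Ey : E S j x y ≡ true
      Ey = proj₂ p₃
      open ≤-Reasoning
      C = K + (K + K)
      bound : sum (λ z → 𝟙 (S x z ∧ E S j x z) * cn S x z) ≤ C * M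
      bound = begin
        sum (λ z → 𝟙 (S x z ∧ E S j x z) * cn S x z)  ≤⟨ ∑-𝟙*≤ (λ z → S x z ∧ E S j x z) C (λ z q → cn-≤ {S} S≼core sy (proj₁ (∧-true q))) ⟩
        C * # (λ z → S x z ∧ E S j x z)  ≤⟨ *-monoʳ-≤ C (#-mono {p = λ z → S x z ∧ E S j x z} {q = E S j x} λ z q → proj₂ (∧-true {S x z} q)) ⟩
        C * # (E S j x)  ≤⟨ *-monoʳ-≤ C (<⇒≤ (does-true {d = # (E S j x) <? M} (proj₂ (∧-true {some (E S j x)} (proj₂ p₂))))) ⟩
        C * M  ∎
    ...   | false = inj₁ (sum-zero λ x → sum-zero λ y → cong (λ b → 𝟙 b * (# (common x y) + # (friend S x y))) (no-rest full deg x y))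
      where
      full : ∀ x y → S x y ≡ true → suc a ≤ cn S x y
      full x y e = ≮⇒≥ λ h → clash (∧-intro e (does-intro (cn S x y <? suc a) h))
        (some-none (λ y → S x y ∧ does (cn S x y <? suc a)) (some-none (λ x → some λ y → S x y ∧ does (cn S x y <? suc a)) eq x) y)
      deg : ∀ j x y → E S j x y ≡ true → M ≤ # (E S j x)
      deg j x y e = ≮⇒≥ λ h → clash (∧-intro (some-intro (E S j x) y e) (does-intro (# (E S j x) <? M) h))
        (some-none (λ x → some (E S j x) ∧ does (# (E S j x) <? M)) (some-none (λ j → some λ x → some (E S j x) ∧ does (# (E S j x) <? M)) eq′ j) x)

  τ-S₂ : τ S₂ ≤ a * size S₂ + κ * (2 * n)
  τ-S₂ = ≤-trans (peel progress S₂ S₂-sym λ _ _ e → e)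
    (+-monoʳ-≤ (a * size S₂) (*-monoʳ-≤ κ (sum-≤-const {2} {f = λ j → # λ x → some (E S₂ j x)} {c = n} λ j → #≤n λ x → some (E S₂ j x))))

-- Counting ordered triangles

∑³ : ∀ {n} → (Fin n → Fin n → Fin n → ℕ) → ℕ
∑³ f = sum λ a → sum λ b → sum λ c → f a b c

∑³-mono : ∀ {n} {f h : Fin n → Fin n → Fin n → ℕ} → (∀ a b c → f a b c ≤ h a b c) → ∑³ f ≤ ∑³ h
∑³-mono k = sum-mono λ a → sum-mono λ b → sum-mono (k a b)

∑³-+ : ∀ {n} (f h : Fin n → Fin n → Fin n → ℕ) → ∑³ (λ a b c → f a b c + h a b c) ≡ ∑³ f + ∑³ h
∑³-+ f h = trans
  (sum-cong-≗ λ a → trans (sum-cong-≗ λ b → ∑-distrib-+ (f a b) (h a b)) (∑-distrib-+ (λ b → sum (f a b)) (λ b → sum (h a b))))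
  (∑-distrib-+ (λ a → sum λ b → sum (f a b)) (λ a → sum λ b → sum (h a b)))

∑³-cyc : ∀ {n} (f : Fin n → Fin n → Fin n → ℕ) → ∑³ (λ a b c → f b c a) ≡ ∑³ f
∑³-cyc f = trans (∑-comm (λ a b → sum λ c → f b c a)) (sum-cong-≗ λ b → ∑-comm (λ a c → f b c a))

∑³-swap : ∀ {n} (f : Fin n → Fin n → Fin n → ℕ) → ∑³ (λ a b c → f b a c) ≡ ∑³ f
∑³-swap f = ∑-comm (λ a b → sum (f b a))

weight-∑³ : ∀ {n} (S : BRel n) (p : Fin n → Fin n → Fin n → Bool) →
  weight S (λ x y → # (p x y)) ≡ ∑³ λ x y z → 𝟙 (S x y) * 𝟙 (p x y z)
weight-∑³ S p = sum-cong-≗ λ x → sum-cong-≗ λ y → *-distribˡ-sum (𝟙 (S x y)) (𝟙 ∘ p x y)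

clique : ∀ {n} → BRel n → Fin n → Fin n → Fin n → Bool
clique S a b c = S a b ∧ (S b c ∧ S c a)

2mn≤m²+n² : ∀ m n → 2 * (m * n) ≤ m * m + n * n
2mn≤m²+n² m n with ≤-total m n
... | inj₁ h = go h
  where
  go : ∀ {m n} → m ≤ n → 2 * (m * n) ≤ m * m + n * n
  go {m} {n} h with k , refl ← m≤n⇒∃[o]m+o≡n h = ≤-trans (m≤m+n _ (k * k)) (≤-reflexive (eq m k))
    where
    eq : ∀ m k → 2 * (m * (m + k)) + k * k ≡ m * m + (m + k) * (m + k)
    eq = solve-∀
... | inj₂ h with k , refl ← m≤n⇒∃[o]m+o≡n h = ≤-trans (m≤m+n _ (k * k)) (≤-reflexive (eq n k))
  where
  eq : ∀ n k → 2 * ((n + k) * n) + k * k ≡ (n + k) * (n + k) + n * n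
  eq = solve-∀

cauchy : ∀ {n} (f : Fin n → ℕ) → sum f * sum f ≤ n * sum (λ x → f x * f x)
cauchy {n} f = *-cancelˡ-≤ 2 (begin
  2 * (sum f * sum f)  ≡⟨ cong (2 *_) (trans (*-distribʳ-sum (sum f) f) (sum-cong-≗ λ x → *-distribˡ-sum (f x) f)) ⟩
  2 * sum (λ x → sum λ y → f x * f y)  ≡⟨ trans (*-distribˡ-sum 2 (λ x → sum λ y → f x * f y)) (sum-cong-≗ λ x → *-distribˡ-sum 2 (λ y → f x * f y)) ⟩
  sum (λ x → sum λ y → 2 * (f x * f y))  ≤⟨ sum-mono (λ x → sum-mono λ y → 2mn≤m²+n² (f x) (f y)) ⟩
  sum (λ x → sum λ y → f x * f x + f y * f y)  ≡⟨ sum-cong-≗ {n} (λ x → ∑-distrib-+ {n} (λ _ → f x * f x) (λ y → f y * f y)) ⟩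
  sum {n} (λ x → sum {n} (λ _ → f x * f x) + Q)  ≡⟨ ∑-distrib-+ {n} (λ x → sum {n} (λ _ → f x * f x)) (λ _ → Q) ⟩
  sum (λ x → sum {n} (λ _ → f x * f x)) + sum {n} (λ _ → Q) ≤⟨ +-mono-≤ (sum-mono λ x → sum-≤-const {n} {c = f x * f x} λ _ → ≤-refl) (sum-≤-const {n} {c = Q} λ _ → ≤-refl) ⟩
  sum (λ x → n * (f x * f x)) + n * Q  ≡⟨ cong₂ _+_ (sym (*-distribˡ-sum n (λ x → f x * f x))) (sym (+-identityʳ (n * Q))) ⟩
  2 * (n * Q)  ∎)
  where
  open ≤-Reasoning
  Q = sum λ x → f x * f x

-- Mantel's theorem with a defect; all counts are over ordered tuples.
mantel : ∀ {n} (S : BRel n) → Symᵇ S → ∀ C → weight S (λ x y → # λ w → S x w ∧ S y w) ≤ C * n →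
  2 * size S ≤ n * n + 2 * C
mantel {n} S sy C few = ≮⇒≥ λ h → <-irrefl refl (begin-strict
  2 * (e * e)  ≤⟨ *-monoʳ-≤ 2 square ⟩
  2 * (n * Q)  ≡⟨ mid n Q ⟩
  n * (2 * Q)  ≤⟨ *-monoʳ-≤ n degrees ⟩
  n * (n * e + C * n)  ≡⟨ expand n e C ⟩
  -- The defect is absorbed by the assumption to be refuted, which gives n² ≤ 2e; so it costs a
  -- constant and not a multiple of n.
  n * n * e + C * (n * n)  ≤⟨ +-monoʳ-≤ (n * n * e) (*-monoʳ-≤ C (≤-trans (m≤m+n (n * n) (2 * C)) (<⇒≤ h))) ⟩
  n * n * e + C * (2 * e)  ≡⟨ collect n e C ⟩
  (n * n + 2 * C) * e  <⟨ *-monoˡ-< e {{>-nonZero (e>0 h)}} h ⟩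
  2 * e * e  ≡⟨ *-assoc 2 e e ⟩
  2 * (e * e)  ∎)
  where
  open ≤-Reasoning
  e = size S
  d : Fin n → ℕ
  d x = # (S x)
  Q = sum λ x → d x * d x
  e>0 : ∀ {k} → k < 2 * e → 0 < e
  e>0 {k} h with e
  ... | zero  = contradiction h λ ()
  ... | suc _ = s≤s z≤n
  mid : ∀ n Q → 2 * (n * Q) ≡ n * (2 * Q)
  mid = solve-∀
  expand : ∀ n e C → n * (n * e + C * n) ≡ n * n * e + C * (n * n)
  expand = solve-∀
  collect : ∀ n e C → n * n * e + C * (2 * e) ≡ (n * n + 2 * C) * e
  collect = solve-∀
  square : e * e ≤ n * Q
  square = subst (λ k → k * k ≤ n * Q) (sym (size≡∑# S)) (cauchy d)
  left : weight S (λ x _ → d x) ≡ Q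
  left = sum-cong-≗ λ x → trans (sym (*-distribʳ-sum (d x) (𝟙 ∘ S x))) refl
  right : weight S (λ _ y → d y) ≡ Q
  right = trans (∑-comm (λ x y → 𝟙 (S x y) * d y)) (trans
    (sum-cong-≗ λ y → sum-cong-≗ λ x → cong (λ b → 𝟙 b * d y) (bool-ext (sy x y) (sy y x))) left)
  degrees : 2 * Q ≤ n * e + C * n
  degrees = begin
    2 * Q  ≡⟨ cong₂ _+_ (sym left) (trans (+-identityʳ Q) (sym right)) ⟩
    weight S (λ x _ → d x) + weight S (λ _ y → d y)  ≡⟨ sym (weight-+ S (λ x _ → d x) (λ _ y → d y)) ⟩
    weight S (λ x y → d x + d y)  ≤⟨ weight-mono {S = S} (λ _ _ q → q) (λ x y _ → pair x y) ⟩
    weight S (λ x y → n + # λ w → S x w ∧ S y w)  ≡⟨ weight-+ S (λ _ _ → n) _ ⟩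
    weight S (λ _ _ → n) + weight S (λ x y → # λ w → S x w ∧ S y w) ≤⟨ +-mono-≤ (weight-≤ S n λ _ _ _ → ≤-refl) few ⟩
    n * e + C * n  ∎
    where
    pair : ∀ x y → d x + d y ≤ n + # λ w → S x w ∧ S y w
    pair x y = begin
      d x + d y  ≡⟨ sym (∑-distrib-+ (𝟙 ∘ S x) (𝟙 ∘ S y)) ⟩
      sum (λ w → 𝟙 (S x w) + 𝟙 (S y w))  ≤⟨ sum-mono pt ⟩
      sum (λ w → 1 + 𝟙 (S x w ∧ S y w))  ≡⟨ ∑-distrib-+ (λ _ → 1) (λ w → 𝟙 (S x w ∧ S y w)) ⟩
      sum {n} (λ _ → 1) + # (λ w → S x w ∧ S y w)  ≤⟨ +-monoˡ-≤ _ (≤-trans (sum-≤-const {n} {c = 1} λ _ → ≤-refl) (≤-reflexive (*-identityʳ n))) ⟩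
      n + # (λ w → S x w ∧ S y w)  ∎
      where
      pt : ∀ w → 𝟙 (S x w) + 𝟙 (S y w) ≤ 1 + 𝟙 (S x w ∧ S y w)
      pt w with S x w | S y w
      ... | true  | true  = ≤-refl
      ... | true  | false = ≤-refl
      ... | false | true  = ≤-refl
      ... | false | false = z≤n

-- Covering all triangles

module Count {n} (g : BRel n) (gs : Symᵇ g) (gi : Irrᵇ g) {m} (t : Tree m) (free : ¬ Blowup t g) (D : ℕ)
  (col : Fin (suc m) → Bool)
  (indep : ∀ i → col (inject₁ i) ≡ true → col (parent t i) ≡ true → ⊥)
  (a : ℕ) (budget : # col + # (rr t col) ≤ suc a) (col-root : col (fromℕ m) ≡ true)
  where
  open Final g gs gi t free D col indep a budget col-root public

  bad : BRel n
  bad x y = small x y ∧ not (S₂ x y)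

  in-bad in-S₂ low all-small all-high : Fin n → Fin n → Fin n → ℕ
  in-bad    x y z = 𝟙 (bad x y) * 𝟙 (g x z ∧ g y z)
  in-S₂     x y z = 𝟙 (S₂ x y) * (𝟙 (common x y z) + 𝟙 (friend S₂ x y z))
  low       x y z = 𝟙 (not (hi x)) * (𝟙 (big x y) * 𝟙 (big x z))
  all-small x y z = 𝟙 (small x y ∧ (small x z ∧ small y z))
  all-high  x y z = 𝟙 (hi x) * 𝟙 (big y z)

  -- A triangle is charged to its edge `x y`, bad or in `S₂`, or to a low vertex `x` with two big
  -- edges. Summing over the three rotations makes the choice of edge or vertex free.
  part : Fin n → Fin n → Fin n → ℕ
  part x y z = in-bad x y z + (in-S₂ x y z + low x y z)

  private
    one* : ∀ {p q} → p ≡ true → q ≡ true → 1 ≤ 𝟙 p * 𝟙 q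
    one* refl refl = ≤-refl

    𝟙-one : ∀ {p} → p ≡ true → 1 ≤ 𝟙 p
    𝟙-one refl = ≤-refl

    data Class (x y : Fin n) : Set where
      isBig : big x y ≡ true → Class x y
      isBad : bad x y ≡ true → Class x y
      isS₂  : S₂ x y ≡ true → Class x y

    class : ∀ {x y} → g x y ≡ true → Class x y
    class {x} {y} e with big⊎small x y e
    ... | inj₁ h = isBig h
    ... | inj₂ h with true⊎false (S₂ x y)
    ...   | inj₁ q = isS₂ q
    ...   | inj₂ q = isBad (∧-intro h (cong not q))

    bad-part : ∀ {x y z} → bad x y ≡ true → g x z ≡ true → g y z ≡ true → 1 ≤ part x y z
    bad-part b e f = ≤-trans (one* b (∧-intro e f)) (m≤m+n _ _)

    S₂-part : ∀ {x y z} → S₂ x y ≡ true → 1 ≤ 𝟙 (common x y z) + 𝟙 (friend S₂ x y z) → 1 ≤ part x y z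
    S₂-part {x} {y} {z} b h = ≤-trans (≤-trans (*-mono-≤ (𝟙-one b) h) (m≤m+n (in-S₂ x y z) (low x y z))) (m≤n+m _ (in-bad x y z))

    one-big : ∀ {x y z} → big x z ≡ true → S₂ x y ≡ true → S₂ z y ≡ true → 1 ≤ part x y z
    one-big {x} {y} {z} b p q = S₂-part p (≤-trans (𝟙-one (∧-intro b q)) (m≤n+m _ (𝟙 (common x y z))))

    low-part : ∀ {x y z} → hi x ≡ false → big x y ≡ true → big x z ≡ true → 1 ≤ part x y z
    low-part {x} {y} {z} h b c = ≤-trans (≤-trans (*-mono-≤ (𝟙-one (cong not h)) (one* b c)) (m≤n+m (low x y z) (in-S₂ x y z))) (m≤n+m _ (in-bad x y z))

    -- Two big edges meet in z: the triangle is counted at S₂ x y if z is high and at z otherwise.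
    two-big : ∀ {x y z} → S₂ x y ≡ true → big x z ≡ true → big y z ≡ true → 1 ≤ part x y z ⊎ 1 ≤ part z x y
    two-big {x} {y} {z} p b c with true⊎false (hi z)
    ... | inj₁ h = inj₁ (S₂-part p (≤-trans (𝟙-one (∧-intro h (∧-intro b c))) (m≤m+n _ (𝟙 (friend S₂ x y z)))))
    ... | inj₂ h = inj₂ (low-part h (big-sym x z b) (big-sym y z c))

    S₂→small : ∀ {x y} → S₂ x y ≡ true → small x y ≡ true
    S₂→small e = core→small _ _ (S₂≼core _ _ e)

    module _ (x y z : Fin n) (xy : g x y ≡ true) (yz : g y z ≡ true) (zx : g z x ≡ true) where

      -- When no edge is bad, the number of big edges decides: none gives `all-small`, one a friend,
      -- two a common high neighbour or a low vertex, three a low vertex or `all-high`.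
      covered : 1 ≤ all-small x y z ⊎ 1 ≤ part x y z ⊎ 1 ≤ part y z x ⊎ 1 ≤ part z x y ⊎ 1 ≤ all-high x y z
      covered with class xy | class yz | class zx
      ... | isBad p | _ | _ = inj₂ (inj₁ (bad-part p (gs z x zx) yz))
      ... | _ | isBad p | _ = inj₂ (inj₂ (inj₁ (bad-part p (gs x y xy) zx)))
      ... | _ | _ | isBad p = inj₂ (inj₂ (inj₂ (inj₁ (bad-part p (gs y z yz) xy))))
      ... | isS₂ p | isS₂ q | isS₂ r = inj₁ (𝟙-one (∧-intro (S₂→small p) (∧-intro (small-sym z x (S₂→small r)) (S₂→small q))))
      ... | isS₂ p | isS₂ q | isBig r = inj₂ (inj₁ (one-big (big-sym z x r) p (S₂-sym y z q)))
      ... | isBig p | isS₂ q | isS₂ r = inj₂ (inj₂ (inj₁ (one-big (big-sym x y p) q (S₂-sym z x r))))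
      ... | isS₂ p | isBig q | isS₂ r = inj₂ (inj₂ (inj₂ (inj₁ (one-big (big-sym y z q) r (S₂-sym x y p)))))
      ... | isS₂ p | isBig q | isBig r with two-big p (big-sym z x r) q
      ...   | inj₁ h = inj₂ (inj₁ h)
      ...   | inj₂ h = inj₂ (inj₂ (inj₂ (inj₁ h)))
      covered | isBig p | isS₂ q | isBig r with two-big q (big-sym x y p) r
      ...   | inj₁ h = inj₂ (inj₂ (inj₁ h))
      ...   | inj₂ h = inj₂ (inj₁ h)
      covered | isBig p | isBig q | isS₂ r with two-big r (big-sym y z q) p
      ...   | inj₁ h = inj₂ (inj₂ (inj₂ (inj₁ h)))
      ...   | inj₂ h = inj₂ (inj₂ (inj₁ h))
      covered | isBig p | isBig q | isBig r with true⊎false (hi x)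
      ...   | inj₁ h = inj₂ (inj₂ (inj₂ (inj₂ (one* h q))))
      ...   | inj₂ h = inj₂ (inj₁ (low-part h p (big-sym z x r)))

  total : ℕ
  total = ∑³ λ x y z → 𝟙 (clique g x y z)

  total-≤ : total ≤ ∑³ all-small + (∑³ part + (∑³ part + ∑³ part)) + ∑³ all-high
  total-≤ = begin
    total ≤⟨ ∑³-mono pt ⟩
    ∑³ (λ x y z → all-small x y z + (part x y z + (part y z x + part z x y)) + all-high x y z)
      ≡⟨ ∑³-+ (λ x y z → all-small x y z + (part x y z + (part y z x + part z x y))) all-high ⟩
    ∑³ (λ x y z → all-small x y z + (part x y z + (part y z x + part z x y))) + ∑³ all-high
      ≡⟨ cong (_+ ∑³ all-high) (trans (∑³-+ all-small _) (cong (∑³ all-small +_) (trans (∑³-+ part _) (cong (∑³ part +_)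
           (trans (∑³-+ (λ x y z → part y z x) (λ x y z → part z x y)) (cong₂ _+_ (∑³-cyc part) (trans (sym (∑³-cyc (λ x y z → part z x y))) refl))))))) ⟩
    ∑³ all-small + (∑³ part + (∑³ part + ∑³ part)) + ∑³ all-high ∎
    where
    open ≤-Reasoning
    pt : ∀ x y z → 𝟙 (clique g x y z) ≤ all-small x y z + (part x y z + (part y z x + part z x y)) + all-high x y z
    pt x y z with clique g x y z in eq
    ... | false = z≤n
    ... | true with ∧-true {g x y} eq
    ...   | e₁ , e₂₃ with ∧-true {g y z} e₂₃
    ...     | e₂ , e₃ with covered x y z e₁ e₂ e₃
    ...       | inj₁ h = ≤-trans h (≤-trans (m≤m+n _ _) (m≤m+n _ _))
    ...       | inj₂ (inj₁ h) = ≤-trans h (≤-trans (m≤m+n _ _) (≤-trans (m≤n+m _ (all-small x y z)) (m≤m+n _ _)))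
    ...       | inj₂ (inj₂ (inj₁ h)) = ≤-trans h (≤-trans (m≤m+n _ _) (≤-trans (m≤n+m _ (part x y z)) (≤-trans (m≤n+m _ (all-small x y z)) (m≤m+n _ _))))
    ...       | inj₂ (inj₂ (inj₂ (inj₁ h))) = ≤-trans h (≤-trans (m≤n+m _ (part y z x)) (≤-trans (m≤n+m _ (part x y z)) (≤-trans (m≤n+m _ (all-small x y z)) (m≤m+n _ _))))
    ...       | inj₂ (inj₂ (inj₂ (inj₂ h))) = ≤-trans h (m≤n+m _ _)

-- m is the number of edges of the tree, D the degree cut-off, i the size of the independent set.
module Constants (m D i a : ℕ) where
  k kB kT kW kH κ₀ : ℕ
  k  = suc (suc m + m + m)
  kB = 2 * suc (2 * m * 1)
  kT = 2 * suc (2 * m * suc k)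
  kW = 2 * suc (2 * m * suc D)
  kH = 2 * suc (suc m * suc D) * D ^ i
  κ₀ = 2 * ((k + (k + k)) * suc (suc (2 * m) * suc D ^ (suc m + suc m)))

  linear constant : ℕ
  linear   = 2 * (k * kT) + 6 * (k * (kW + kH)) + 12 * κ₀ + 6 * (D * D)
  constant = 6 * (a * (k * kT))

-- The coefficient of (number of high vertices) n. It depends on m and not on D, so D can be defined
-- from it.
slope : ℕ → ℕ
slope m = 12 * suc (suc m + m + m) + 2 * (2 * suc (2 * m * 1))

-- The main term arises from three copies of `P`, each containing `a * e`, and 2e ≤ n² + O(1); the
-- terms with `q` are collected separately because they are not linear in n.
combine : ∀ {T AS P BB n q e DL τ CH a k t w h κ d b} →
  T ≤ AS + (P + (P + P)) + BB → P ≤ DL + (τ + CH) →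
  AS ≤ k * (t * n) → DL ≤ k * (n * q + (n * q + (w * n + h * n))) →
  τ ≤ a * e + κ * (2 * n) → CH ≤ n * d → BB ≤ q * (b * n) → 2 * e ≤ n * n + 2 * (k * t) →
  2 * T ≤ 3 * a * (n * n) + ((2 * (k * t) + 6 * (k * (w + h)) + 12 * κ + 6 * d) * n + 6 * (a * (k * t)))
            + (12 * k + 2 * b) * (q * n)
combine {T} {AS} {P} {BB} {n} {q} {e} {DL} {τ} {CH} {a} {k} {t} {w} {h} {κ} {d} {b} h₁ h₂ h₃ h₄ h₅ h₆ h₇ h₈ = begin
  2 * T
    ≤⟨ *-monoʳ-≤ 2 h₁ ⟩
  2 * (AS + (P + (P + P)) + BB)
    ≤⟨ *-monoʳ-≤ 2 (+-mono-≤ (+-mono-≤ h₃ (+-mono-≤ P≤ (+-mono-≤ P≤ P≤))) h₇) ⟩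
  2 * (k * (t * n) + (X + (X + X)) + q * (b * n))
    ≡⟨ arith₁ a e n q k t w h κ d b ⟩
  3 * a * (2 * e) + R
    ≤⟨ +-monoˡ-≤ R (*-monoʳ-≤ (3 * a) h₈) ⟩
  3 * a * (n * n + 2 * (k * t)) + R
    ≡⟨ arith₂ a n q k t w h κ d b ⟩
  3 * a * (n * n) + ((2 * (k * t) + 6 * (k * (w + h)) + 12 * κ + 6 * d) * n + 6 * (a * (k * t)))
    + (12 * k + 2 * b) * (q * n) ∎
  where
  open ≤-Reasoning
  X = k * (n * q + (n * q + (w * n + h * n))) + ((a * e + κ * (2 * n)) + n * d)
  R = (2 * (k * t) + 6 * (k * (w + h)) + 12 * κ + 6 * d) * n + (12 * k + 2 * b) * (q * n)
  P≤ : P ≤ X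
  P≤ = ≤-trans h₂ (+-mono-≤ h₄ (+-mono-≤ h₅ h₆))
  arith₁ : ∀ a e n q k t w h κ d b → let X = k * (n * q + (n * q + (w * n + h * n))) + ((a * e + κ * (2 * n)) + n * d) in
    2 * (k * (t * n) + (X + (X + X)) + q * (b * n)) ≡
    3 * a * (2 * e) + ((2 * (k * t) + 6 * (k * (w + h)) + 12 * κ + 6 * d) * n + (12 * k + 2 * b) * (q * n))
  arith₁ = solve-∀
  arith₂ : ∀ a n q k t w h κ d b →
    3 * a * (n * n + 2 * (k * t)) + ((2 * (k * t) + 6 * (k * (w + h)) + 12 * κ + 6 * d) * n + (12 * k + 2 * b) * (q * n)) ≡
    3 * a * (n * n) + ((2 * (k * t) + 6 * (k * (w + h)) + 12 * κ + 6 * d) * n + 6 * (a * (k * t))) + (12 * k + 2 * b) * (q * n)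
  arith₂ = solve-∀

module Bound {n} (g : BRel n) (gs : Symᵇ g) (gi : Irrᵇ g) {m} (t : Tree m) (free : ¬ Blowup t g) (D : ℕ)
  (col : Fin (suc m) → Bool)
  (indep : ∀ i → col (inject₁ i) ≡ true → col (parent t i) ≡ true → ⊥)
  (a : ℕ) (budget : # col + # (rr t col) ≤ suc a) (col-root : col (fromℕ m) ≡ true)
  where
  open Count g gs gi t free D col indep a budget col-root
  open Constants m D (# col) a

  #hi : ℕ
  #hi = # hi

  #hi-≤ : D * #hi ≤ kB * n
  #hi-≤ = ≤-trans (≤-trans (≤-reflexive (*-distribˡ-sum D (𝟙 ∘ hi))) (sum-mono pt))
            (≤-trans (≤-reflexive (sym (size≡∑# big))) size-big)
    where
    pt : ∀ x → D * 𝟙 (hi x) ≤ # (big x)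
    pt x with hi x in eq
    ... | true  = ≤-trans (≤-reflexive (*-identityʳ D)) (<⇒≤ (hi-elim eq))
    ... | false = ≤-trans (≤-reflexive (*-zeroʳ D)) z≤n

  all-small-≤ : ∑³ all-small ≤ k * (kT * n)
  all-small-≤ = begin
    ∑³ all-small  ≤⟨ ∑³-mono pt ⟩
    ∑³ (λ x y z → 𝟙 (smallT x y) * 𝟙 (g x z ∧ g y z))  ≡⟨ sym (weight-∑³ smallT λ x y z → g x z ∧ g y z) ⟩
    weight smallT codeg  ≤⟨ weight-≤ smallT k (λ x y e → small-codeg (proj₁ (∧-true {small x y} e))) ⟩
    k * size smallT  ≤⟨ *-monoʳ-≤ k size-smallT ⟩
    k * (kT * n)  ∎
    where
    open ≤-Reasoning
    pt : ∀ x y z → all-small x y z ≤ 𝟙 (smallT x y) * 𝟙 (g x z ∧ g y z)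
    pt x y z = ≤-trans (𝟙-mono {b = smallT x y ∧ (g x z ∧ g y z)} λ e →
      let p , q = ∧-true {small x y} e ; r , s = ∧-true {small x z} q
      in ∧-intro (∧-intro p (some-intro (λ w → small x w ∧ small y w) z q)) (∧-intro (small→g x z r) (small→g y z s)))
      (≤-reflexive (𝟙-∧ (smallT x y) _))

  mantel-S₂ : 2 * size S₂ ≤ n * n + 2 * (k * kT)
  mantel-S₂ = mantel S₂ S₂-sym (k * kT) (begin
    weight S₂ (λ x y → # λ w → S₂ x w ∧ S₂ y w)  ≡⟨ weight-∑³ S₂ (λ x y w → S₂ x w ∧ S₂ y w) ⟩
    ∑³ (λ x y z → 𝟙 (S₂ x y) * 𝟙 (S₂ x z ∧ S₂ y z)) ≤⟨ ∑³-mono pt ⟩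
    ∑³ all-small  ≤⟨ all-small-≤ ⟩
    k * (kT * n)  ≡⟨ sym (*-assoc k kT n) ⟩
    k * kT * n  ∎)
    where
    open ≤-Reasoning
    s : ∀ x y → S₂ x y ≡ true → small x y ≡ true
    s x y e = core→small x y (S₂≼core x y e)
    pt : ∀ x y z → 𝟙 (S₂ x y) * 𝟙 (S₂ x z ∧ S₂ y z) ≤ all-small x y z
    pt x y z = ≤-trans (≤-reflexive (sym (𝟙-∧ (S₂ x y) _))) (𝟙-mono {S₂ x y ∧ (S₂ x z ∧ S₂ y z)} λ e →
      let p , q = ∧-true {S₂ x y} e ; r , u = ∧-true {S₂ x z} q in ∧-intro (s x y p) (∧-intro (s x z r) (s y z u)))

  size-bad : size bad ≤ n * #hi + (n * #hi + (kW * n + kH * n))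
  size-bad = begin
    size bad  ≤⟨ size-cover bad R cover ⟩
    size hiˡ + (size hiʳ + (size twin + (size heavy + 0)))  ≤⟨ +-mono-≤ left (+-mono-≤ right (+-mono-≤ size-twin (≤-trans (≤-reflexive (+-identityʳ (size heavy))) size-heavy))) ⟩
    n * #hi + (n * #hi + (kW * n + kH * n))  ∎
    where
    open ≤-Reasoning
    hiˡ hiʳ : BRel n
    hiˡ x y = hi x
    hiʳ x y = hi y
    R : Fin 4 → BRel n
    R zero                   = hiˡ
    R (suc zero)             = hiʳ
    R (suc (suc zero))       = twin
    R (suc (suc (suc zero))) = heavy
    right : size hiʳ ≤ n * #hi
    right = ≤-trans (≤-reflexive (size≡∑# hiʳ)) (sum-≤-const {n} {c = #hi} λ _ → ≤-refl)
    left : size hiˡ ≤ n * #hi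
    left = ≤-trans (≤-reflexive (∑-comm {n} {n} (λ x y → 𝟙 (hi x) * 1))) right
    cover : ∀ x y → bad x y ≡ true → ∃ λ j → R j x y ≡ true
    cover x y e with ∧-true {small x y} e
    ... | p , q with true⊎false (hi x) | true⊎false (hi y) | true⊎false (twin x y) | true⊎false (heavy x y)
    ...   | inj₁ hx | _       | _       | _       = zero , hx
    ...   | _       | inj₁ hy | _       | _       = suc zero , hy
    ...   | _       | _       | inj₁ tw | _       = suc (suc zero) , tw
    ...   | _       | _       | _       | inj₁ hv = suc (suc (suc zero)) , hv
    ...   | inj₂ hx | inj₂ hy | inj₂ tw | inj₂ hv = clash
      (∧-intro (∧-intro (∧-intro p (cong₂ (λ u v → not u ∧ not v) hx hy)) (cong not tw)) (cong not hv)) (not-true q)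

  part-≤ : ∑³ part ≤ k * size bad + (τ S₂ + n * (D * D))
  part-≤ = begin
    ∑³ part  ≡⟨ trans (∑³-+ in-bad _) (cong (∑³ in-bad +_) (∑³-+ in-S₂ low)) ⟩
    ∑³ in-bad + (∑³ in-S₂ + ∑³ low)  ≤⟨ +-mono-≤ bad≤ (+-mono-≤ (≤-reflexive S₂≡) low≤) ⟩
    k * size bad + (τ S₂ + n * (D * D))  ∎
    where
    open ≤-Reasoning
    bad≤ : ∑³ in-bad ≤ k * size bad
    bad≤ = ≤-trans (≤-reflexive (sym (weight-∑³ bad λ x y z → g x z ∧ g y z)))
      (weight-≤ bad k λ x y e → small-codeg (proj₁ (∧-true {small x y} e)))
    S₂≡ : ∑³ in-S₂ ≡ τ S₂
    S₂≡ = sum-cong-≗ λ x → sum-cong-≗ λ y → trans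
      (sym (*-distribˡ-sum (𝟙 (S₂ x y)) (λ z → 𝟙 (common x y z) + 𝟙 (friend S₂ x y z))))
      (cong (𝟙 (S₂ x y) *_) (∑-distrib-+ (𝟙 ∘ common x y) (𝟙 ∘ friend S₂ x y)))
    low≤ : ∑³ low ≤ n * (D * D)
    low≤ = sum-≤-const λ x → begin
      sum (λ y → sum λ z → 𝟙 (not (hi x)) * (𝟙 (big x y) * 𝟙 (big x z)))
        ≡⟨ sum-cong-≗ (λ y → trans (sym (*-distribˡ-sum (𝟙 (not (hi x))) (λ z → 𝟙 (big x y) * 𝟙 (big x z)))) (cong (𝟙 (not (hi x)) *_) (sym (*-distribˡ-sum (𝟙 (big x y)) (𝟙 ∘ big x))))) ⟩
      sum (λ y → 𝟙 (not (hi x)) * (𝟙 (big x y) * # (big x)))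
        ≡⟨ trans (sym (*-distribˡ-sum (𝟙 (not (hi x))) (λ y → 𝟙 (big x y) * # (big x)))) (cong (𝟙 (not (hi x)) *_) (sym (*-distribʳ-sum (# (big x)) (𝟙 ∘ big x)))) ⟩
      𝟙 (not (hi x)) * (# (big x) * # (big x))
        ≤⟨ square x ⟩
      D * D ∎
      where
      square : ∀ x → 𝟙 (not (hi x)) * (# (big x) * # (big x)) ≤ D * D
      square x with hi x in eq
      ... | true  = z≤n
      ... | false = ≤-trans (≤-reflexive (+-identityʳ _)) (*-mono-≤ (lo-deg eq) (lo-deg eq))

  all-high-≤ : ∑³ all-high ≤ #hi * (kB * n)
  all-high-≤ = begin
    ∑³ all-high  ≡⟨ sum-cong-≗ (λ x → trans (sum-cong-≗ λ y → sym (*-distribˡ-sum (𝟙 (hi x)) (𝟙 ∘ big y)))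
                                                                         (sym (*-distribˡ-sum (𝟙 (hi x)) (λ y → # (big y))))) ⟩
    sum (λ x → 𝟙 (hi x) * sum (λ y → # (big y))) ≡⟨ sym (*-distribʳ-sum (sum λ y → # (big y)) (𝟙 ∘ hi)) ⟩
    #hi * sum (λ y → # (big y))  ≤⟨ *-monoʳ-≤ #hi (≤-trans (≤-reflexive (sym (size≡∑# big))) size-big) ⟩
    #hi * (kB * n)  ∎
    where open ≤-Reasoning

  bound : 2 * total ≤ 3 * a * (n * n) + (linear * n + constant) + slope m * (#hi * n)
  bound = combine {T = total} {AS = ∑³ all-small} {P = ∑³ part} {BB = ∑³ all-high} {n = n} {q = #hi} {e = size S₂}
    {DL = k * size bad} {τ = τ S₂} {CH = n * (D * D)} {a = a} {k = k} {t = kT} {w = kW} {h = kH} {κ = κ₀} {d = D * D} {b = kB}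
    total-≤ part-≤ all-small-≤ (*-monoʳ-≤ k size-bad) τ-S₂ ≤-refl all-high-≤ mantel-S₂

few-triangles : ∀ {n} (g : BRel n) → Symᵇ g → Irrᵇ g → ∀ {m} (t : Tree m) → ¬ Blowup t g →
  ∀ D (col : Fin (suc m) → Bool) → (∀ i → col (inject₁ i) ≡ true → col (parent t i) ≡ true → ⊥) →
  ∀ a → # col + # (rr t col) ≤ suc a → col (fromℕ m) ≡ true →
  let open Constants m D (# col) a in
  ∃ λ q → D * q ≤ kB * n
    × 2 * ∑³ (λ x y z → 𝟙 (clique g x y z)) ≤ 3 * a * (n * n) + (linear * n + constant) + slope m * (q * n)
few-triangles g gs gi t free D col indep a budget cr = B.#hi , B.#hi-≤ , B.bound
  where module B = Bound g gs gi t free D col indep a budget cr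

-- Rooting a tree

record SimplePath {k} (R : Fin k → Fin k → Set) (x y : Fin k) : Set where
  field
    {len} : ℕ
    at    : Fin (suc len) → Fin k
    start : at zero ≡ x
    end   : at (fromℕ len) ≡ y
    inj   : ∀ i j → at i ≡ at j → i ≡ j
    step  : ∀ i → R (at (inject₁ i)) (at (suc i))

module _ {k} {R : Fin k → Fin k → Set} where
  open SimplePath

  suffix : ∀ {len} (at : Fin (suc len) → Fin k) i → (∀ i j → at i ≡ at j → i ≡ j) →
           (∀ i → R (at (inject₁ i)) (at (suc i))) → SimplePath R (at i) (at (fromℕ len))
  suffix at zero inj st = record { at = at ; start = refl ; end = refl ; inj = inj ; step = st }
  suffix {suc len} at (suc i) inj st =
    suffix (at ∘ suc) i (λ a b q → suc-injective (inj (suc a) (suc b) q)) (st ∘ suc)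

  -- If the new first vertex already occurs on the simplified rest, everything before that
  -- occurrence is dropped.
  simplify : ∀ {x y} → Star R x y → SimplePath R x y
  simplify {x} ε = record { len = 0 ; at = λ _ → x ; start = refl ; end = refl ; inj = λ { zero zero _ → refl } ; step = λ () }
  simplify {x} {y} (r ◅ rs) with simplify rs
  ... | P with any? (λ i → at P i ≟ x)
  ...   | yes (i , q) = subst₂ (SimplePath R) q (end P) (suffix (at P) i (inj P) (step P))
  ...   | no none = record
    { at = x ∷ᶠ at P ; start = refl ; end = end P
    ; inj = ∷ᶠ-inj (λ i q → none (i , q)) (inj P)
    ; step = λ { zero → subst (R x) (sym (start P)) r ; (suc i) → step P i } }

module _ {v} (F : Graph v) where
  open Graph F

  -- `only` says that the named vertices span no edge of F beyond the tree edges. Acyclicity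
  -- preserves this, and it later identifies the edges of F with those of `tree`.
  record Partial (r : Fin v) (k : ℕ) : Set where
    field
      tree  : Tree k
      name  : Fin (suc k) → Fin v
      inj   : ∀ i j → name i ≡ name j → i ≡ j
      root≡ : name (fromℕ k) ≡ r
      edge  : ∀ i → name (inject₁ i) ~ name (parent tree i)
      only  : ∀ i j → name i ~ name j →
              ∃ λ e → (i ≡ inject₁ e × j ≡ parent tree e) ⊎ (j ≡ inject₁ e × i ≡ parent tree e)

  climb : ∀ {k} (t : Tree k) (name : Fin (suc k) → Fin v) →
    (∀ i → name (inject₁ i) ~ name (parent t i)) → ∀ i → Star (λ i j → name i ~ name j) i (fromℕ k)
  climb root name e zero = ε
  climb (grow a t) name e zero = e zero ◅ gmap suc (λ r → r) (climb t (name ∘ suc) (e ∘ suc) a)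
  climb (grow a t) name e (suc i) = gmap suc (λ r → r) (climb t (name ∘ suc) (e ∘ suc) i)

  module _ {r k} (P : Partial r k) where
    open Partial P

    -- The two neighbours of `b` are joined inside the tree by a path through the root, made simple;
    -- `b` closes it. As `i ≢ j`, the path has at least two vertices, so the cycle has at least
    -- three.
    detour : ∀ {b i j} → (∀ i → name i ≢ b) → b ~ name i → b ~ name j → i ≢ j → Cycle F
    detour {b} {i} {j} new bi bj ne = close-up (simplify (climb tree name edge i ◅◅ reverse ~-sym (climb tree name edge j)))
      where
      close-up : SimplePath (λ i j → name i ~ name j) i j → Cycle F
      close-up record { len = zero ; at = at ; start = s ; end = e } = contradiction (trans (sym s) e) ne
      close-up record { len = suc l ; at = at ; start = s ; end = e ; inj = in′ ; step = st } = record
        { vertex = b ∷ᶠ (name ∘ at)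
        ; distinct = λ {x} {y} → ∷ᶠ-inj (λ i → new (at i)) (λ x y q → in′ x y (inj _ _ q)) x y
        ; step = λ { zero → subst (λ z → b ~ name z) (sym s) bi ; (suc i) → st i }
        ; close = subst (λ z → name z ~ b) (sym e) (~-sym bj) }

    extend : ¬ Cycle F → ∀ {b} a → (∀ i → name i ≢ b) → b ~ name a → Partial r (suc k)
    extend acyclic {b} a new ba = record
      { tree = grow a tree ; name = b ∷ᶠ name ; inj = ∷ᶠ-inj new inj ; root≡ = root≡
      ; edge = λ { zero → ba ; (suc i) → edge i }
      ; only = on }
      where
      at-a : ∀ {j} → b ~ name j → j ≡ a
      at-a {j} bj with j ≟ a
      ... | yes q = q
      ... | no ne = ⊥-elim (acyclic (detour new bj ba ne))
      on : ∀ i j → (b ∷ᶠ name) i ~ (b ∷ᶠ name) j →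
           ∃ λ e → (i ≡ inject₁ e × j ≡ parent (grow a tree) e) ⊎ (j ≡ inject₁ e × i ≡ parent (grow a tree) e)
      on zero    zero    q = ⊥-elim (~-irr q)
      on zero    (suc j) q = zero , inj₁ (refl , cong suc (at-a q))
      on (suc i) zero    q = zero , inj₂ (refl , cong suc (at-a (~-sym q)))
      on (suc i) (suc j) q with only i j q
      ... | e , inj₁ (x , y) = suc e , inj₁ (cong suc x , cong suc y)
      ... | e , inj₂ (x , y) = suc e , inj₂ (cong suc x , cong suc y)

    named? : ∀ u → Dec (∃ λ i → name i ≡ u)
    named? u = any? λ i → name i ≟ u

    leave : ∀ {x u} → Star _~_ x u → (∃ λ i → name i ≡ x) → ¬ (∃ λ i → name i ≡ u) →
      ∃₂ λ b a → (∀ i → name i ≢ b) × b ~ name a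
    leave ε h out = contradiction h out
    leave {x} (_◅_ {j = y} e s) (i , q) out with named? y
    ... | yes h = leave s h out
    ... | no no-y = y , i , (λ j p → no-y (j , p)) , ~-sym (subst (_~ y) (sym q) e)

  Rooting : Fin v → ℕ → Set
  Rooting r k = Σ (Partial r k) λ P → ∀ u → ∃ λ i → Partial.name P i ≡ u

  -- A walk from the root to an unnamed vertex leaves the named set somewhere, and the first vertex
  -- outside becomes the next leaf. With no fuel left this would give k + 2 distinct names among at
  -- most k + 1 vertices.
  complete-rooting : Connected F → ¬ Cycle F → ∀ {r} fuel k → Partial r k → v ≤ suc k + fuel → ∃ λ m → Rooting r m
  complete-rooting conn acyclic {r} fuel k P h with any? (λ u → ¬? (named? P u))
  ... | no all = k , P , λ u → named-of u
    where
    named-of : ∀ u → ∃ λ i → Partial.name P i ≡ u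
    named-of u with named? P u
    ... | yes q = q
    ... | no ¬q = contradiction (u , ¬q) all
  ... | yes (u , out) with leave P (conn r u) (fromℕ k , Partial.root≡ P) out
  ...   | b , a , new , ba with fuel
  ...     | zero = contradiction (injective⇒≤ {f = b ∷ᶠ Partial.name P} (λ {x} {y} → ∷ᶠ-inj new (Partial.inj P) x y))
                     (<⇒≱ (s≤s (≤-trans h (≤-reflexive (+-identityʳ (suc k))))))
  ...     | suc f = complete-rooting conn acyclic f (suc k) (extend P acyclic a new ba)
                      (≤-trans h (≤-reflexive (+-suc (suc k) f)))

  rooting : IsTree F → ∀ r → ∃ λ m → Rooting r m
  rooting T r = complete-rooting (IsTree.connected T) (IsTree.acyclic T) v 0 start (m≤n+m v 1)
    where
    start : Partial r 0
    start = record { tree = root ; name = λ _ → r ; inj = λ { zero zero _ → refl } ; root≡ = refl ; edge = λ ()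
                   ; only = λ _ _ q → ⊥-elim (~-irr q) }

-- Colour classes of the rooted tree and crosscuts

#≤1 : ∀ {n} (p : Fin n → Bool) → (∀ x y → p x ≡ true → p y ≡ true → x ≡ y) → # p ≤ 1
#≤1 p h = ≮⇒≥ λ two →
  let x , px = #-∃ (<-trans (s≤s z≤n) two)
      y , py , y∉ = pick-fresh p (x ∷ []) two
  in y∉ (here (h y x py px))

#-injective : ∀ {k n} (f : Fin k → Fin n) → (∀ i j → f i ≡ f j → i ≡ j) → ∀ p → # (p ∘ f) ≤ # p
#-injective {k} {n} f inj p = begin
  # (p ∘ f)  ≡⟨ sum-cong-≗ (λ i → sym (sum-δ (𝟙 ∘ p) (f i))) ⟩
  sum (λ i → sum λ u → 𝟙 (u == f i) * 𝟙 (p u))  ≡⟨ ∑-comm (λ i u → 𝟙 (u == f i) * 𝟙 (p u)) ⟩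
  sum (λ u → sum λ i → 𝟙 (u == f i) * 𝟙 (p u))  ≡⟨ sum-cong-≗ (λ u → sym (*-distribʳ-sum (𝟙 (p u)) (λ i → 𝟙 (u == f i)))) ⟩
  sum (λ u → # (λ i → u == f i) * 𝟙 (p u))  ≤⟨ sum-mono (λ u → *-monoˡ-≤ (𝟙 (p u)) (#≤1 (λ i → u == f i) λ i j a b → inj i j (trans (sym (==-true {x = u} {f i} a)) (==-true {x = u} {f j} b)))) ⟩
  sum (λ u → 1 * 𝟙 (p u))  ≡⟨ sum-cong-≗ (λ u → +-identityʳ (𝟙 (p u))) ⟩
  # p  ∎
  where open ≤-Reasoning

#-subset : ∀ {n} (I : Subset n) → # (λ u → does (u ∈? I)) ≡ ∣ I ∣
#-subset []            = refl
#-subset (inside ∷ I)  = cong suc (#-subset I)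
#-subset (outside ∷ I) = #-subset I

#-into-list : ∀ {k} {A : Set} (_≟ᴬ_ : (x y : A) → Dec (x ≡ y)) (c : Fin k → Bool) (f : Fin k → A) (L : List A) →
  (∀ i → c i ≡ true → f i ∈ L) → (∀ i j → f i ≡ f j → i ≡ j) → # c ≤ length L
#-into-list _≟ᴬ_ c f L mem inj = ≮⇒≥ λ h →
  let i , ci , out = pick c (λ u i → does (f i ≟ᴬ u)) 1 L
        (λ u _ → #≤1 (λ i → does (f i ≟ᴬ u)) λ i j a b → inj i j (trans (does-true {d = f i ≟ᴬ u} a) (sym (does-true {d = f j ≟ᴬ u} b))))
        (≤-<-trans (≤-reflexive (*-identityʳ _)) h)
  in clash (does-intro (f i ≟ᴬ f i) refl) (out (f i) (mem i ci))

lookup-inj : ∀ {A : Set} {xs : List A} → Unique xs → ∀ i j → lookup xs i ≡ lookup xs j → i ≡ j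
lookup-inj (_ ∷ _) zero    zero    _ = refl
lookup-inj (p ∷ _) zero    (suc j) q = contradiction q (All.lookup p (∈-lookup j))
lookup-inj (p ∷ _) (suc i) zero    q = contradiction (sym q) (All.lookup p (∈-lookup i))
lookup-inj (_ ∷ u) (suc i) (suc j) q = cong suc (lookup-inj u i j q)

module _ {v} (F : Graph v) where
  open Graph F

  edges-unique : Unique (edges F)
  edges-unique = filter⁺ _ (cartesianProduct⁺ (allFin⁺ v) (allFin⁺ v))

  ends : ∀ e → let p = lookup (edges F) e in proj₁ p <ᶠ proj₂ p × proj₁ p ~ proj₂ p
  ends e = proj₂ (∈-filter⁻ (λ (x , y) → (x <ᶠ? y) ×-dec (x ~? y)) {xs = cartesianProduct (allFin v) (allFin v)} (∈-lookup e))

  edge-∈ : ∀ {x y} → x <ᶠ y → x ~ y → (x , y) ∈ edges F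
  edge-∈ {x} {y} l e = ∈-filter⁺ (λ (x , y) → (x <ᶠ? y) ×-dec (x ~? y)) (∈-cartesianProduct⁺ (∈-allFin x) (∈-allFin y)) (l , e)

  ordered : Fin v → Fin v → Fin v × Fin v
  ordered x y with <ᶠ-cmp x y
  ... | tri< _ _ _ = x , y
  ... | tri≈ _ _ _ = x , y
  ... | tri> _ _ _ = y , x

module _ {v} (F : Graph v) {r m} (P : Partial F r m) (I : Subset v) where
  open Graph F
  open Partial P

  colour : Fin (suc m) → Bool
  colour i = does (name i ∈? I)

  #-colour : # colour ≤ ∣ I ∣
  #-colour = ≤-trans (#-injective name inj (λ u → does (u ∈? I))) (≤-reflexive (#-subset I))

  parent≢ : ∀ {k} (t : Tree k) i → parent t i ≢ inject₁ i
  parent≢ (grow a t) zero    ()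
  parent≢ (grow a t) (suc i) q = parent≢ t i (suc-injective q)

  -- A parent is always older than its child, so no tree edge is another one reversed.
  no-swap : ∀ {k} (t : Tree k) i j → inject₁ i ≡ parent t j → parent t i ≡ inject₁ j → ⊥
  no-swap (grow a t) zero    zero    ()
  no-swap (grow a t) zero    (suc j) () q
  no-swap (grow a t) (suc i) zero    p ()
  no-swap (grow a t) (suc i) (suc j) p q = no-swap t i j (suc-injective p) (suc-injective q)

  inject₁-inj : ∀ {k} (i j : Fin k) → inject₁ i ≡ inject₁ j → i ≡ j
  inject₁-inj zero    zero    _ = refl
  inject₁-inj (suc i) (suc j) q = cong suc (inject₁-inj i j (suc-injective q))

  pair : Fin m → Fin v × Fin v
  pair i = ordered F (name (inject₁ i)) (name (parent tree i))

  pair-cases : ∀ i → (pair i ≡ (name (inject₁ i) , name (parent tree i)) × name (inject₁ i) <ᶠ name (parent tree i))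
                   ⊎ (pair i ≡ (name (parent tree i) , name (inject₁ i)) × name (parent tree i) <ᶠ name (inject₁ i))
  pair-cases i with <ᶠ-cmp (name (inject₁ i)) (name (parent tree i))
  ... | tri< l _ _ = inj₁ (refl , l)
  ... | tri≈ _ q _ = contradiction (sym (inj _ _ q)) (parent≢ tree i)
  ... | tri> _ _ l = inj₂ (refl , l)

  pair-inj : ∀ i j → pair i ≡ pair j → i ≡ j
  pair-inj i j q with pair-cases i | pair-cases j
  ... | inj₁ (a , _) | inj₁ (b , _) = inject₁-inj i j (inj _ _ (cong proj₁ (trans (sym a) (trans q b))))
  ... | inj₂ (a , _) | inj₂ (b , _) = inject₁-inj i j (inj _ _ (cong proj₂ (trans (sym a) (trans q b))))
  ... | inj₁ (a , _) | inj₂ (b , _) = let p = trans (sym a) (trans q b) in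
    ⊥-elim (no-swap tree i j (inj _ _ (cong proj₁ p)) (inj _ _ (cong proj₂ p)))
  ... | inj₂ (a , _) | inj₁ (b , _) = let p = trans (sym a) (trans q b) in
    ⊥-elim (no-swap tree i j (inj _ _ (cong proj₂ p)) (inj _ _ (cong proj₁ p)))

  #-rr : # (rr tree colour) ≤ length (edgesOff F I)
  #-rr = #-into-list (≡-dec _≟_ _≟_) (rr tree colour) pair (edgesOff F I) mem pair-inj
    where
    out : ∀ {u} → does (u ∈? I) ≡ false → ¬ (u ∈ˢ I)
    out {u} e u∈ = clash (does-intro (u ∈? I) u∈) e
    mem : ∀ i → rr tree colour i ≡ true → pair i ∈ edgesOff F I
    mem i e with ∧-true {not (colour (inject₁ i))} e | pair-cases i
    ... | a , b | inj₁ (q , l) = subst (_∈ edgesOff F I) (sym q)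
          (∈-filter⁺ (λ (x , y) → ¬? (x ∈? I) ×-dec ¬? (y ∈? I)) (edge-∈ F l (edge i)) (out (not-true a) , out (not-true b)))
    ... | a , b | inj₂ (q , l) = subst (_∈ edgesOff F I) (sym q)
          (∈-filter⁺ (λ (x , y) → ¬? (x ∈? I) ×-dec ¬? (y ∈? I)) (edge-∈ F l (~-sym (edge i))) (out (not-true b) , out (not-true a)))

  colour-indep : Independent F I → ∀ i → colour (inject₁ i) ≡ true → colour (parent tree i) ≡ true → ⊥
  colour-indep ind i a b = ind _ _ (does-true {d = name (inject₁ i) ∈? I} a) (does-true {d = name (parent tree i) ∈? I} b) (edge i)

-- From a blowup of the rooted tree to a copy of F▵

adjacency : ∀ {n} → Graph n → BRel n
adjacency G x y = does (Graph._~?_ G x y)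

module _ {v} (F : Graph v) {r m} (R : Rooting F r m) {n} (G : Graph n) where
  private
    module F = Graph F
    module G = Graph G
    open Partial (proj₁ R)
    pos : Fin v → Fin (suc m)
    pos u = proj₁ (proj₂ R u)
    name-pos : ∀ u → name (pos u) ≡ u
    name-pos u = proj₂ (proj₂ R u)

    tree-edge : ∀ x y → x F.~ y → ∃ λ e → (pos x ≡ inject₁ e × pos y ≡ parent tree e) ⊎ (pos y ≡ inject₁ e × pos x ≡ parent tree e)
    tree-edge x y e = only (pos x) (pos y) (subst₂ F._~_ (sym (name-pos x)) (sym (name-pos y)) e)

    index : Edge F → Fin m
    index e = proj₁ (tree-edge _ _ (proj₂ (ends F e)))

    index-ends : ∀ e → let p = lookup (edges F) e in
      (pos (proj₁ p) ≡ inject₁ (index e) × pos (proj₂ p) ≡ parent tree (index e)) ⊎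
      (pos (proj₂ p) ≡ inject₁ (index e) × pos (proj₁ p) ≡ parent tree (index e))
    index-ends e = proj₂ (tree-edge _ _ (proj₂ (ends F e)))

    pos-inj : ∀ {x y} → pos x ≡ pos y → x ≡ y
    pos-inj {x} {y} q = trans (sym (name-pos x)) (trans (cong name q) (name-pos y))

    -- The tree edge determines both ends. Opposite orientations are impossible because `edges`
    -- lists every edge in increasing order.
    index-inj : ∀ e e′ → index e ≡ index e′ → e ≡ e′
    index-inj e e′ q = lookup-inj (edges-unique F) e e′ same
      where
      same : lookup (edges F) e ≡ lookup (edges F) e′
      same with index-ends e | index-ends e′
      ... | inj₁ (a , b) | inj₁ (c , d) = cong₂ _,_ (pos-inj (trans a (trans (cong inject₁ q) (sym c)))) (pos-inj (trans b (trans (cong (parent tree) q) (sym d))))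
      ... | inj₂ (a , b) | inj₂ (c , d) = cong₂ _,_ (pos-inj (trans b (trans (cong (parent tree) q) (sym d)))) (pos-inj (trans a (trans (cong inject₁ q) (sym c))))
      ... | inj₁ (a , b) | inj₂ (c , d) = contradiction (proj₁ (ends F e′)) (<ᶠ-asym
            (subst₂ _<ᶠ_ (pos-inj (trans a (trans (cong inject₁ q) (sym c)))) (pos-inj (trans b (trans (cong (parent tree) q) (sym d)))) (proj₁ (ends F e))))
      ... | inj₂ (a , b) | inj₁ (c , d) = contradiction (proj₁ (ends F e′)) (<ᶠ-asym
            (subst₂ _<ᶠ_ (pos-inj (trans b (trans (cong (parent tree) q) (sym d)))) (pos-inj (trans a (trans (cong inject₁ q) (sym c)))) (proj₁ (ends F e))))

  blowup-copy : Blowup tree (adjacency G) → ∃ λ f → IsCopy (F ▵) G f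
  blowup-copy B = f , inj-f , λ x y → hom (splitAt v x) (splitAt v y)
    where
    open Blowup B
    fs : Fin v ⊎ Edge F → Fin n
    fs = [ φ ∘ pos , ω ∘ index ]′
    f : Fin (v + length (edges F)) → Fin n
    f x = fs (splitAt v x)
    fs-inj : ∀ s s′ → fs s ≡ fs s′ → s ≡ s′
    fs-inj (inj₁ x) (inj₁ y) q = cong inj₁ (pos-inj (φ-inj _ _ q))
    fs-inj (inj₁ x) (inj₂ e) q = contradiction q (disjoint _ _)
    fs-inj (inj₂ e) (inj₁ x) q = contradiction (sym q) (disjoint _ _)
    fs-inj (inj₂ e) (inj₂ e′) q = cong inj₂ (index-inj e e′ (ω-inj _ _ q))
    inj-f : Injective _≡_ _≡_ f
    inj-f {x} {y} q = trans (sym (join-splitAt v _ x)) (trans (cong (join v _) (fs-inj (splitAt v x) (splitAt v y) q)) (join-splitAt v _ y))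
    adj : ∀ {x y} → adjacency G x y ≡ true → x G.~ y
    adj {x} {y} = does-true {d = x G.~? y}
    spoke : ∀ x e → Incident F x e → φ (pos x) G.~ ω (index e)
    spoke x e h with index-ends e
    spoke x e (inj₁ refl) | inj₁ (a , b) = subst (G._~ _) (cong φ (sym a)) (adj (left (index e)))
    spoke x e (inj₂ refl) | inj₁ (a , b) = subst (G._~ _) (cong φ (sym b)) (adj (right (index e)))
    spoke x e (inj₁ refl) | inj₂ (a , b) = subst (G._~ _) (cong φ (sym b)) (adj (right (index e)))
    spoke x e (inj₂ refl) | inj₂ (a , b) = subst (G._~ _) (cong φ (sym a)) (adj (left (index e)))
    hom : ∀ s s′ → BlowupAdj F s s′ → fs s G.~ fs s′
    hom (inj₁ x) (inj₁ y) h with tree-edge x y h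
    ... | e , inj₁ (a , b) = subst₂ G._~_ (cong φ (sym a)) (cong φ (sym b)) (adj (base e))
    ... | e , inj₂ (a , b) = G.~-sym (subst₂ G._~_ (cong φ (sym a)) (cong φ (sym b)) (adj (base e)))
    hom (inj₁ x) (inj₂ e) h = spoke x e h
    hom (inj₂ e) (inj₁ x) h = G.~-sym (spoke x e h)

-- Triangles as ordered triples

length-filter : {A : Set} {P : A → Set} (P? : Decidable P) (xs : List A) → length (filter P? xs) ≡ # λ i → does (P? (lookup xs i))
length-filter P? [] = refl
length-filter P? (x ∷ xs) with does (P? x)
... | true  = cong suc (length-filter P? xs)
... | false = length-filter P? xs

length-filter-tabulate : {A : Set} {P : A → Set} (P? : Decidable P) {n : ℕ} (f : Fin n → A) →
  length (filter P? (tabulate f)) ≡ # λ i → does (P? (f i))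
length-filter-tabulate P? {zero}  f = refl
length-filter-tabulate P? {suc n} f with does (P? (f zero))
... | true  = cong suc (length-filter-tabulate P? (f ∘ suc))
... | false = length-filter-tabulate P? (f ∘ suc)

length-filter-map : {A B : Set} {P : B → Set} (P? : Decidable P) (h : A → B) (xs : List A) →
  length (filter P? (map h xs)) ≡ length (filter (λ x → P? (h x)) xs)
length-filter-map P? h [] = refl
length-filter-map P? h (x ∷ xs) with does (P? (h x))
... | true  = cong suc (length-filter-map P? h xs)
... | false = length-filter-map P? h xs

length-filter-product : {A B : Set} {P : A × B → Set} (P? : Decidable P) {n : ℕ} (f : Fin n → A) (ys : List B) →
  length (filter P? (cartesianProduct (tabulate f) ys)) ≡ sum λ i → length (filter (λ y → P? (f i , y)) ys)
length-filter-product P? {zero}  f ys = refl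
length-filter-product P? {suc n} f ys =
  trans (cong length (filter-++ P? (map (f zero ,_) ys) _))
  (trans (length-++ (filter P? (map (f zero ,_) ys)))
  (cong₂ _+_ (length-filter-map P? (f zero ,_) ys) (length-filter-product P? (f ∘ suc) ys)))

increasing : ∀ {n} → Graph n → Fin n → Fin n → Fin n → ℕ
increasing G u v w = 𝟙 (does (isTriangle? G (u , v , w)))

triangles-∑³ : ∀ {n} (G : Graph n) → length (triangles G) ≡ ∑³ (increasing G)
triangles-∑³ {n} G = trans (length-filter-product (isTriangle? G) id (cartesianProduct (allFin n) (allFin n)))
  (sum-cong-≗ λ u → trans (length-filter-product (λ y → isTriangle? G (u , y)) id (allFin n))
    (sum-cong-≗ λ v → length-filter-tabulate (λ w → isTriangle? G (u , v , w)) id))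

adjacency-sym : ∀ {n} (G : Graph n) → Symᵇ (adjacency G)
adjacency-sym G x y e = does-intro (Graph._~?_ G y x) (Graph.~-sym G (does-true {d = Graph._~?_ G x y} e))

adjacency-irr : ∀ {n} (G : Graph n) → Irrᵇ (adjacency G)
adjacency-irr G x with Graph._~?_ G x x
... | yes e = ⊥-elim (Graph.~-irr G e)
... | no _  = refl

private
  lt : ∀ {n} → Fin n → Fin n → Bool
  lt u v = does (u <ᶠ? v)

  lt-asym : ∀ {n} (u v : Fin n) → lt u v ≡ true → lt v u ≡ true → ⊥
  lt-asym u v a b = <ᶠ-asym (does-true {d = u <ᶠ? v} a) (does-true {d = v <ᶠ? u} b)

  lt-cyc : ∀ {n} (u v w : Fin n) → lt u v ≡ true → lt v w ≡ true → lt w u ≡ true → ⊥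
  lt-cyc u v w a b c = <ᶠ-irrefl refl
    (<ᶠ-trans (does-true {d = u <ᶠ? v} a) (<ᶠ-trans (does-true {d = v <ᶠ? w} b) (does-true {d = w <ᶠ? u} c)))

  -- A truth table with x, y, z for a < b, b < c, a < c and the primed letters for the reversed
  -- comparisons. The five hypotheses remove every row that admits a contradiction in the order.
  one-order : ∀ x x′ y y′ z z′ → (x ≡ true → x′ ≡ true → ⊥) → (y ≡ true → y′ ≡ true → ⊥) → (z ≡ true → z′ ≡ true → ⊥) →
    (x ≡ true → y ≡ true → z′ ≡ true → ⊥) → (x′ ≡ true → y′ ≡ true → z ≡ true → ⊥) →
    𝟙 (x ∧ y) + (𝟙 (y ∧ z′) + (𝟙 (z′ ∧ x) + (𝟙 (x′ ∧ z) + (𝟙 (y′ ∧ x′) + 𝟙 (z ∧ y′))))) ≤ 1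
  one-order true  true  _     _     _     _     p _ _ _ _ = ⊥-elim (p refl refl)
  one-order _     _     true  true  _     _     _ p _ _ _ = ⊥-elim (p refl refl)
  one-order _     _     _     _     true  true  _ _ p _ _ = ⊥-elim (p refl refl)
  one-order true  _     true  _     _     true  _ _ _ p _ = ⊥-elim (p refl refl refl)
  one-order _     true  _     true  true  _     _ _ _ _ p = ⊥-elim (p refl refl refl)
  one-order true  false true  false true  false _ _ _ _ _ = s≤s z≤n
  one-order true  false true  false false false _ _ _ _ _ = s≤s z≤n
  one-order true  false false true  true  false _ _ _ _ _ = s≤s z≤n
  one-order true  false false true  false true  _ _ _ _ _ = s≤s z≤n
  one-order true  false false true  false false _ _ _ _ _ = z≤n
  one-order true  false false false true  false _ _ _ _ _ = z≤n
  one-order true  false false false false true  _ _ _ _ _ = s≤s z≤n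
  one-order true  false false false false false _ _ _ _ _ = z≤n
  one-order false true  true  false true  false _ _ _ _ _ = s≤s z≤n
  one-order false true  true  false false true  _ _ _ _ _ = s≤s z≤n
  one-order false true  true  false false false _ _ _ _ _ = z≤n
  one-order false true  false true  false true  _ _ _ _ _ = s≤s z≤n
  one-order false true  false true  false false _ _ _ _ _ = s≤s z≤n
  one-order false true  false false true  false _ _ _ _ _ = s≤s z≤n
  one-order false true  false false false true  _ _ _ _ _ = z≤n
  one-order false true  false false false false _ _ _ _ _ = z≤n
  one-order false false true  false true  false _ _ _ _ _ = z≤n
  one-order false false true  false false true  _ _ _ _ _ = s≤s z≤n
  one-order false false true  false false false _ _ _ _ _ = z≤n
  one-order false false false true  true  false _ _ _ _ _ = s≤s z≤n
  one-order false false false true  false true  _ _ _ _ _ = z≤n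
  one-order false false false true  false false _ _ _ _ _ = z≤n
  one-order false false false false true  false _ _ _ _ _ = z≤n
  one-order false false false false false true  _ _ _ _ _ = z≤n
  one-order false false false false false false _ _ _ _ _ = z≤n

-- Each triangle is listed once in increasing order and six times as an ordered triple.
six-triangles : ∀ {n} (G : Graph n) → 6 * length (triangles G) ≤ ∑³ λ a b c → 𝟙 (clique (adjacency G) a b c)
six-triangles {n} G = begin
  6 * length (triangles G)  ≡⟨ cong (6 *_) (triangles-∑³ G) ⟩
  6 * ∑³ (increasing G)  ≤⟨ *-monoʳ-≤ 6 (∑³-mono T≤U) ⟩
  6 * ∑³ U  ≡⟨ cong (λ k → ∑³ U + (∑³ U + (∑³ U + (∑³ U + (∑³ U + k))))) (+-identityʳ (∑³ U)) ⟩
  ∑³ U + (∑³ U + (∑³ U + (∑³ U + (∑³ U + ∑³ U))))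
    ≡⟨ sym (trans (∑³-+ U _) (cong (∑³ U +_) (trans (∑³-+ (λ a b c → U b c a) _) (cong₂ _+_ (∑³-cyc U)
         (trans (∑³-+ (λ a b c → U c a b) _) (cong₂ _+_ cyc₂ (trans (∑³-+ V _) (cong₂ _+_ (∑³-swap U)
         (trans (∑³-+ (λ a b c → V b c a) (λ a b c → V c a b)) (cong₂ _+_ (trans (∑³-cyc V) (∑³-swap U)) (trans cyc₃ (∑³-swap U)))))))))))) ⟩
  ∑³ (λ a b c → U a b c + (U b c a + (U c a b + (V a b c + (V b c a + V c a b)))))
    ≤⟨ ∑³-mono pt ⟩
  ∑³ (λ a b c → 𝟙 (C a b c)) ∎
  where
  open ≤-Reasoning
  A = adjacency G
  C = clique A
  U V : Fin n → Fin n → Fin n → ℕ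
  U a b c = 𝟙 (lt a b ∧ lt b c) * 𝟙 (C a b c)
  V a b c = U b a c
  cyc₂ : ∑³ (λ a b c → U c a b) ≡ ∑³ U
  cyc₂ = trans (∑³-cyc (λ a b c → U b c a)) (∑³-cyc U)
  cyc₃ : ∑³ (λ a b c → V c a b) ≡ ∑³ V
  cyc₃ = trans (∑³-cyc (λ a b c → V b c a)) (∑³-cyc V)
  T≤U : ∀ a b c → increasing G a b c ≤ U a b c
  T≤U a b c = ≤-trans (𝟙-mono {b = (lt a b ∧ lt b c) ∧ C a b c} λ e →
    let o , p = ∧-true {lt a b ∧ lt b c} e ; ab , q = ∧-true {A a b} p ; bc , ac = ∧-true {A b c} q
    in ∧-intro o (∧-intro ab (∧-intro bc (adjacency-sym G a c ac)))) (≤-reflexive (𝟙-∧ (lt a b ∧ lt b c) (C a b c)))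
  turn : ∀ a b c → C a b c ≡ true → C b c a ≡ true
  turn a b c e = let ab , p = ∧-true {A a b} e ; bc , ca = ∧-true {A b c} p in ∧-intro bc (∧-intro ca ab)
  flip : ∀ a b c → C a b c ≡ true → C b a c ≡ true
  flip a b c e = let ab , p = ∧-true {A a b} e ; bc , ca = ∧-true {A b c} p in
    ∧-intro (adjacency-sym G a b ab) (∧-intro (adjacency-sym G c a ca) (adjacency-sym G b c bc))
  turn≡ : ∀ a b c → C b c a ≡ C a b c
  turn≡ a b c = bool-ext (λ e → turn c a b (turn b c a e)) (turn a b c)
  flip≡ : ∀ a b c → C b a c ≡ C a b c
  flip≡ a b c = bool-ext (flip b a c) (flip a b c)
  pt : ∀ a b c → U a b c + (U b c a + (U c a b + (V a b c + (V b c a + V c a b)))) ≤ 𝟙 (C a b c)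
  pt a b c rewrite turn≡ a b c | trans (turn≡ b c a) (turn≡ a b c) | flip≡ a b c
                 | trans (flip≡ b c a) (turn≡ a b c) | trans (flip≡ c a b) (trans (turn≡ b c a) (turn≡ a b c)) = begin
    o₁ * k + (o₂ * k + (o₃ * k + (o₄ * k + (o₅ * k + o₆ * k))))
      ≡⟨ factor o₁ o₂ o₃ o₄ o₅ o₆ k ⟩
    (o₁ + (o₂ + (o₃ + (o₄ + (o₅ + o₆))))) * k
      ≤⟨ *-monoˡ-≤ k (one-order (lt a b) (lt b a) (lt b c) (lt c b) (lt a c) (lt c a)
           (lt-asym a b) (lt-asym b c) (lt-asym a c) (lt-cyc a b c) (λ p q r → lt-cyc b a c p r q)) ⟩
    1 * k
      ≡⟨ +-identityʳ k ⟩
    k ∎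
    where
    k  = 𝟙 (C a b c)
    o₁ = 𝟙 (lt a b ∧ lt b c)
    o₂ = 𝟙 (lt b c ∧ lt c a)
    o₃ = 𝟙 (lt c a ∧ lt a b)
    o₄ = 𝟙 (lt b a ∧ lt a c)
    o₅ = 𝟙 (lt c b ∧ lt b a)
    o₆ = 𝟙 (lt a c ∧ lt c b)
    factor : ∀ p q r s t u k → p * k + (q * k + (r * k + (s * k + (t * k + u * k)))) ≡ (p + (q + (r + (s + (t + u))))) * k
    factor = solve-∀

-- The lower bound

sum-split : ∀ m {n} (f : Fin (m + n) → ℕ) → sum f ≡ sum (λ i → f (i ↑ˡ n)) + sum (λ j → f (m ↑ʳ j))
sum-split zero    f = refl
sum-split (suc m) f = trans (cong (f zero +_) (sum-split m (f ∘ suc))) (sym (+-assoc (f zero) _ _))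

sum-left : ∀ m {n} (f : Fin (m + n) → ℕ) → sum (λ i → f (i ↑ˡ n)) ≤ sum f
sum-left m f = ≤-trans (m≤m+n _ _) (≤-reflexive (sym (sum-split m f)))

sum-right : ∀ m {n} (f : Fin (m + n) → ℕ) → sum (λ j → f (m ↑ʳ j)) ≤ sum f
sum-right m f = ≤-trans (m≤n+m _ _) (≤-reflexive (sym (sum-split m f)))

const≤sum : ∀ {n} {f : Fin n → ℕ} {c} → (∀ x → c ≤ f x) → n * c ≤ sum f
const≤sum {zero}  h = z≤n
const≤sum {suc n} h = +-mono-≤ (h zero) (const≤sum (h ∘ suc))

isLeft : {A B : Set} → A ⊎ B → Bool
isLeft (inj₁ _) = true
isLeft (inj₂ _) = false

hub : ∀ t {k} → Fin (t + k) → Bool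
hub t u = isLeft (splitAt t u)

#-hub : ∀ t k → # (hub t {k}) ≤ t
#-hub t k = begin
  # (hub t {k})  ≡⟨ sum-split t {k} (𝟙 ∘ hub t {k}) ⟩
  # {t} (λ i → hub t {k} (i ↑ˡ k)) + # {k} (λ j → hub t {k} (t ↑ʳ j))  ≤⟨ +-mono-≤ (#≤n λ i → hub t {k} (i ↑ˡ k)) (≤-reflexive (#-none {p = λ j → hub t {k} (t ↑ʳ j)} λ j → cong isLeft (splitAt-↑ʳ t k j))) ⟩
  t + 0  ≡⟨ +-identityʳ t ⟩
  t  ∎
  where open ≤-Reasoning

module _ {t} (H : Graph t) (M : ℕ) where

  hub-triangle : ∀ a b c → let open Graph (H ∨ᴳ balancedBipartite M) in a ~ b → b ~ c → a ~ c →
    hub t a ≡ true ⊎ hub t b ≡ true ⊎ hub t c ≡ true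
  hub-triangle a b c = go (splitAt t a) (splitAt t b) (splitAt t c)
    where
    _⌢_ : (x y : Fin t ⊎ Fin (⌊ M /2⌋ + ⌈ M /2⌉)) → Set
    _⌢_ = JoinAdj H (balancedBipartite M)
    bip : ∀ (x y z : Fin ⌊ M /2⌋ ⊎ Fin ⌈ M /2⌉) → let K = JoinAdj (edgeless ⌊ M /2⌋) (edgeless ⌈ M /2⌉) in K x y → K y z → K x z → ⊥
    bip (inj₁ _) (inj₁ _) _ ()
    bip (inj₂ _) (inj₂ _) _ ()
    bip (inj₁ _) (inj₂ _) (inj₁ _) _ _ ()
    bip (inj₁ _) (inj₂ _) (inj₂ _) _ ()
    bip (inj₂ _) (inj₁ _) (inj₁ _) _ ()
    bip (inj₂ _) (inj₁ _) (inj₂ _) _ _ ()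
    go : ∀ x y z → x ⌢ y → y ⌢ z → x ⌢ z → isLeft x ≡ true ⊎ isLeft y ≡ true ⊎ isLeft z ≡ true
    go (inj₁ _) _ _ _ _ _ = inj₁ refl
    go (inj₂ _) (inj₁ _) _ _ _ _ = inj₂ (inj₁ refl)
    go (inj₂ _) (inj₂ _) (inj₁ _) _ _ _ = inj₂ (inj₂ refl)
    go (inj₂ x) (inj₂ y) (inj₂ z) p q r =
      ⊥-elim (bip (splitAt ⌊ M /2⌋ x) (splitAt ⌊ M /2⌋ y) (splitAt ⌊ M /2⌋ z) p q r)

-- Unlike S n t, the tripartite graph has no edges inside the first block, which makes it F▵-free
-- while it loses only O(n) triangles.
tripartite : ∀ n t → Graph (t + (⌊ n ∸ t /2⌋ + ⌈ n ∸ t /2⌉))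
tripartite n t = edgeless t ∨ᴳ balancedBipartite (n ∸ t)

module _ (n t : ℕ) where
  private
    N = t + (⌊ n ∸ t /2⌋ + ⌈ n ∸ t /2⌉)
    L : Fin N → Bool
    L = hub t
    module S = Graph (S n t)
    module R = Graph (tripartite n t)

    thin : ∀ {u v} → L u ∧ L v ≡ false → u S.~ v → u R.~ v
    thin {u} {v} h e with splitAt t u | splitAt t v
    thin () e | inj₁ _ | inj₁ _
    thin h  e | inj₁ _ | inj₂ _ = tt
    thin h  e | inj₂ _ | inj₁ _ = tt
    thin h  e | inj₂ _ | inj₂ _ = e

  -- A triangle lost by removing the edges inside the first block has two vertices there; the factor
  -- 3 is the position of that pair.
  Sbi-≤ : length (Sbi n t) ≤ length (triangles (tripartite n t)) + 3 * (t * t) * N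
  Sbi-≤ = begin
    length (Sbi n t)  ≡⟨ triangles-∑³ (S n t) ⟩
    ∑³ (increasing (S n t))  ≤⟨ ∑³-mono pt ⟩
    ∑³ (λ u v w → increasing (tripartite n t) u v w + (Q u v w + (Q v w u + Q w u v)))
      ≡⟨ trans (∑³-+ (increasing (tripartite n t)) _) (cong₂ _+_ (sym (triangles-∑³ (tripartite n t)))
           (trans (∑³-+ Q _) (cong (∑³ Q +_) (trans (∑³-+ (λ u v w → Q v w u) (λ u v w → Q w u v))
             (cong₂ _+_ (∑³-cyc Q) (trans (∑³-cyc (λ u v w → Q v w u)) (∑³-cyc Q))))))) ⟩
    length (triangles (tripartite n t)) + (∑³ Q + (∑³ Q + ∑³ Q)) ≤⟨ +-monoʳ-≤ (length (triangles (tripartite n t))) (+-mono-≤ {∑³ Q} Q≤ (+-mono-≤ {∑³ Q} Q≤ Q≤)) ⟩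
    length (triangles (tripartite n t)) + (t * t * N + (t * t * N + t * t * N))
      ≡⟨ cong (length (triangles (tripartite n t)) +_) (trans (cong (t * t * N +_) (cong (t * t * N +_) (sym (+-identityʳ _)))) (sym (*-assoc 3 (t * t) N))) ⟩
    length (triangles (tripartite n t)) + 3 * (t * t) * N  ∎
    where
    open ≤-Reasoning
    Q : Fin N → Fin N → Fin N → ℕ
    Q u v w = 𝟙 (L u ∧ L v)
    #L≤t : # L ≤ t
    #L≤t = #-hub t (⌊ n ∸ t /2⌋ + ⌈ n ∸ t /2⌉)
    Q≤ : ∑³ Q ≤ t * t * N
    Q≤ = begin
      ∑³ Q  ≤⟨ sum-mono (λ u → sum-mono λ v → sum-≤-const {N} {c = 𝟙 (L u ∧ L v)} λ _ → ≤-refl) ⟩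
      sum (λ u → sum λ v → N * 𝟙 (L u ∧ L v))  ≡⟨ sum-cong-≗ (λ u → sum-cong-≗ λ v → cong (N *_) (𝟙-∧ (L u) (L v))) ⟩
      sum (λ u → sum λ v → N * (𝟙 (L u) * 𝟙 (L v)))  ≡⟨ sum-cong-≗ (λ u → trans (sym (*-distribˡ-sum N (λ v → 𝟙 (L u) * 𝟙 (L v)))) (cong (N *_) (sym (*-distribˡ-sum (𝟙 (L u)) (𝟙 ∘ L))))) ⟩
      sum (λ u → N * (𝟙 (L u) * # L))  ≡⟨ trans (sym (*-distribˡ-sum N (λ u → 𝟙 (L u) * # L))) (cong (N *_) (sym (*-distribʳ-sum (# L) (𝟙 ∘ L)))) ⟩
      N * (# L * # L)  ≤⟨ *-monoʳ-≤ N (*-mono-≤ #L≤t #L≤t) ⟩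
      N * (t * t)  ≡⟨ *-comm N (t * t) ⟩
      t * t * N  ∎
    pt : ∀ u v w → increasing (S n t) u v w ≤ increasing (tripartite n t) u v w + (Q u v w + (Q v w u + Q w u v))
    pt u v w with true⊎false (L u ∧ L v) | true⊎false (L v ∧ L w) | true⊎false (L w ∧ L u)
    ... | inj₁ h | _ | _ rewrite h = ≤-trans (𝟙≤1 _) (≤-trans (m≤m+n 1 _) (m≤n+m _ (increasing (tripartite n t) u v w)))
    ... | _ | inj₁ h | _ rewrite h = ≤-trans (𝟙≤1 _) (≤-trans (≤-trans (m≤m+n 1 _) (m≤n+m _ (Q u v w))) (m≤n+m _ (increasing (tripartite n t) u v w)))
    ... | _ | _ | inj₁ h rewrite h = ≤-trans (𝟙≤1 _) (≤-trans (≤-trans (m≤n+m 1 (Q v w u)) (m≤n+m _ (Q u v w))) (m≤n+m _ (increasing (tripartite n t) u v w)))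
    ... | inj₂ a | inj₂ b | inj₂ c = ≤-trans (𝟙-mono λ e →
      let o , uv , vw , uw = does-true {d = isTriangle? (S n t) (u , v , w)} e
      in does-intro (isTriangle? (tripartite n t) (u , v , w))
           (o , thin a uv , thin b vw , R.~-sym {w} {u} (thin c (S.~-sym {u} {w} uw)))) (m≤m+n _ _)

  -- One vertex from each of the three blocks, which are numbered consecutively, so these triples
  -- are already increasing.
  ≤-Sbi : t * (⌊ n ∸ t /2⌋ * ⌈ n ∸ t /2⌉) ≤ length (Sbi n t)
  ≤-Sbi = begin
    t * (p * q)
      ≤⟨ const≤sum {t} (λ i → const≤sum {p} λ j → ≤-trans (≤-reflexive (sym (*-identityʳ q))) (const≤sum {q} λ k → one i j k)) ⟩
    sum {t} (λ i → sum {p} λ j → sum {q} λ k → T (a i) (b j) (c k))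
      ≤⟨ sum-mono {t} (λ i → sum-mono {p} λ j → ≤-trans (sum-right p {q} λ x → T (a i) (b j) (t ↑ʳ x)) (sum-right t {p + q} (T (a i) (b j)))) ⟩
    sum {t} (λ i → sum {p} λ j → sum (T (a i) (b j)))
      ≤⟨ sum-mono {t} (λ i → ≤-trans (sum-left p {q} λ x → sum (T (a i) (t ↑ʳ x))) (sum-right t {p + q} λ v → sum (T (a i) v))) ⟩
    sum {t} (λ i → sum {N} λ v → sum (T (a i) v))
      ≤⟨ sum-left t {p + q} (λ u → sum {N} λ v → sum (T u v)) ⟩
    ∑³ T
      ≡⟨ sym (triangles-∑³ (S n t)) ⟩
    length (Sbi n t) ∎
    where
    open ≤-Reasoning
    p = ⌊ n ∸ t /2⌋
    q = ⌈ n ∸ t /2⌉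
    T = increasing (S n t)
    a : Fin t → Fin N
    a i = i ↑ˡ (p + q)
    b : Fin p → Fin N
    b j = t ↑ʳ (j ↑ˡ q)
    c : Fin q → Fin N
    c k = t ↑ʳ (p ↑ʳ k)
    one : ∀ i j k → 1 ≤ increasing (S n t) (i ↑ˡ (p + q)) (t ↑ʳ (j ↑ˡ q)) (t ↑ʳ (p ↑ʳ k))
    one i j k = ≤-reflexive (sym (cong 𝟙 (does-intro (isTriangle? (S n t) _) ((uv< , vw<) , uv , vw , uw))))
      where
      below : ∀ {a b} (x : Fin a) (y : Fin b) → x ↑ˡ b <ᶠ a ↑ʳ y
      below {a} {b} x y = subst₂ _<_ (sym (toℕ-↑ˡ x b)) (sym (toℕ-↑ʳ a y)) (<-≤-trans (toℕ<n x) (m≤m+n a _))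
      uv< = below i (j ↑ˡ q)
      vw< : t ↑ʳ (j ↑ˡ q) <ᶠ t ↑ʳ (p ↑ʳ k)
      vw< = subst₂ _<_ (sym (toℕ-↑ʳ t _)) (sym (toℕ-↑ʳ t _)) (+-monoʳ-< t (below j k))
      uv : (i ↑ˡ (p + q)) S.~ (t ↑ʳ (j ↑ˡ q))
      uv rewrite splitAt-↑ˡ t i (p + q) | splitAt-↑ʳ t (p + q) (j ↑ˡ q) = tt
      uw : (i ↑ˡ (p + q)) S.~ (t ↑ʳ (p ↑ʳ k))
      uw rewrite splitAt-↑ˡ t i (p + q) | splitAt-↑ʳ t (p + q) (p ↑ʳ k) = tt
      vw : (t ↑ʳ (j ↑ˡ q)) S.~ (t ↑ʳ (p ↑ʳ k))
      vw rewrite splitAt-↑ʳ t (p + q) (j ↑ˡ q) | splitAt-↑ʳ t (p + q) (p ↑ʳ k) | splitAt-↑ˡ p j q | splitAt-↑ʳ p q k = tt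

Sbi-0 : ∀ n → length (Sbi n 0) ≡ 0
Sbi-0 n = trans (triangles-∑³ (S n 0)) (sum-zero λ u → sum-zero λ v → sum-zero λ w → none u v w)
  where
  none : ∀ u v w → increasing (S n 0) u v w ≡ 0
  none u v w with true⊎false (does (isTriangle? (S n 0) (u , v , w)))
  ... | inj₂ e = cong 𝟙 e
  ... | inj₁ e with does-true {d = isTriangle? (S n 0) (u , v , w)} e
  ...   | _ , uv , vw , uw with hub-triangle (complete 0) (n ∸ 0) u v w uv vw uw
  ...   | inj₁ ()
  ...   | inj₂ (inj₁ ())
  ...   | inj₂ (inj₂ ())

∣tabulate∣ : ∀ {n} (p : Fin n → Bool) → ∣ tabulateᵛ p ∣ ≡ # p
∣tabulate∣ {zero}  p = refl
∣tabulate∣ {suc n} p with p zero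
... | true  = cong suc (∣tabulate∣ (p ∘ suc))
... | false = ∣tabulate∣ (p ∘ suc)

∈-tabulateᵛ⁻ : ∀ {n} (p : Fin n → Bool) {u} → u ∈ˢ tabulateᵛ p → p u ≡ true
∈-tabulateᵛ⁻ p {u} h = trans (sym (lookup∘tabulate p u)) ([]=⇒lookup h)

∈-tabulateᵛ⁺ : ∀ {n} (p : Fin n → Bool) {u} → p u ≡ true → u ∈ˢ tabulateᵛ p
∈-tabulateᵛ⁺ p {u} h = lookup⇒[]= u _ (trans (lookup∘tabulate p u) h)

-- Let I be the set of vertices of F sent to the first block, which is independent. An edge off I
-- spans a triangle that must meet the first block, so its new vertex lies there. By injectivity |I|
-- + |F - I| ≤ t, against t < σ F.
tripartite-free : ∀ {v} (F : Graph v) n → ∀ t → t < σ F → Free (F ▵) (tripartite n t)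
tripartite-free {v} F n t t<σ (f , inj , hom) = <-irrefl refl (<-≤-trans t<σ (≤-trans (σ-lower F I ind) small))
  where
  module F = Graph F
  k = length (edges F)
  p : Fin (v + k) → Bool
  p x = hub t (f x)
  I : Subset v
  I = tabulateᵛ λ u → p (u ↑ˡ k)
  apart : ∀ x y → Graph._~_ (tripartite n t) x y → hub t x ≡ true → hub t y ≡ true → ⊥
  apart x y e a b with splitAt t x | splitAt t y
  ... | inj₁ _ | inj₁ _ = e
  apart x y e a () | inj₁ _ | inj₂ _
  apart x y e () b | inj₂ _ | _
  old : ∀ {u u′} → u F.~ u′ → Graph._~_ (F ▵) (u ↑ˡ k) (u′ ↑ˡ k)
  old {u} {u′} e rewrite splitAt-↑ˡ v u k | splitAt-↑ˡ v u′ k = e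
  new : ∀ {u e} → Incident F u e → Graph._~_ (F ▵) (u ↑ˡ k) (v ↑ʳ e)
  new {u} {e} h rewrite splitAt-↑ˡ v u k | splitAt-↑ʳ v k e = h
  ind : Independent F I
  ind u u′ u∈ u′∈ e = apart _ _ (hom _ _ (old e)) (∈-tabulateᵛ⁻ (λ u → p (u ↑ˡ k)) u∈) (∈-tabulateᵛ⁻ (λ u → p (u ↑ˡ k)) u′∈)
  off : ∀ e → does (¬? (proj₁ (lookup (edges F) e) ∈? I) ×-dec ¬? (proj₂ (lookup (edges F) e) ∈? I)) ≡ true → p (v ↑ʳ e) ≡ true
  off e h with does-true {d = ¬? (proj₁ (lookup (edges F) e) ∈? I) ×-dec ¬? (proj₂ (lookup (edges F) e) ∈? I)} h
  ... | x∉ , y∉ with hub-triangle (edgeless t) (n ∸ t) _ _ _ (hom _ _ (old (proj₂ (ends F e)))) (hom _ _ (new (inj₂ refl))) (hom _ _ (new {e = e} (inj₁ refl)))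
  ...   | inj₁ q = contradiction (∈-tabulateᵛ⁺ (λ u → p (u ↑ˡ k)) q) x∉
  ...   | inj₂ (inj₁ q) = contradiction (∈-tabulateᵛ⁺ (λ u → p (u ↑ˡ k)) q) y∉
  ...   | inj₂ (inj₂ q) = q
  open ≤-Reasoning
  small : crosscutSize F I ≤ t
  small = begin
    ∣ I ∣ + length (edgesOff F I)  ≡⟨ cong₂ _+_ (∣tabulate∣ (λ u → p (u ↑ˡ k))) (length-filter _ (edges F)) ⟩
    # (λ u → p (u ↑ˡ k)) + # (λ e → does (¬? (proj₁ (lookup (edges F) e) ∈? I) ×-dec ¬? (proj₂ (lookup (edges F) e) ∈? I)))
                                                            ≤⟨ +-monoʳ-≤ _ (#-mono off) ⟩
    # (λ u → p (u ↑ˡ k)) + # (λ e → p (v ↑ʳ e))  ≡⟨ sym (sum-split v (𝟙 ∘ p)) ⟩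
    # p  ≤⟨ #-injective f (λ i j → inj) (hub t) ⟩
    # (hub t)  ≤⟨ #-hub t _ ⟩
    t  ∎

-- An empty crosscut can be replaced by an end of any edge.
optimal : ∀ {v} (F : Graph v) {x y} (e : Graph._~_ F x y) → (x , y) ∈ edges F →
  ∃ λ I → Independent F I × (∃ λ r → r ∈ˢ I) × crosscutSize F I ≤ σ F
optimal F {x} {y} e xy∈ with σ-attained F
... | I , ind , eq with nonempty? I
...   | yes ne = I , ind , ne , ≤-reflexive (sym eq)
...   | no empty = ⁅ x ⁆ , ind′ , (x , x∈⁅x⁆ x) , (begin
    ∣ ⁅ x ⁆ ∣ + length (edgesOff F ⁅ x ⁆)  ≡⟨ cong (_+ length (edgesOff F ⁅ x ⁆)) (∣⁅x⁆∣≡1 x) ⟩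
    suc (length (edgesOff F ⁅ x ⁆))  ≤⟨ filter-notAll _ (edges F) (lose xy∈ λ h → proj₁ h (x∈⁅x⁆ x)) ⟩
    length (edges F)  ≡⟨ cong length (sym (filter-all (λ (a , b) → ¬? (a ∈? I) ×-dec ¬? (b ∈? I)) (All.tabulate {xs = edges F} λ {_} _ → (λ a∈ → empty (_ , a∈)) , (λ b∈ → empty (_ , b∈))))) ⟩
    length (edgesOff F I)  ≤⟨ m≤n+m _ ∣ I ∣ ⟩
    crosscutSize F I  ≡⟨ sym eq ⟩
    σ F  ∎)
    where
    open ≤-Reasoning
    ind′ : Independent F ⁅ x ⁆
    ind′ a b a∈ b∈ ab with x∈⁅y⁆⇒x≡y x a∈ | x∈⁅y⁆⇒x≡y x b∈
    ... | refl | refl = Graph.~-irr F ab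

-- The theorem

-- The maximum defining `ex` is attained by a free graph or equals its seed 0, hence the hypothesis
-- `Q 0`.
ex-elim : ∀ {h n} (H : Graph h) (Q : ℕ → Set) → Q 0 →
  (∀ (G : Graph n) → Free H G → Q (length (triangles G))) → Q (ex n H)
ex-elim {n = n} H Q q₀ q with argmax-sel (λ m → m) 0 (map (length ∘ triangles) (filter (free? H) (allGraphs n)))
... | inj₁ eq = subst Q (sym eq) q₀
... | inj₂ c∈ with ∈-map⁻ (length ∘ triangles) c∈
...   | G , G∈ , eq = subst Q (sym eq) (q G (proj₂ (∈-filter⁻ (free? H) {xs = allGraphs n} G∈)))

-- Trees without edges

module _ {v} (F : Graph v) (T : IsTree F) (none : edges F ≡ []) where
  private
    open Graph F

    no-edge : ∀ x y → ¬ (x ~ y)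
    no-edge x y e with <ᶠ-cmp x y
    ... | tri< l _ _ with () ← subst (_ ∈_) none (edge-∈ F l e)
    ... | tri≈ _ refl _ = ~-irr e
    ... | tri> _ _ l with () ← subst (_ ∈_) none (edge-∈ F l (~-sym e))

    no-Edge : Edge F → ⊥
    no-Edge e with () ← subst (λ xs → Fin (length xs)) none e

    one-vertex : ∀ x y → x ≡ y
    one-vertex x y with IsTree.connected T x y
    ... | ε     = refl
    ... | e ◅ _ = ⊥-elim (no-edge _ _ e)

  edgeless-copy : ∀ {n} (G : Graph (suc n)) → ∃ λ f → IsCopy (F ▵) G f
  edgeless-copy G = (λ _ → zero) , (λ {x} {y} _ → inj x y) , λ x y e → ⊥-elim (none′ (splitAt v x) (splitAt v y) e)
    where
    same : ∀ s s′ → s ≡ s′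
    same (inj₁ x) (inj₁ y) = cong inj₁ (one-vertex x y)
    same (inj₂ e) _        = ⊥-elim (no-Edge e)
    same _        (inj₂ e) = ⊥-elim (no-Edge e)
    inj : ∀ x y → x ≡ y
    inj x y = trans (sym (join-splitAt v _ x)) (trans (cong (join v _) (same (splitAt v x) (splitAt v y))) (join-splitAt v _ y))
    none′ : ∀ s s′ → ¬ BlowupAdj F s s′
    none′ (inj₁ x) (inj₁ y) e = no-edge x y e
    none′ (inj₁ x) (inj₂ e) _ = no-Edge e
    none′ (inj₂ e) _        _ = no-Edge e

  σ-edgeless : σ F ≡ 0
  σ-edgeless = n≤0⇒n≡0 (≤-trans (σ-lower F ∅ λ _ _ x∈ _ _ → ∉⊥ x∈)
    (≤-reflexive (cong₂ _+_ (∣⊥∣≡0 v) (cong (λ es → length (filter _ es)) none))))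

∈-edges : ∀ {v} (F : Graph v) {x y} → (x , y) ∈ edges F → Graph._~_ F x y
∈-edges {v} F h = proj₂ (proj₂ (∈-filter⁻ (λ (x , y) → (x <ᶠ? y) ×-dec (Graph._~?_ F x y)) {xs = cartesianProduct (allFin v) (allFin v)} h))

-- From the counts to the asymptotic statement

near-halves : ∀ n → ⌈ n /2⌉ ≡ ⌊ n /2⌋ ⊎ ⌈ n /2⌉ ≡ suc ⌊ n /2⌋
near-halves zero          = inj₁ refl
near-halves (suc zero)    = inj₂ refl
near-halves (suc (suc n)) with near-halves n
... | inj₁ q = inj₁ (cong suc q)
... | inj₂ q = inj₂ (cong suc q)

-- The summand 1 is for odd n - t, where four times the product of the halves is (n - t)² - 1.
square-≤ : ∀ n t → t ≤ n → n * n ≤ 4 * (⌊ n ∸ t /2⌋ * ⌈ n ∸ t /2⌉) + (1 + 2 * t * n + t * t)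
square-≤ n t t≤n = begin
  n * n  ≡⟨ cong (λ k → k * k) (sym n≡) ⟩
  (t + (x + y)) * (t + (x + y))  ≡⟨ expand t (x + y) ⟩
  (x + y) * (x + y) + (2 * t * (x + y) + t * t)  ≤⟨ +-mono-≤ balanced (+-monoˡ-≤ (t * t) (*-monoʳ-≤ (2 * t) (≤-trans (m≤n+m (x + y) t) (≤-reflexive n≡)))) ⟩
  4 * (x * y) + 1 + (2 * t * n + t * t)  ≡⟨ +-assoc (4 * (x * y)) 1 _ ⟩
  4 * (x * y) + (1 + (2 * t * n + t * t))  ∎
  where
  open ≤-Reasoning
  x = ⌊ n ∸ t /2⌋
  y = ⌈ n ∸ t /2⌉
  n≡ : t + (x + y) ≡ n
  n≡ = trans (cong (t +_) (⌊n/2⌋+⌈n/2⌉≡n (n ∸ t))) (m+[n∸m]≡n t≤n)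
  expand : ∀ t m → (t + m) * (t + m) ≡ m * m + (2 * t * m + t * t)
  expand = solve-∀
  even : ∀ x → (x + x) * (x + x) ≡ 4 * (x * x)
  even = solve-∀
  odd : ∀ x → (x + suc x) * (x + suc x) ≡ 4 * (x * suc x) + 1
  odd = solve-∀
  balanced : (x + y) * (x + y) ≤ 4 * (x * y) + 1
  balanced with near-halves (n ∸ t)
  ... | inj₁ q rewrite q = ≤-trans (≤-reflexive (even x)) (m≤m+n _ 1)
  ... | inj₂ q rewrite q = ≤-reflexive (odd x)

dist-≤ : ∀ c {x y z} → c * x ≤ c * y + z → c * y ≤ c * x + z → c * ∣ x - y ∣ ≤ z
dist-≤ c {x} {y} {z} h k = ≤-trans (≤-reflexive (*-distribˡ-∣-∣ c x y)) go
  where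
  go : ∣ c * x - c * y ∣ ≤ z
  go with ∣m-n∣≡[m∸n]∨[n∸m] (c * x) (c * y)
  ... | inj₁ q = ≤-trans (≤-reflexive q) (m≤n+o⇒m∸n≤o (c * x) (c * y) h)
  ... | inj₂ q = ≤-trans (≤-reflexive q) (m≤n+o⇒m∸n≤o (c * y) (c * x) k)

module _ (k a A A₀ : ℕ) where

  -- The sum of all coefficients of the lower order terms: for n ≥ 1 these terms are at most
  -- `lead * n`, and so at most n² once n ≥ `lead`.
  lead : ℕ
  lead = suc k * ((A + A₀) + 3 * a * (1 + 2 * a + a * a))

  absorb : ∀ n → 1 ≤ n → lead ≤ n → suc k * ((A * n + A₀) + 3 * a * (1 + 2 * a * n + a * a)) ≤ n * n
  absorb n@(suc j) _ h = begin
    suc k * ((A * n + A₀) + 3 * a * (1 + 2 * a * n + a * a))  ≤⟨ m≤m+n _ (suc k * (A₀ * j + 3 * a * (j + a * a * j))) ⟩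
    suc k * ((A * n + A₀) + 3 * a * (1 + 2 * a * n + a * a)) + suc k * (A₀ * j + 3 * a * (j + a * a * j))
                                                                          ≡⟨ eq k A A₀ a j ⟩
    lead * n  ≤⟨ *-monoˡ-≤ n h ⟩
    n * n  ∎
    where
    open ≤-Reasoning
    eq : ∀ k A A₀ a j → suc k * ((A * suc j + A₀) + 3 * a * (1 + 2 * a * suc j + a * a)) + suc k * (A₀ * j + 3 * a * (j + a * a * j))
       ≡ suc k * ((A + A₀) + 3 * a * (1 + 2 * a + a * a)) * suc j
    eq = solve-∀

  -- The factor 12 is 6 orders of a triangle times the 2 in front of `T`. It makes room for twelve
  -- error terms n², of which two arise: the lower order terms and the contribution of the high
  -- vertices.
  upper : ∀ l b {n T X Y Z q} → 1 ≤ n → lead ≤ n →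
    6 * X ≤ T → 2 * T ≤ 3 * a * (n * n) + (A * n + A₀) + l * (q * n) →
    suc b * (suc k * l * q) ≤ suc b * n →
    n * n ≤ 4 * Z + (1 + 2 * a * n + a * a) → a * Z ≤ Y →
    suc k * X ≤ suc k * Y + n * n
  upper l b {n} {T} {X} {Y} {Z} {q} n>0 big-n h₁ h₂ h₃ h₄ h₅ = *-cancelˡ-≤ 12 (begin
    12 * (suc k * X)  ≡⟨ e₁ k X ⟩
    suc k * (2 * (6 * X))  ≤⟨ *-monoʳ-≤ (suc k) (≤-trans (*-monoʳ-≤ 2 h₁) h₂) ⟩
    suc k * (3 * a * (n * n) + (A * n + A₀) + l * (q * n))
      ≤⟨ *-monoʳ-≤ (suc k) (+-monoˡ-≤ (l * (q * n)) (+-monoˡ-≤ (A * n + A₀) (*-monoʳ-≤ (3 * a) h₄))) ⟩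
    suc k * (3 * a * (4 * Z + (1 + 2 * a * n + a * a)) + (A * n + A₀) + l * (q * n))
      ≡⟨ e₂ k a A A₀ l n q Z ⟩
    12 * (suc k * (a * Z)) + suc k * ((A * n + A₀) + 3 * a * (1 + 2 * a * n + a * a)) + suc k * l * q * n
      ≤⟨ +-mono-≤ (+-mono-≤ (*-monoʳ-≤ 12 (*-monoʳ-≤ (suc k) h₅)) (absorb n n>0 big-n)) (*-monoˡ-≤ n (*-cancelˡ-≤ (suc b) h₃)) ⟩
    12 * (suc k * Y) + n * n + n * n
      ≤⟨ m≤m+n _ (10 * (n * n)) ⟩
    12 * (suc k * Y) + n * n + n * n + 10 * (n * n)
      ≡⟨ e₃ (suc k * Y) (n * n) ⟩
    12 * (suc k * Y + n * n) ∎)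
    where
    open ≤-Reasoning
    e₁ : ∀ k X → 12 * (suc k * X) ≡ suc k * (2 * (6 * X))
    e₁ = solve-∀
    e₂ : ∀ k a A A₀ l n q Z → suc k * (3 * a * (4 * Z + (1 + 2 * a * n + a * a)) + (A * n + A₀) + l * (q * n))
       ≡ 12 * (suc k * (a * Z)) + suc k * ((A * n + A₀) + 3 * a * (1 + 2 * a * n + a * a)) + suc k * l * q * n
    e₂ = solve-∀
    e₃ : ∀ y z → 12 * y + z + z + 10 * z ≡ 12 * (y + z)
    e₃ = solve-∀

-- `tripartite n t` has n vertices only up to a propositional equality, valid for t ≤ n, so the
-- estimate is made for its own vertex count first.
lower-bound : ∀ {v} (F : Graph v) n t → t < σ F → t ≤ n → length (Sbi n t) ≤ ex n (F ▵) + 3 * (t * t) * n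
lower-bound F n t t<σ t≤n = begin
  length (Sbi n t)  ≤⟨ Sbi-≤ n t ⟩
  length (triangles (tripartite n t)) + 3 * (t * t) * N  ≤⟨ +-monoˡ-≤ (3 * (t * t) * N) (ex-upper (F ▵) (tripartite n t) (tripartite-free F n t t<σ)) ⟩
  ex N (F ▵) + 3 * (t * t) * N  ≡⟨ cong (λ j → ex j (F ▵) + 3 * (t * t) * j) N≡ ⟩
  ex n (F ▵) + 3 * (t * t) * n  ∎
  where
  open ≤-Reasoning
  N = t + (⌊ n ∸ t /2⌋ + ⌈ n ∸ t /2⌉)
  N≡ : N ≡ n
  N≡ = trans (cong (t +_) (⌊n/2⌋+⌈n/2⌉≡n (n ∸ t))) (m+[n∸m]≡n t≤n)

-- `A` and `A₀` are chosen before n and `G`. The bound on the number of big edges is written as a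
-- successor so that it can be cancelled.
tree-few : ∀ {v} (F : Graph v) {r m} (R : Rooting F r m) I → Independent F I → r ∈ˢ I → ∀ a → crosscutSize F I ≤ suc a →
  ∀ D → ∃₂ λ A A₀ → ∀ {n} (G : Graph n) → Free (F ▵) G → ∃ λ q →
    D * q ≤ suc (pred (2 * suc (2 * m * 1))) * n
    × 2 * ∑³ (λ x y z → 𝟙 (clique (adjacency G) x y z)) ≤ 3 * a * (n * n) + (A * n + A₀) + slope m * (q * n)
tree-few F {r} {m} R I ind r∈I a I≤ D = linear , constant , λ G free →
  few-triangles (adjacency G) (adjacency-sym G) (adjacency-irr G) (Partial.tree P) (λ B → free (blowup-copy F R G B))
    D col (colour-indep F P I ind) a budget col-root
  where
  P = proj₁ R
  col = colour F P I
  open Constants m D (# col) a using (linear; constant)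
  budget : # col + # (rr (Partial.tree P) col) ≤ suc a
  budget = ≤-trans (+-mono-≤ (#-colour F P I) (#-rr F P I)) I≤
  col-root : col (fromℕ m) ≡ true
  col-root = does-intro (Partial.name P (fromℕ m) ∈? I) (subst (_∈ˢ I) (sym (Partial.root≡ P)) r∈I)

module Eventually {v} (F : Graph v) (k a l b A A₀ : ℕ) (σ≡ : suc a ≡ σ F)
  (few : ∀ {n} (G : Graph n) → Free (F ▵) G → ∃ λ q → suc b * (suc k * l) * q ≤ suc b * n
    × 2 * ∑³ (λ x y z → 𝟙 (clique (adjacency G) x y z)) ≤ 3 * a * (n * n) + (A * n + A₀) + l * (q * n)) where

  threshold : ℕ
  threshold = suc (lead k a A A₀ + suc k * (3 * (a * a)) + a)

  module _ (n : ℕ) (large : threshold ≤ n) where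
    private
      n>0 : 1 ≤ n
      n>0 = ≤-trans (s≤s z≤n) large

      a≤n : a ≤ n
      a≤n = ≤-trans (≤-trans (m≤n+m a _) (n≤1+n _)) large

      lead≤n : lead k a A A₀ ≤ n
      lead≤n = ≤-trans (≤-trans (m≤m+n _ _) (≤-trans (m≤m+n _ a) (n≤1+n _))) large

      rest≤n : suc k * (3 * (a * a)) ≤ n
      rest≤n = ≤-trans (≤-trans (m≤n+m _ (lead k a A A₀)) (≤-trans (m≤m+n _ a) (n≤1+n _))) large

    below : suc k * length (Sbi n a) ≤ suc k * ex n (F ▵) + n * n
    below = begin
      suc k * length (Sbi n a)  ≤⟨ *-monoʳ-≤ (suc k) (lower-bound F n a (≤-reflexive σ≡) a≤n) ⟩
      suc k * (ex n (F ▵) + 3 * (a * a) * n)  ≡⟨ *-distribˡ-+ (suc k) (ex n (F ▵)) (3 * (a * a) * n) ⟩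
      suc k * ex n (F ▵) + suc k * (3 * (a * a) * n)  ≡⟨ cong (suc k * ex n (F ▵) +_) (sym (*-assoc (suc k) (3 * (a * a)) n)) ⟩
      suc k * ex n (F ▵) + suc k * (3 * (a * a)) * n  ≤⟨ +-monoʳ-≤ (suc k * ex n (F ▵)) (*-monoˡ-≤ n rest≤n) ⟩
      suc k * ex n (F ▵) + n * n  ∎
      where open ≤-Reasoning

    above : suc k * ex n (F ▵) ≤ suc k * length (Sbi n a) + n * n
    above = ex-elim (F ▵) (λ e → suc k * e ≤ suc k * length (Sbi n a) + n * n)
      (≤-trans (≤-reflexive (*-zeroʳ (suc k))) z≤n) each
      where
      each : ∀ (G : Graph n) → Free (F ▵) G → suc k * length (triangles G) ≤ suc k * length (Sbi n a) + n * n
      each G free = let q , few-hi , bound = few G free in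
        upper k a A A₀ l b n>0 lead≤n (six-triangles G) bound
          (≤-trans (≤-reflexive (sym (*-assoc (suc b) (suc k * l) q))) few-hi)
          (square-≤ n a a≤n) (≤-Sbi n a)

    close : suc k * ∣ ex n (F ▵) - length (Sbi n a) ∣ ≤ n ^ 2
    close = ≤-trans (dist-≤ (suc k) above below) (≤-reflexive (cong (n *_) (sym (*-identityʳ n))))

tree-case : ∀ {v} (F : Graph v) → IsTree F → ∀ {x y} → Graph._~_ F x y → (x , y) ∈ edges F → ∀ k →
  ∃ λ N → ∀ n → N ≤ n → suc k * ∣ ex n (F ▵) - length (Sbi n (σ F ∸ 1)) ∣ ≤ n ^ 2
tree-case F T xy xy∈ k = from (optimal F xy xy∈)
  where
  from : (∃ λ I → Independent F I × (∃ λ r → r ∈ˢ I) × crosscutSize F I ≤ σ F) → _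
  from (I , ind , (r , r∈I) , I≤σ) = Ev.threshold , Ev.close
    where
    m = proj₁ (rooting F T r)
    σ>0 : 0 < σ F
    σ>0 = <-≤-trans (<-≤-trans (#-pos r (does-intro (r ∈? I) r∈I)) (≤-reflexive (#-subset I)))
            (≤-trans (m≤m+n ∣ I ∣ (length (edgesOff F I))) I≤σ)
    σ≡ : suc (σ F ∸ 1) ≡ σ F
    σ≡ = suc-pred (σ F) {{>-nonZero σ>0}}
    -- D is the big-edge constant times (k + 1) `slope m`, so that D q ≤ (that constant) n becomes
    -- (k + 1) `slope m` q ≤ n for the number q of high vertices.
    few = tree-few F (proj₂ (rooting F T r)) I ind r∈I (σ F ∸ 1) (≤-trans I≤σ (≤-reflexive (sym σ≡)))
            (suc (pred (2 * suc (2 * m * 1))) * (suc k * slope m))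
    module Ev = Eventually F k (σ F ∸ 1) (slope m) (pred (2 * suc (2 * m * 1))) (proj₁ few) (proj₁ (proj₂ few)) σ≡ (proj₂ (proj₂ few))

theorem1p6 : ∀ {v : ℕ} (F : Graph v) → IsTree F →
    (λ n → ∣ ex n (F ▵) - length (Sbi n (σ F ∸ 1)) ∣) =o (λ n → n ^ 2)
theorem1p6 F T k = cases (edges F) refl
  where
  cases : ∀ es → edges F ≡ es →
    ∃ λ N → ∀ n → N ≤ n → suc k * ∣ ex n (F ▵) - length (Sbi n (σ F ∸ 1)) ∣ ≤ n ^ 2
  cases ((x , y) ∷ _) eq = tree-case F T (∈-edges F xy∈) xy∈ k
    where
    xy∈ : (x , y) ∈ edges F
    xy∈ = subst ((x , y) ∈_) (sym eq) (here refl)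
  -- F▵ is a single vertex, so no graph with n ≥ 1 is free and `ex` is the default 0. Here σ F = 0,
  -- the truncated σ F ∸ 1 is 0 as well, and a bipartite graph has no triangles.
  cases [] eq = 1 , λ { (suc n) _ → ≤-trans (≤-reflexive (trans (cong (suc k *_) (zero-diff n)) (*-zeroʳ (suc k)))) z≤n }
    where
    zero-diff : ∀ n → ∣ ex (suc n) (F ▵) - length (Sbi (suc n) (σ F ∸ 1)) ∣ ≡ 0
    zero-diff n = cong₂ ∣_-_∣
      (ex-elim {n = suc n} (F ▵) (_≡ 0) refl λ G free → contradiction (edgeless-copy F T eq G) free)
      (trans (cong (λ s → length (Sbi (suc n) (s ∸ 1))) (σ-edgeless F T eq)) (Sbi-0 (suc n)))
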